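{- Let $n\ge 1$ and let $A$ be an $n\times n$ matrix with rational entries. There exists a finite set $\mathcal{D}\subset \mathbb{Z}^n[A]$ such that $(A,\mathcal{D})$ is a digit system in $\mathbb{Z}^n[A]$ with the finiteness property if and only if $A$ has no (complex) eigenvalue $\lambda$ with $|\lambda|<1$. Moreover, when this condition holds, the digit set $\mathcal{D}$ can be chosen to be a subset of $\mathbb{Z}^n$.
   Context: For $A\in M_n(\mathbb{Q})$, define the $\mathbb{Z}$-module $\mathbb{Z}^n[A]:=\bigcup_{k=1}^{\infty}\left(\mathbb{Z}^n + A\mathbb{Z}^n+\dots+A^{k-1}\mathbb{Z}^n\right)$, the smallest $A$-invariant $\mathbb{Z}$-module containing $\mathbb{Z}^n$. For a finite set $\mathcal{D}\subset\mathbb{Z}^n[A]$, the pair $(A,\mathcal{D})$ is called a digit system in $\mathbb{Z}^n[A]$, and $\mathcal{D}[A]:=\{\mathbf{d}_0+A\mathbf{d}_1+\dots+A^k\mathbf{d}_k : k\ge 0,\ \mathbf{d}_j\in\mathcal{D}\}$. The digit system has the finiteness property if $\mathcal{D}[A]=\mathbb{Z}^n[A]$, i.e., every $\mathbf{z}\in\mathbb{Z}^n[A]$ can be written as $\mathbf{z}=\mathbf{d}_0+A\mathbf{d}_1+\dots+A^k\mathbf{d}_k$ for some $k\in\mathbb{N}$ and $\mathbf{d}_j\in\mathcal{D}$. -}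

module Defs where

open import Data.Nat as ℕ using (ℕ; zero; suc)
open import Data.Integer using (ℤ; +_)
open import Data.Rational using (ℚ; 0ℚ; _+_; _*_; _-_; ∣_∣; _≤_; _/_)
open import Data.Fin using (Fin; zero; suc)
open import Data.List using (List; []; _∷_)
open import Data.List.Relation.Unary.All using (All)
open import Data.List.Relation.Unary.Any using (Any)
open import Data.Product using (Σ; ∃; ∃-syntax; _×_)
open import Data.Sum using (_⊎_)
open import Relation.Binary.PropositionalEquality using (_≡_)

Vecℚ : ℕ → Set
Vecℚ n = Fin n → ℚ

Mat : ℕ → Set
Mat n = Fin n → Fin n → ℚ

sumF : ∀ {n} → (Fin n → ℚ) → ℚ
sumF {zero}  f = 0ℚ
sumF {suc n} f = f zero + sumF (λ i → f (suc i))

_·_ : ∀ {n} → Mat n → Vecℚ n → Vecℚ n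
(A · v) i = sumF (λ j → A i j * v j)

_⊕_ : ∀ {n} → Vecℚ n → Vecℚ n → Vecℚ n
(v ⊕ w) i = v i + w i

_≈_ : ∀ {n} → Vecℚ n → Vecℚ n → Set
v ≈ w = ∀ i → v i ≡ w i

Integral : ∀ {n} → Vecℚ n → Set
Integral v = ∀ i → ∃[ z ] (v i ≡ z / 1)

horner : ∀ {n} → Mat n → Vecℚ n → List (Vecℚ n) → Vecℚ n
horner A d []        = d
horner A d (e ∷ es)  = d ⊕ (A · horner A e es)

InZA : ∀ {n} → Mat n → Vecℚ n → Set
InZA {n} A v = Σ (Vecℚ n) λ z → Σ (List (Vecℚ n)) λ zs →
  Integral z × All Integral zs × v ≈ horner A z zs

_∈ᵥ_ : ∀ {n} → Vecℚ n → List (Vecℚ n) → Set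
d ∈ᵥ D = Any (λ e → e ≈ d) D

InDA : ∀ {n} → Mat n → List (Vecℚ n) → Vecℚ n → Set
InDA {n} A D v = Σ (Vecℚ n) λ d → Σ (List (Vecℚ n)) λ ds →
  d ∈ᵥ D × All (_∈ᵥ D) ds × v ≈ horner A d ds

DigitSystem : ∀ {n} → Mat n → List (Vecℚ n) → Set
DigitSystem A D = All (InZA A) D

Finiteness : ∀ {n} → Mat n → List (Vecℚ n) → Set
Finiteness {n} A D =
  (∀ (v : Vecℚ n) → InZA A v → InDA A D v) × (∀ (v : Vecℚ n) → InDA A D v → InZA A v)

IsCauchy : (ℕ → ℚ) → Set
IsCauchy s = ∀ (m : ℕ) → ∃[ N ] ∀ p q → N ℕ.≤ p → N ℕ.≤ q →
  ∣ s p - s q ∣ ≤ (+ 1 / suc m)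

record ℝ : Set where
  constructor mkℝ
  field
    seq    : ℕ → ℚ
    cauchy : IsCauchy seq
open ℝ public

Null : (ℕ → ℚ) → Set
Null s = ∀ (m : ℕ) → ∃[ N ] ∀ p → N ℕ.≤ p → ∣ s p ∣ ≤ (+ 1 / suc m)

Apart0 : (ℕ → ℚ) → Set
Apart0 s = ∃[ m ] ∃[ N ] ∀ p → N ℕ.≤ p → (+ 1 / suc m) ≤ ∣ s p ∣

-- A has a complex eigenvalue λ = a + i b with |λ| < 1:
-- there is a nonzero eigenvector v = x + i y ∈ ℂ^n with A v = λ v, i.e.
--   A x = a x - b y,  A y = b x + a y  (equalities of real numbers),
-- some component of x or y is nonzero, and a² + b² < 1.
HasSmallEigenvalue : ∀ {n} → Mat n → Set
HasSmallEigenvalue {n} A =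
  Σ ℝ λ a → Σ ℝ λ b → Σ (Fin n → ℝ) λ x → Σ (Fin n → ℝ) λ y →
    (∀ i → Null (λ k → (A · (λ j → seq (x j) k)) i
                        - (seq a k * seq (x i) k - seq b k * seq (y i) k)))
  × (∀ i → Null (λ k → (A · (λ j → seq (y j) k)) i
                        - (seq b k * seq (x i) k + seq a k * seq (y i) k)))
  × (∃[ i ] (Apart0 (seq (x i)) ⊎ Apart0 (seq (y i))))
  × (∃[ m ] ∃[ N ] ∀ k → N ℕ.≤ k →
       (seq a k * seq a k + seq b k * seq b k) + (+ 1 / suc m) ≤ (+ 1 / 1))

{-# OPTIONS --safe #-}

-- Let P be the minimal polynomial of A and put Q_λ(x) = (P(x) - P(λ)) / (x - λ), so that
-- A Q_λ(A) = Q_λ(A) A = λ Q_λ(A) - P(λ), while Q_λ(A) ≠ 0.  Hence Q_λ(A) supplies both right and left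
-- eigenvectors for a root λ of P.
--
-- If |λ| < 1 and D is a digit set, then Q_λ(A)(d₀ + A d₁ + …) = Σ λ^j Q_λ(A) d_j is bounded, so
-- Q_λ(A) vanishes on the multiples N e_l up to a bounded error and is therefore zero.
--
-- Conversely, if all roots of P satisfy |λ| ≥ 1, then with μ = 1/λ each factor x - λ divides
-- 1 - (μ x + … + μ^k x^k)/k, and the product of these polynomials is a multiple of P of the form
-- 1 + (coefficients as small as we please).  Evaluated at A this writes every z ∈ ℤⁿ as Σ A^j w_j with
-- rational |w_j| ≤ 1; rounding the w_j to integers congruent to the current remainder, while feeding
-- the rounding error back, keeps all digits and remainders in one fixed box of ℤⁿ.
--
-- Complex roots are only ever approximated by Gaussian rationals: Kneser's descent step gives
-- approximate roots and then approximate factorisations of P; a small approximate root is refined to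
-- a Cauchy sequence, i.e. to a genuine small eigenvalue.

module Submission where

open import Defs
open import Algebra.Bundles using (CommutativeRing)
open import Data.Empty using (⊥; ⊥-elim)
open import Data.Fin using (Fin; zero; suc; punchIn; punchOut; remQuot; combine)
open import Data.Fin.Properties using (any?; punchIn-punchOut; remQuot-combine) renaming (_≟_ to _≟ᶠ_)
open import Data.Integer as ℤ using (ℤ; -[1+_])
import Data.Integer.DivMod as ℤ÷
import Data.Integer.Properties as ℤₚ
open import Data.Integer.Tactic.RingSolver using () renaming (ring to ℤ-ring)
open import Data.List as List using (List; []; _∷_; length; concatMap)
open import Data.List.Relation.Unary.All as All using (All; []; _∷_)
import Data.List.Relation.Unary.All.Properties as Allₚ
open import Data.List.Relation.Unary.Any as Any using (Any; here; there)
import Data.List.Relation.Unary.Any.Properties as Anyₚ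
open import Data.Maybe using (Maybe; just; nothing)
open import Data.Nat as ℕ using (ℕ; zero; suc)
import Data.Nat.Divisibility as ℕ∣
import Data.Nat.Properties as ℕₚ
open import Data.Product using (Σ; ∃-syntax; _×_; _,_; proj₁; proj₂)
open import Data.Rational
open import Data.Rational.Properties
open import Data.Rational.Unnormalised as ℚᵘ using (mkℚᵘ; *≡*)
import Data.Rational.Unnormalised.Properties as ℚᵘₚ
open import Data.Sum using (_⊎_; inj₁; inj₂)
open import Data.Vec as Vec using (Vec; []; _∷_)
open import Data.Vec.Relation.Unary.All as VAll using ([]; _∷_)
open import Relation.Binary.PropositionalEquality
open import Relation.Nullary using (Dec; yes; no; ¬_; ¬?)
open import Relation.Nullary.Decidable using (from-no; decidable-stable)
open import Tactic.RingSolver using (solve-∀)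
open import Tactic.RingSolver.Core.AlmostCommutativeRing using (AlmostCommutativeRing; fromCommutativeRing)

-- Ordered field arithmetic in ℚ

-- Three obstacles shape the details. First, Q_λ(A) ≠ 0 has to survive replacing λ by an
-- approximation. Elimination therefore yields not just the minimal degree but a linear functional
-- equal to 1 on every monic polynomial of degree deg P - 1 in A; so Q_z(A) has an entry bounded
-- below uniformly in z, and both directions rest on this.
--
-- Second, Kneser's step calls for k-th roots, which ℚ(i) lacks. A few powers of one rational point
-- on the unit circle replace them, at the cost of a factor depending only on the degree.
--
-- Third, for roots on the unit circle the powers of μ do not decay; only their average over k terms
-- has small coefficients. Approximate roots may even lie slightly inside the circle, but |μ| ≤ 1 +
-- 1/(2k) keeps the powers up to exponent k below 2. The bound on the cofactor then depends on k and
-- the degree alone, so the precision of the factorisation can be fixed after it. A root further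
-- inside is refined to a small eigenvalue, which is excluded by hypothesis: the case distinction
-- compares rational numbers only.

ℚ-ring : AlmostCommutativeRing _ _
ℚ-ring = fromCommutativeRing +-*-commutativeRing zero?
  where
  zero? : ∀ x → Maybe (0ℚ ≡ x)
  zero? x with 0ℚ ≟ x
  ... | yes p = just p
  ... | no _ = nothing

≤-by : ∀ {a b e} → 0ℚ ≤ e → b ≡ a + e → a ≤ b
≤-by {a} {b} {e} 0≤e refl = subst (_≤ a + e) (+-identityʳ a) (+-monoʳ-≤ a 0≤e)

≤⇒0≤ : ∀ {a b} → a ≤ b → 0ℚ ≤ b - a
≤⇒0≤ {a} {b} a≤b = subst (_≤ b - a) (+-inverseʳ a) (+-monoˡ-≤ (- a) a≤b)

0≤+ : ∀ {a b} → 0ℚ ≤ a → 0ℚ ≤ b → 0ℚ ≤ a + b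
0≤+ = +-mono-≤

0≤* : ∀ {a b} → 0ℚ ≤ a → 0ℚ ≤ b → 0ℚ ≤ a * b
0≤* {a} {b} p q = nonNegative⁻¹ (a * b) {{nonNeg*nonNeg⇒nonNeg a {{nonNegative p}} b {{nonNegative q}}}}

0<+ : ∀ {a b} → 0ℚ < a → 0ℚ ≤ b → 0ℚ < a + b
0<+ = +-mono-<-≤

0<* : ∀ {a b} → 0ℚ < a → 0ℚ < b → 0ℚ < a * b
0<* {a} {b} p q = positive⁻¹ (a * b) {{pos*pos⇒pos a {{positive p}} b {{positive q}}}}

0≤sq : ∀ a → 0ℚ ≤ a * a
0≤sq a with ≤-total 0ℚ a
... | inj₁ p = 0≤* p p
... | inj₂ p = subst (0ℚ ≤_) (neg² a) (0≤* (neg-antimono-≤ p) (neg-antimono-≤ p))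
  where
  neg² : ∀ a → (- a) * (- a) ≡ a * a
  neg² = solve-∀ ℚ-ring

*-monoʳ : ∀ {a b} c → 0ℚ ≤ c → a ≤ b → a * c ≤ b * c
*-monoʳ c p = *-monoʳ-≤-nonNeg c {{nonNegative p}}

*-monoˡ : ∀ {a b} c → 0ℚ ≤ c → a ≤ b → c * a ≤ c * b
*-monoˡ c p = *-monoˡ-≤-nonNeg c {{nonNegative p}}

*-mono : ∀ {a b c d} → 0ℚ ≤ a → a ≤ b → 0ℚ ≤ c → c ≤ d → a * c ≤ b * d
*-mono {a} {b} {c} p q r s = ≤-trans (*-monoʳ c r q) (*-monoˡ b (≤-trans p q) s)

*-cancelʳ : ∀ {a b} c → 0ℚ < c → a * c ≤ b * c → a ≤ b
*-cancelʳ c p = *-cancelʳ-≤-pos c {{positive p}}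

inv⁺ : ∀ {p} → 0ℚ < p → Σ ℚ λ q → 0ℚ < q × p * q ≡ 1ℚ
inv⁺ {p} 0<p = _ , positive⁻¹ _ {{1/pos⇒pos p {{positive 0<p}}}} , *-inverseʳ p {{>-nonZero 0<p}}

inv≢ : ∀ {p} → p ≢ 0ℚ → Σ ℚ λ q → p * q ≡ 1ℚ
inv≢ {p} p≢0 = _ , *-inverseʳ p {{≢-nonZero p≢0}}

sq-cancel : ∀ {x y} → 0ℚ ≤ y → x * x ≤ y * y → x ≤ y
sq-cancel {x} {y} 0≤y le = ≮⇒≥ λ y<x → <-irrefl refl (<-≤-trans
  (≤-<-trans (*-monoˡ y 0≤y (<⇒≤ y<x)) (*-monoˡ-<-pos x {{positive (≤-<-trans 0≤y y<x)}} y<x)) le)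

-- Integers and natural numbers inside ℚ

int-+ : ∀ x y → x / 1 + y / 1 ≡ (x ℤ.+ y) / 1
int-+ x y = toℚᵘ-injective (ℚᵘₚ.≃-trans (toℚᵘ-homo-+ (x / 1) (y / 1))
  (ℚᵘₚ.≃-trans (ℚᵘₚ.+-cong (toℚᵘ-fromℚᵘ (mkℚᵘ x 0)) (toℚᵘ-fromℚᵘ (mkℚᵘ y 0)))
  (ℚᵘₚ.≃-trans (*≡* (cong (ℤ._* ℤ.+ 1) (cong₂ ℤ._+_ (ℤₚ.*-identityʳ x) (ℤₚ.*-identityʳ y))))
    (ℚᵘₚ.≃-sym (toℚᵘ-fromℚᵘ (mkℚᵘ (x ℤ.+ y) 0))))))

int-* : ∀ x y → x / 1 * (y / 1) ≡ (x ℤ.* y) / 1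
int-* x y = toℚᵘ-injective (ℚᵘₚ.≃-trans (toℚᵘ-homo-* (x / 1) (y / 1))
  (ℚᵘₚ.≃-trans (ℚᵘₚ.*-cong (toℚᵘ-fromℚᵘ (mkℚᵘ x 0)) (toℚᵘ-fromℚᵘ (mkℚᵘ y 0)))
    (ℚᵘₚ.≃-sym (toℚᵘ-fromℚᵘ (mkℚᵘ (x ℤ.* y) 0)))))

-- Defined by recursion so that `ι (suc n)` unfolds to `1ℚ + ι n`, the form used in polynomial
-- identities.
ι : ℕ → ℚ
ι zero = 0ℚ
ι (suc n) = 1ℚ + ι n

ι-/ : ∀ n → ι n ≡ ℤ.+ n / 1
ι-/ zero = refl
ι-/ (suc n) = trans (cong (λ x → 1ℚ + x) (ι-/ n)) (int-+ (ℤ.+ 1) (ℤ.+ n))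

0≤ι : ∀ n → 0ℚ ≤ ι n
0≤ι zero = ≤-refl
0≤ι (suc n) = 0≤+ {1ℚ} (nonNegative⁻¹ 1ℚ) (0≤ι n)

0<1 : 0ℚ < 1ℚ
0<1 = positive⁻¹ 1ℚ

0≤1 : 0ℚ ≤ 1ℚ
0≤1 = <⇒≤ 0<1

0<ι : ∀ n → 0ℚ < ι (suc n)
0<ι n = 0<+ 0<1 (0≤ι n)

recip : ∀ m → ι (suc m) * (ℤ.+ 1 / suc m) ≡ 1ℚ
recip m = trans (cong (_* (ℤ.+ 1 / suc m)) (ι-/ (suc m))) (toℚᵘ-injective (ℚᵘₚ.≃-trans (toℚᵘ-homo-* (ℤ.+ suc m / 1) (ℤ.+ 1 / suc m))
  (ℚᵘₚ.≃-trans (ℚᵘₚ.*-cong (toℚᵘ-fromℚᵘ (mkℚᵘ (ℤ.+ suc m) 0)) (toℚᵘ-fromℚᵘ (mkℚᵘ (ℤ.+ 1) m)))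
    (*≡* (cong ℤ.+_ (trans (trans (ℕₚ.*-identityʳ _) (ℕₚ.*-identityʳ _)) (sym (trans (ℕₚ.*-identityˡ _) (ℕₚ.*-identityˡ _)))))))))

0<recip : ∀ m → 0ℚ < ℤ.+ 1 / suc m
0<recip m = positive⁻¹ _ {{normalize-pos 1 (suc m)}}

recip≤1 : ∀ m → ℤ.+ 1 / suc m ≤ 1ℚ
recip≤1 m = ≤-by (0≤* (0≤ι m) (<⇒≤ (0<recip m))) (trans (sym (recip m)) (eq (ι m) (ℤ.+ 1 / suc m)))
  where
  eq : ∀ n r → (1ℚ + n) * r ≡ r + n * r
  eq = solve-∀ ℚ-ring

p≤∣p∣ : ∀ p → p ≤ ∣ p ∣
p≤∣p∣ p with ≤-total 0ℚ p
... | inj₁ q = ≤-reflexive (sym (0≤p⇒∣p∣≡p q))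
... | inj₂ q = ≤-trans q (0≤∣p∣ p)

den-num : ∀ p → ι (↧ₙ p) * p ≡ (↥ p) / 1
den-num p@(mkℚ n d c) = trans (cong₂ _*_ (ι-/ (suc d)) (sym (↥p/↧p≡p p)))
  (toℚᵘ-injective (ℚᵘₚ.≃-trans (toℚᵘ-homo-* (ℤ.+ suc d / 1) (n / suc d))
  (ℚᵘₚ.≃-trans (ℚᵘₚ.*-cong (toℚᵘ-fromℚᵘ (mkℚᵘ (ℤ.+ suc d) 0)) (toℚᵘ-fromℚᵘ (mkℚᵘ n d)))
  (ℚᵘₚ.≃-trans (*≡* (trans (ℤₚ.*-identityʳ (ℤ.+ suc d ℤ.* n)) (trans (ℤₚ.*-comm (ℤ.+ suc d) n)
     (cong (n ℤ.*_) (sym (ℤₚ.*-identityˡ (ℤ.+ suc d)))))))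
    (ℚᵘₚ.≃-sym (toℚᵘ-fromℚᵘ (mkℚᵘ n 0)))))))

archimedean : ∀ q → Σ ℕ λ n → q ≤ ι n
archimedean q@(mkℚ n d c) = ℤ.∣ n ∣ , subst (q ≤_) (sym (ι-/ ℤ.∣ n ∣)) (toℚᵘ-cancel-≤
  (ℚᵘₚ.≤-trans (ℚᵘ.*≤* (le n)) (ℚᵘₚ.≤-reflexive (ℚᵘₚ.≃-sym (toℚᵘ-fromℚᵘ (mkℚᵘ (ℤ.+ ℤ.∣ n ∣) 0))))))
  where
  le : ∀ n → n ℤ.* ℤ.+ 1 ℤ.≤ ℤ.+ ℤ.∣ n ∣ ℤ.* ℤ.+ suc d
  le (ℤ.+ m) = ℤₚ.≤-trans (ℤₚ.≤-reflexive (sym (ℤₚ.pos-* m 1))) (ℤₚ.≤-trans (ℤ.+≤+ (ℕₚ.*-monoʳ-≤ m (ℕ.s≤s ℕ.z≤n))) (ℤₚ.≤-reflexive (ℤₚ.pos-* m (suc d))))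
  le -[1+ m ] = ℤ.-≤+

archimedean⁻ : ∀ {ε} → 0ℚ < ε → Σ ℕ λ m → ℤ.+ 1 / suc m ≤ ε
archimedean⁻ {ε} 0<ε with inv⁺ 0<ε
... | δ , 0<δ , εδ≡1 with archimedean δ
...   | m , δ≤m = m , *-cancelʳ (ι (suc m)) (0<ι m) (subst₂ _≤_ (sym (trans (*-comm _ (ι (suc m))) (recip m))) refl
          (≤-trans (≤-reflexive (sym εδ≡1)) (*-monoˡ ε (<⇒≤ 0<ε) (≤-trans δ≤m (≤-by 0≤1 (+-comm 1ℚ (ι m)))))))

-- Gaussian rationals

record ℂ : Set where
  no-eta-equality; pattern
  constructor _+i_
  field
    re im : ℚ
open ℂ public

infixl 6 _+ᶜ_ _-ᶜ_
infixl 7 _*ᶜ_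
infix 8 -ᶜ_

_+ᶜ_ _*ᶜ_ : ℂ → ℂ → ℂ
(a +i b) +ᶜ (c +i d) = (a + c) +i (b + d)
(a +i b) *ᶜ (c +i d) = (a * c - b * d) +i (a * d + b * c)

-ᶜ_ : ℂ → ℂ
-ᶜ (a +i b) = (- a) +i (- b)

_-ᶜ_ : ℂ → ℂ → ℂ
z -ᶜ w = z +ᶜ (-ᶜ w)

⟦_⟧ : ℚ → ℂ
⟦ q ⟧ = q +i 0ℚ

0ᶜ 1ᶜ : ℂ
0ᶜ = ⟦ 0ℚ ⟧
1ᶜ = ⟦ 1ℚ ⟧

re-* : ∀ z w → re (z *ᶜ w) ≡ re z * re w - im z * im w
re-* (_ +i _) (_ +i _) = refl

im-* : ∀ z w → im (z *ᶜ w) ≡ re z * im w + im z * re w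
im-* (_ +i _) (_ +i _) = refl

re-+ : ∀ z w → re (z +ᶜ w) ≡ re z + re w
re-+ (_ +i _) (_ +i _) = refl

im-+ : ∀ z w → im (z +ᶜ w) ≡ im z + im w
im-+ (_ +i _) (_ +i _) = refl

re-neg : ∀ z → re (-ᶜ z) ≡ - re z
re-neg (_ +i _) = refl

im-neg : ∀ z → im (-ᶜ z) ≡ - im z
im-neg (_ +i _) = refl

ℂ-commutativeRing : CommutativeRing _ _
ℂ-commutativeRing = record
  { Carrier = ℂ ; _≈_ = _≡_ ; _+_ = _+ᶜ_ ; _*_ = _*ᶜ_ ; -_ = -ᶜ_ ; 0# = 0ᶜ ; 1# = 1ᶜ
  ; isCommutativeRing = record
    { isRing = record
      { +-isAbelianGroup = record
        { isGroup = record
          { isMonoid = record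
            { isSemigroup = record
              { isMagma = record { isEquivalence = isEquivalence ; ∙-cong = cong₂ _+ᶜ_ }
              ; assoc = λ { (a +i b) (c +i d) (e +i f) → cong₂ _+i_ (+-assoc a c e) (+-assoc b d f) } }
            ; identity = (λ { (a +i b) → cong₂ _+i_ (+-identityˡ a) (+-identityˡ b) })
                       , (λ { (a +i b) → cong₂ _+i_ (+-identityʳ a) (+-identityʳ b) }) }
          ; inverse = (λ { (a +i b) → cong₂ _+i_ (+-inverseˡ a) (+-inverseˡ b) })
                    , (λ { (a +i b) → cong₂ _+i_ (+-inverseʳ a) (+-inverseʳ b) })
          ; ⁻¹-cong = cong (λ z → -ᶜ z) }
        ; comm = λ { (a +i b) (c +i d) → cong₂ _+i_ (+-comm a c) (+-comm b d) } }
      ; *-cong = cong₂ _*ᶜ_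
      ; *-assoc = λ { (a +i b) (c +i d) (e +i f) → cong₂ _+i_ (assoc-re a b c d e f) (assoc-im a b c d e f) }
      ; *-identity = (λ { (a +i b) → cong₂ _+i_ (idˡ-re a b) (idˡ-im a b) })
                   , (λ { (a +i b) → cong₂ _+i_ (idʳ-re a b) (idʳ-im a b) })
      ; distrib = (λ { (a +i b) (c +i d) (e +i f) → cong₂ _+i_ (distˡ-re a b c d e f) (distˡ-im a b c d e f) })
                , (λ { (a +i b) (c +i d) (e +i f) → cong₂ _+i_ (distʳ-re a b c d e f) (distʳ-im a b c d e f) }) }
    ; *-comm = λ { (a +i b) (c +i d) → cong₂ _+i_ (comm-re a b c d) (comm-im a b c d) } } }
  where
  assoc-re : ∀ a b c d e f → (a * c - b * d) * e - (a * d + b * c) * f ≡ a * (c * e - d * f) - b * (c * f + d * e)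
  assoc-re = solve-∀ ℚ-ring
  assoc-im : ∀ a b c d e f → (a * c - b * d) * f + (a * d + b * c) * e ≡ a * (c * f + d * e) + b * (c * e - d * f)
  assoc-im = solve-∀ ℚ-ring
  idˡ-re : ∀ a b → 1ℚ * a - 0ℚ * b ≡ a
  idˡ-re = solve-∀ ℚ-ring
  idˡ-im : ∀ a b → 1ℚ * b + 0ℚ * a ≡ b
  idˡ-im = solve-∀ ℚ-ring
  idʳ-re : ∀ a b → a * 1ℚ - b * 0ℚ ≡ a
  idʳ-re = solve-∀ ℚ-ring
  idʳ-im : ∀ a b → a * 0ℚ + b * 1ℚ ≡ b
  idʳ-im = solve-∀ ℚ-ring
  distˡ-re : ∀ a b c d e f → a * (c + e) - b * (d + f) ≡ (a * c - b * d) + (a * e - b * f)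
  distˡ-re = solve-∀ ℚ-ring
  distˡ-im : ∀ a b c d e f → a * (d + f) + b * (c + e) ≡ (a * d + b * c) + (a * f + b * e)
  distˡ-im = solve-∀ ℚ-ring
  distʳ-re : ∀ a b c d e f → (c + e) * a - (d + f) * b ≡ (c * a - d * b) + (e * a - f * b)
  distʳ-re = solve-∀ ℚ-ring
  distʳ-im : ∀ a b c d e f → (c + e) * b + (d + f) * a ≡ (c * b + d * a) + (e * b + f * a)
  distʳ-im = solve-∀ ℚ-ring
  comm-re : ∀ a b c d → a * c - b * d ≡ c * a - d * b
  comm-re = solve-∀ ℚ-ring
  comm-im : ∀ a b c d → a * d + b * c ≡ c * b + d * a
  comm-im = solve-∀ ℚ-ring

_≟ᶜ_ : ∀ (z w : ℂ) → Dec (z ≡ w)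
(a +i b) ≟ᶜ (c +i d) with a ≟ c | b ≟ d
... | yes refl | yes refl = yes refl
... | no p | _ = no λ { refl → p refl }
... | _ | no p = no λ { refl → p refl }

ℂ-ring : AlmostCommutativeRing _ _
ℂ-ring = fromCommutativeRing ℂ-commutativeRing zero?
  where
  zero? : ∀ x → Maybe (0ᶜ ≡ x)
  zero? x with 0ᶜ ≟ᶜ x
  ... | yes p = just p
  ... | no _ = nothing

N : ℂ → ℚ
N z = re z * re z + im z * im z

0≤N : ∀ z → 0ℚ ≤ N z
0≤N z = 0≤+ (0≤sq (re z)) (0≤sq (im z))

N-* : ∀ z w → N (z *ᶜ w) ≡ N z * N w
N-* (a +i b) (c +i d) = eq a b c d
  where
  eq : ∀ a b c d → (a * c - b * d) * (a * c - b * d) + (a * d + b * c) * (a * d + b * c) ≡ (a * a + b * b) * (c * c + d * d)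
  eq = solve-∀ ℚ-ring

-- |z| ≤ r stated through squares, because moduli of Gaussian rationals are in general irrational;
-- `0≤bound` excludes negative r.
infix 4 _≼_
record _≼_ (z : ℂ) (r : ℚ) : Set where
  constructor mk≼
  field
    0≤bound : 0ℚ ≤ r
    N≤ : N z ≤ r * r
open _≼_ public

≼-mono : ∀ {z r s} → z ≼ r → r ≤ s → z ≼ s
≼-mono (mk≼ p q) le = mk≼ (≤-trans p le) (≤-trans q (*-mono p le p le))

≼-* : ∀ {z w r s} → z ≼ r → w ≼ s → z *ᶜ w ≼ r * s
≼-* {z} {w} {r} {s} (mk≼ p q) (mk≼ p′ q′) = mk≼ (0≤* p p′)
  (subst₂ _≤_ (sym (N-* z w)) (eq r s) (*-mono (0≤N z) q (0≤N w) q′))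
  where
  eq : ∀ r s → r * r * (s * s) ≡ (r * s) * (r * s)
  eq = solve-∀ ℚ-ring

-- Lagrange's identity gives Cauchy-Schwarz without square roots, and this bounds the cross term
-- `a * c + b * d` by `r * s`.
≼-+ : ∀ {z w r s} → z ≼ r → w ≼ s → z +ᶜ w ≼ r + s
≼-+ {a +i b} {c +i d} {r} {s} (mk≼ p q) (mk≼ p′ q′) = mk≼ (0≤+ p p′)
  (≤-by (0≤+ (0≤+ (≤⇒0≤ q) (≤⇒0≤ q′)) (0≤+ (≤⇒0≤ cs) (≤⇒0≤ cs))) (eq a b c d r s))
  where
  eq : ∀ a b c d r s → (r + s) * (r + s) ≡ ((a + c) * (a + c) + (b + d) * (b + d))
     + (((r * r - (a * a + b * b)) + (s * s - (c * c + d * d))) + ((r * s - (a * c + b * d)) + (r * s - (a * c + b * d))))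
  eq = solve-∀ ℚ-ring
  lagrange : ∀ a b c d → (a * a + b * b) * (c * c + d * d) ≡ (a * c + b * d) * (a * c + b * d) + (a * d - b * c) * (a * d - b * c)
  lagrange = solve-∀ ℚ-ring
  sqs : ∀ r s → r * r * (s * s) ≡ (r * s) * (r * s)
  sqs = solve-∀ ℚ-ring
  cs : a * c + b * d ≤ r * s
  cs = sq-cancel (0≤* p p′) (≤-trans (≤-by (0≤sq (a * d - b * c)) (lagrange a b c d))
         (subst (_ ≤_) (sqs r s) (*-mono (0≤N (a +i b)) q (0≤N (c +i d)) q′)))

N-neg : ∀ z → N (-ᶜ z) ≡ N z
N-neg (a +i b) = eq a b
  where
  eq : ∀ a b → (- a) * (- a) + (- b) * (- b) ≡ a * a + b * b
  eq = solve-∀ ℚ-ring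

≼-neg : ∀ {z r} → z ≼ r → -ᶜ z ≼ r
≼-neg {z} (mk≼ p q) = mk≼ p (subst (_≤ _) (sym (N-neg z)) q)

≼-sub : ∀ {z w r s} → z ≼ r → w ≼ s → z -ᶜ w ≼ r + s
≼-sub p q = ≼-+ p (≼-neg q)

0≼ : ∀ {r} → 0ℚ ≤ r → 0ᶜ ≼ r
0≼ {r} p = mk≼ p (0≤sq r)

1≼1 : 1ᶜ ≼ 1ℚ
1≼1 = mk≼ 0≤1 ≤-refl

abs-sq : ∀ a → ∣ a ∣ * ∣ a ∣ ≡ a * a
abs-sq a with ∣p∣≡p∨∣p∣≡-p a
... | inj₁ e = cong₂ _*_ e e
... | inj₂ e = trans (cong₂ _*_ e e) (eq a)
  where
  eq : ∀ a → (- a) * (- a) ≡ a * a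
  eq = solve-∀ ℚ-ring

≼-re : ∀ {z r} → z ≼ r → ∣ re z ∣ ≤ r
≼-re {a +i b} (mk≼ p q) = sq-cancel p (≤-trans (≤-reflexive (abs-sq a)) (≤-trans (≤-by (0≤sq b) refl) q))

≼-im : ∀ {z r} → z ≼ r → ∣ im z ∣ ≤ r
≼-im {a +i b} (mk≼ p q) = sq-cancel p (≤-trans (≤-reflexive (abs-sq b)) (≤-trans (≤-by (0≤sq a) (+-comm (a * a) (b * b))) q))

-- The 1-norm: a rational quantity that dominates the modulus and commutes with scaling by
-- nonnegative rationals.
‖_‖ : ℂ → ℚ
‖ z ‖ = ∣ re z ∣ + ∣ im z ∣

0≤‖‖ : ∀ z → 0ℚ ≤ ‖ z ‖
0≤‖‖ z = 0≤+ (0≤∣p∣ (re z)) (0≤∣p∣ (im z))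

≼‖‖ : ∀ z → z ≼ ‖ z ‖
≼‖‖ z@(a +i b) = mk≼ (0≤‖‖ z) (≤-by (0≤+ {∣ a ∣ * ∣ b ∣} (0≤* (0≤∣p∣ a) (0≤∣p∣ b)) (0≤* (0≤∣p∣ a) (0≤∣p∣ b)))
   (trans (eq ∣ a ∣ ∣ b ∣) (cong (_+ (∣ a ∣ * ∣ b ∣ + ∣ a ∣ * ∣ b ∣)) (cong₂ _+_ (abs-sq a) (abs-sq b)))))
  where
  eq : ∀ a b → (a + b) * (a + b) ≡ (a * a + b * b) + (a * b + a * b)
  eq = solve-∀ ℚ-ring

re≼ : ∀ {a r} → ∣ a ∣ ≤ r → ⟦ a ⟧ ≼ r
re≼ {a} {r} p = mk≼ (≤-trans (0≤∣p∣ a) p) (≤-trans (≤-reflexive (trans (+-identityʳ (a * a)) (sym (abs-sq a)))) (*-mono (0≤∣p∣ a) p (0≤∣p∣ a) p))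

infixr 8 _^ᶜ_ _^_
_^ᶜ_ : ℂ → ℕ → ℂ
z ^ᶜ zero = 1ᶜ
z ^ᶜ suc k = z *ᶜ z ^ᶜ k

_^_ : ℚ → ℕ → ℚ
x ^ zero = 1ℚ
x ^ suc k = x * x ^ k

0≤^ : ∀ {x} k → 0ℚ ≤ x → 0ℚ ≤ x ^ k
0≤^ zero p = 0≤1
0≤^ (suc k) p = 0≤* p (0≤^ k p)

0<^ : ∀ {x} k → 0ℚ < x → 0ℚ < x ^ k
0<^ zero p = 0<1
0<^ (suc k) p = 0<* p (0<^ k p)

≼-^ : ∀ {z r} k → z ≼ r → z ^ᶜ k ≼ r ^ k
≼-^ zero p = 1≼1
≼-^ (suc k) p = ≼-* p (≼-^ k p)

^-*-distrib : ∀ z w k → (z *ᶜ w) ^ᶜ k ≡ z ^ᶜ k *ᶜ w ^ᶜ k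
^-*-distrib z w zero = refl
^-*-distrib z w (suc k) = trans (cong (z *ᶜ w *ᶜ_) (^-*-distrib z w k)) (eq z w (z ^ᶜ k) (w ^ᶜ k))
  where
  eq : ∀ a b c d → a *ᶜ b *ᶜ (c *ᶜ d) ≡ a *ᶜ c *ᶜ (b *ᶜ d)
  eq = solve-∀ ℂ-ring

inv-ℂ : ∀ {z} → z ≢ 0ᶜ → Σ ℂ λ w → z *ᶜ w ≡ 1ᶜ
inv-ℂ {a +i b} z≢0 with inv≢ {a * a + b * b} N≢0
  where
  N≢0 : a * a + b * b ≢ 0ℚ
  N≢0 e = z≢0 (cong₂ _+i_ (zero-sq a (≤-trans (≤-by (0≤sq b) refl) (≤-reflexive e)))
                          (zero-sq b (≤-trans (≤-by (0≤sq a) (+-comm (a * a) (b * b))) (≤-reflexive e))))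
    where
    zero-sq : ∀ a → a * a ≤ 0ℚ → a ≡ 0ℚ
    zero-sq a p = ∣p∣≡0⇒p≡0 a (≤-antisym (sq-cancel ≤-refl (≤-trans (≤-reflexive (abs-sq a)) p)) (0≤∣p∣ a))
... | q , e = (a * q) +i (- (b * q)) , cong₂ _+i_ (trans (eq₁ a b q) e) (eq₂ a b q)
  where
  eq₁ : ∀ a b q → a * (a * q) - b * (- (b * q)) ≡ (a * a + b * b) * q
  eq₁ = solve-∀ ℚ-ring
  eq₂ : ∀ a b q → a * (- (b * q)) + b * (a * q) ≡ 0ℚ
  eq₂ = solve-∀ ℚ-ring

-- Directions of k-th powers

int-injective : ∀ {x y} → x / 1 ≡ y / 1 → x ≡ y
int-injective {x} {y} e with fromℚᵘ-injective {mkℚᵘ x 0} {mkℚᵘ y 0} e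
... | *≡* p = trans (sym (ℤₚ.*-identityʳ x)) (trans p (ℤₚ.*-identityʳ y))

-- A rational point of the unit circle that is not a root of unity.
u : ℂ
u = (ℤ.+ 3 / 5) +i (ℤ.+ 4 / 5)

-- (3 + 4i)^k ≡ 3 + 4i modulo 5 for k ≥ 1, so no positive power of u is real.
5u^ : ∀ k → Σ ℤ λ a → Σ ℤ λ b →
  ((ℤ.+ 5 / 1) ^ suc k * re (u ^ᶜ suc k) ≡ (ℤ.+ 3 ℤ.+ ℤ.+ 5 ℤ.* a) / 1) ×
  ((ℤ.+ 5 / 1) ^ suc k * im (u ^ᶜ suc k) ≡ (ℤ.+ 4 ℤ.+ ℤ.+ 5 ℤ.* b) / 1)
5u^ zero = ℤ.+ 0 , ℤ.+ 0 , refl , refl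
5u^ (suc k) with 5u^ k
... | a , b , p , q = ℤ.- (ℤ.+ 2) ℤ.+ ℤ.+ 3 ℤ.* a ℤ.+ ℤ.- (ℤ.+ 4) ℤ.* b , ℤ.+ 4 ℤ.+ ℤ.+ 3 ℤ.* b ℤ.+ ℤ.+ 4 ℤ.* a ,
    trans (trans (cong (f ^ suc (suc k) *_) (re-* u (u ^ᶜ suc k))) (step-re f (ℤ.+ 3 / 5) (ℤ.+ 4 / 5) (f ^ suc k) x y))
      (trans (cong₂ (λ x y → (f * (ℤ.+ 3 / 5)) * x + (f * - (ℤ.+ 4 / 5)) * y) p q)
      (trans (cong₂ _+_ (int-* (ℤ.+ 3) X) (int-* (ℤ.- (ℤ.+ 4)) Y)) (trans (int-+ (ℤ.+ 3 ℤ.* X) (ℤ.- (ℤ.+ 4) ℤ.* Y)) (cong (λ t → t / 1) (z₁ a b))))) ,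
    trans (trans (cong (f ^ suc (suc k) *_) (im-* u (u ^ᶜ suc k))) (step-im f (ℤ.+ 3 / 5) (ℤ.+ 4 / 5) (f ^ suc k) x y))
      (trans (cong₂ (λ x y → (f * (ℤ.+ 3 / 5)) * y + (f * (ℤ.+ 4 / 5)) * x) p q)
      (trans (cong₂ _+_ (int-* (ℤ.+ 3) Y) (int-* (ℤ.+ 4) X)) (trans (int-+ (ℤ.+ 3 ℤ.* Y) (ℤ.+ 4 ℤ.* X)) (cong (λ t → t / 1) (z₂ a b)))))
  where
  f = ℤ.+ 5 / 1
  x = re (u ^ᶜ suc k)
  y = im (u ^ᶜ suc k)
  X = ℤ.+ 3 ℤ.+ ℤ.+ 5 ℤ.* a
  Y = ℤ.+ 4 ℤ.+ ℤ.+ 5 ℤ.* b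
  step-re : ∀ f s t m x y → f * m * (s * x - t * y) ≡ (f * s) * (m * x) + (f * - t) * (m * y)
  step-re = solve-∀ ℚ-ring
  step-im : ∀ f s t m x y → f * m * (s * y + t * x) ≡ (f * s) * (m * y) + (f * t) * (m * x)
  step-im = solve-∀ ℚ-ring
  z₁ : ∀ a b → ℤ.+ 3 ℤ.* (ℤ.+ 3 ℤ.+ ℤ.+ 5 ℤ.* a) ℤ.+ ℤ.- (ℤ.+ 4) ℤ.* (ℤ.+ 4 ℤ.+ ℤ.+ 5 ℤ.* b)
     ≡ ℤ.+ 3 ℤ.+ ℤ.+ 5 ℤ.* (ℤ.- (ℤ.+ 2) ℤ.+ ℤ.+ 3 ℤ.* a ℤ.+ ℤ.- (ℤ.+ 4) ℤ.* b)
  z₁ = solve-∀ ℤ-ring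
  z₂ : ∀ a b → ℤ.+ 3 ℤ.* (ℤ.+ 4 ℤ.+ ℤ.+ 5 ℤ.* b) ℤ.+ ℤ.+ 4 ℤ.* (ℤ.+ 3 ℤ.+ ℤ.+ 5 ℤ.* a)
     ≡ ℤ.+ 4 ℤ.+ ℤ.+ 5 ℤ.* (ℤ.+ 4 ℤ.+ ℤ.+ 3 ℤ.* b ℤ.+ ℤ.+ 4 ℤ.* a)
  z₂ = solve-∀ ℤ-ring

im-u^≢0 : ∀ k → im (u ^ᶜ suc k) ≢ 0ℚ
im-u^≢0 k e with 5u^ k
... | a , b , _ , q = from-no (5 ℕ∣.∣? 4) (ℕ∣.divides ℤ.∣ b ∣ (trans (trans (cong ℤ.∣_∣ four) (ℤₚ.∣-i∣≡∣i∣ (ℤ.+ 5 ℤ.* b))) (trans (ℤₚ.abs-* (ℤ.+ 5) b) (ℕₚ.*-comm 5 ℤ.∣ b ∣))))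
  where
  zer : ℤ.+ 4 ℤ.+ ℤ.+ 5 ℤ.* b ≡ ℤ.+ 0
  zer = int-injective (trans (sym q) (trans (cong ((ℤ.+ 5 / 1) ^ suc k *_) e) (*-zeroʳ ((ℤ.+ 5 / 1) ^ suc k))))
  four : ℤ.+ 4 ≡ ℤ.- (ℤ.+ 5 ℤ.* b)
  four = trans (eq (ℤ.+ 5 ℤ.* b)) (trans (cong (ℤ._+ (ℤ.- (ℤ.+ 5 ℤ.* b))) zer) (ℤₚ.+-identityˡ _))
    where
    eq : ∀ c → ℤ.+ 4 ≡ ℤ.+ 4 ℤ.+ c ℤ.+ ℤ.- c
    eq = solve-∀ ℤ-ring

N-^ : ∀ z k → N z ≡ 1ℚ → N (z ^ᶜ k) ≡ 1ℚ
N-^ z zero e = refl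
N-^ z (suc k) e = trans (N-* z (z ^ᶜ k)) (cong₂ _*_ e (N-^ z k e))

<⇒≢0 : ∀ {a} → 0ℚ < a → a ≢ 0ℚ
<⇒≢0 p refl = <-irrefl refl p

≢0-* : ∀ {a b} → a ≢ 0ℚ → b ≢ 0ℚ → a * b ≢ 0ℚ
≢0-* {a} {b} p q e with inv≢ p
... | c , ac≡1 = q (trans (eq a b c) (trans (cong₂ (λ x y → x * c + (1ℚ - y) * b) e ac≡1) (eq′ c b)))
  where
  eq : ∀ a b c → b ≡ (a * b) * c + (1ℚ - a * c) * b
  eq = solve-∀ ℚ-ring
  eq′ : ∀ c b → 0ℚ * c + (1ℚ - 1ℚ) * b ≡ 0ℚ
  eq′ = solve-∀ ℚ-ring

sq-pos : ∀ {a} → a ≢ 0ℚ → 0ℚ < a * a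
sq-pos {a} p with 0ℚ <? a * a
... | yes q = q
... | no q = ⊥-elim (≢0-* p p (≤-antisym (≮⇒≥ q) (0≤sq a)))

-- Squaring a number of modulus 1 and positive real part at least doubles 1 - Re.
doubling : ∀ k n s ζ → 0ℚ < s → N ζ ≡ 1ℚ → im (ζ ^ᶜ k) ≢ 0ℚ → s ≤ 1ℚ - re (ζ ^ᶜ k) →
  1ℚ ≤ 1ℚ - re (ζ ^ᶜ k) + ι n * s →
  Σ ℂ λ ξ → N ξ ≡ 1ℚ × re (ξ ^ᶜ k) ≤ 0ℚ × im (ξ ^ᶜ k) ≢ 0ℚ
doubling k n s ζ 0<s Nζ im≢ s≤ le with re (ζ ^ᶜ k) ≤? 0ℚ
... | yes p = ζ , Nζ , p , im≢
doubling k zero s ζ 0<s Nζ im≢ s≤ le | no p = ⊥-elim (p (≤-by (≤⇒0≤ le) (eq (re (ζ ^ᶜ k)) s)))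
  where
  eq : ∀ a s → 0ℚ ≡ a + (1ℚ - a + 0ℚ * s - 1ℚ)
  eq = solve-∀ ℚ-ring
doubling k (suc n) s ζ 0<s Nζ im≢ s≤ le | no p =
  -- Squaring ζ squares its k-th power. As a is positive here, the new imaginary part 2ab is
  -- nonzero; and 1 - Re grows by at least s, so n bounds the squarings still to come.
  doubling k n s (ζ *ᶜ ζ) 0<s (trans (N-* ζ ζ) (cong₂ _*_ Nζ Nζ))
    (λ e → ≢0-* (≢0-* a≢0 im≢) (<⇒≢0 0<2) (trans (eq₀ a b) (trans (sym (im-* (ζ ^ᶜ k) (ζ ^ᶜ k))) (trans (cong im (sym sq)) e))))
    (≤-trans s≤ (≤-trans (≤-by (≤-trans (<⇒≤ 0<s) s≤) refl) grow))
    (≤-trans le (≤-by (0≤+ (≤⇒0≤ s≤) (≤⇒0≤ grow)) (eq₄ (re ((ζ *ᶜ ζ) ^ᶜ k)) a s (ι n))))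
  where
  a = re (ζ ^ᶜ k)
  b = im (ζ ^ᶜ k)
  0<2 : 0ℚ < 1ℚ + 1ℚ
  0<2 = 0<+ 0<1 0≤1
  0≤a : 0ℚ ≤ a
  0≤a = <⇒≤ (≰⇒> p)
  a≢0 : a ≢ 0ℚ
  a≢0 e = p (≤-reflexive e)
  sq : (ζ *ᶜ ζ) ^ᶜ k ≡ ζ ^ᶜ k *ᶜ ζ ^ᶜ k
  sq = ^-*-distrib ζ ζ k
  eq₀ : ∀ a b → a * b * (1ℚ + 1ℚ) ≡ a * b + b * a
  eq₀ = solve-∀ ℚ-ring
  eq₂ : ∀ a b → (1ℚ - (a * a - b * b)) ≡ ((1ℚ - a) + (1ℚ - a)) + ((1ℚ - a) * a + (1ℚ - a) * a + ((a * a + b * b) - 1ℚ))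
  eq₂ = solve-∀ ℚ-ring
  eq₄ : ∀ c a s n → 1ℚ - c + n * s ≡ (1ℚ - a + (1ℚ + n) * s) + ((1ℚ - a - s) + (1ℚ - c - ((1ℚ - a) + (1ℚ - a))))
  eq₄ = solve-∀ ℚ-ring
  Nv : a * a + b * b ≡ 1ℚ
  Nv = N-^ ζ k Nζ
  0≤1-a : 0ℚ ≤ 1ℚ - a
  0≤1-a = ≤-trans (<⇒≤ 0<s) s≤
  grow : (1ℚ - a) + (1ℚ - a) ≤ 1ℚ - re ((ζ *ᶜ ζ) ^ᶜ k)
  grow = ≤-by (0≤+ (0≤+ (0≤* 0≤1-a 0≤a) (0≤* 0≤1-a 0≤a)) (≤-reflexive (sym (trans (cong (_- 1ℚ) Nv) (+-inverseʳ 1ℚ)))))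
    (trans (cong (λ w → 1ℚ - w) (trans (cong re sq) (re-* (ζ ^ᶜ k) (ζ ^ᶜ k)))) (eq₂ a b))

unit-re<1 : ∀ {a b} → a * a + b * b ≡ 1ℚ → b ≢ 0ℚ → 0ℚ < 1ℚ - a
unit-re<1 {a} {b} e b≢0 = ≰⇒> λ p → <-irrefl refl (<-≤-trans (sq-pos b≢0)
  (≤-by (0≤+ (neg-antimono-≤ p) (0≤+ (neg-antimono-≤ p) (0≤sq (1ℚ - a)))) (trans (sym (+-inverseʳ 1ℚ)) (trans (cong (_- 1ℚ) (sym e)) (eq a b) ))))
  where
  eq : ∀ a b → a * a + b * b - 1ℚ ≡ b * b + (- (1ℚ - a) + (- (1ℚ - a) + (1ℚ - a) * (1ℚ - a)))
  eq = solve-∀ ℚ-ring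

-- Repeated squaring of `u` brings its (k+1)-th power into the left half-plane and keeps it off the
-- real axis, the two properties that `Directions` asks of v. The number of squarings is bounded
-- through 1/s.
quarter-turn : ∀ k → Σ ℂ λ ξ → N ξ ≡ 1ℚ × re (ξ ^ᶜ suc k) ≤ 0ℚ × im (ξ ^ᶜ suc k) ≢ 0ℚ
quarter-turn k = doubling (suc k) (proj₁ n) s u 0<s refl (im-u^≢0 k) ≤-refl
    (≤-trans (≤-reflexive (sym (proj₂ (proj₂ t)))) (≤-trans (*-monoˡ s (<⇒≤ 0<s) (proj₂ n)) (≤-by (<⇒≤ 0<s) (eq s (ι (proj₁ n))))))
  where
  s = 1ℚ - re (u ^ᶜ suc k)
  0<s : 0ℚ < s
  0<s = unit-re<1 {re (u ^ᶜ suc k)} {im (u ^ᶜ suc k)} (N-^ u (suc k) refl) (im-u^≢0 k)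
  t = inv⁺ 0<s
  n = archimedean (proj₁ t)
  eq : ∀ s n → s + n * s ≡ s * n + s
  eq = solve-∀ ℚ-ring

abs-≤ : ∀ {a r} → - r ≤ a → a ≤ r → ∣ a ∣ ≤ r
abs-≤ {a} {r} p q with ∣p∣≡p∨∣p∣≡-p a
... | inj₁ e = ≤-trans (≤-reflexive e) q
... | inj₂ e = ≤-trans (≤-reflexive e) (≤-trans (neg-antimono-≤ p) (≤-reflexive (eq r)))
  where
  eq : ∀ r → - - r ≡ r
  eq = solve-∀ ℚ-ring

-- For each c one of 1, v, v², v³ turns c to the left by a definite amount: the real parts of c, cv,
-- cv², cv³ obey a recurrence that does not let all of them stay above a small negative number
-- unless c = 0.
module Directions (v : ℂ) (Nv : N v ≡ 1ℚ) (a≤0 : re v ≤ 0ℚ) (b≢0 : im v ≢ 0ℚ) where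
  a = re v
  b = im v
  β = ∣ b ∣
  -- The estimates in `none` add up to 9t, so any factor below 1/9 would do.
  κ = β * (ℤ.+ 1 / 10)

  0<β : 0ℚ < β
  0<β = ≰⇒> λ p → b≢0 (∣p∣≡0⇒p≡0 b (≤-antisym p (0≤∣p∣ b)))

  0<κ : 0ℚ < κ
  0<κ = 0<* 0<β (positive⁻¹ (ℤ.+ 1 / 10))

  v≼1 : v ≼ 1ℚ
  v≼1 = mk≼ 0≤1 (≤-reflexive Nv)

  β≤1 : β ≤ 1ℚ
  β≤1 = ≼-im v≼1

  α = - a

  0≤α : 0ℚ ≤ α
  0≤α = neg-antimono-≤ a≤0

  α≤1 : α ≤ 1ℚ
  α≤1 = sq-cancel 0≤1 (≤-by (0≤sq b) (trans (sym Nv) (eq a b)))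
    where
    eq : ∀ a b → a * a + b * b ≡ - a * - a + b * b
    eq = solve-∀ ℚ-ring

  s₁ s₂ s₃ : ℂ → ℚ
  s₁ c = re (c *ᶜ v)
  s₂ c = re (c *ᶜ (v *ᶜ v))
  s₃ c = re (c *ᶜ (v *ᶜ (v *ᶜ v)))

  -- On the unit circle v is a root of x² + 2αx + 1, because α = - Re v and |v|² = 1.
  rec : ∀ c → re (c *ᶜ (v *ᶜ v)) + (α + α) * re (c *ᶜ v) + re c ≡ 0ℚ
  rec c = trans (cong₂ (λ x y → x + (α + α) * y + re c) (trans (re-* c (v *ᶜ v)) (cong₂ (λ x y → re c * x - im c * y) (re-* v v) (im-* v v))) (re-* c v))
             (trans (eq a b p q) (trans (cong (λ n → p * (1ℚ - n)) Nv) (eq′ p)))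
    where
    p = re c
    q = im c
    eq : ∀ a b p q → p * (a * a - b * b) - q * (a * b + b * a) + (- a + - a) * (p * a - q * b) + p ≡ p * (1ℚ - (a * a + b * b))
    eq = solve-∀ ℚ-ring
    eq′ : ∀ p → p * (1ℚ - 1ℚ) ≡ 0ℚ
    eq′ = solve-∀ ℚ-ring

  rec₃ : ∀ c → s₃ c + (α + α) * s₂ c + s₁ c ≡ 0ℚ
  rec₃ c = trans (cong (λ x → re x + (α + α) * s₂ c + s₁ c) (assoc c v))
             (trans (cong (λ x → re ((c *ᶜ v) *ᶜ (v *ᶜ v)) + (α + α) * re x + s₁ c) (assoc′ c v)) (rec (c *ᶜ v)))
    where
    assoc : ∀ c v → c *ᶜ (v *ᶜ (v *ᶜ v)) ≡ (c *ᶜ v) *ᶜ (v *ᶜ v)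
    assoc = solve-∀ ℂ-ring
    assoc′ : ∀ c v → c *ᶜ (v *ᶜ v) ≡ (c *ᶜ v) *ᶜ v
    assoc′ = solve-∀ ℂ-ring

  -- x = - (2αy + z) with weights 2α and 1 that are nonnegative and add up to at most 3. This is
  -- where Re v ≤ 0 enters.
  upper : ∀ {x y z t} → 0ℚ ≤ t → z + (α + α) * y + x ≡ 0ℚ → - t ≤ y → - t ≤ z → x ≤ t + t + t
  upper {x} {y} {z} {t} 0≤t e p q = ≤-by (0≤+ (0≤+ (0≤* 0≤α′ (≤⇒0≤ p)) (≤⇒0≤ q)) (0≤* (≤⇒0≤ α+α≤2) 0≤t))
     (trans (eq x y z t α) (cong (λ w → w + _) (trans (cong (λ w → x - w) e) (eq′ x))))
    where
    0≤α′ : 0ℚ ≤ α + α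
    0≤α′ = 0≤+ 0≤α 0≤α
    α+α≤2 : α + α ≤ 1ℚ + 1ℚ
    α+α≤2 = +-mono-≤ α≤1 α≤1
    eq : ∀ x y z t α → t + t + t ≡ (x - (z + (α + α) * y + x)) + ((α + α) * (y - - t) + (z - - t) + ((1ℚ + 1ℚ) - (α + α)) * t)
    eq = solve-∀ ℚ-ring
    eq′ : ∀ x → x - 0ℚ ≡ x
    eq′ = solve-∀ ℚ-ring

  ten-κ : κ * ι 10 ≡ β
  ten-κ = eq β (ℤ.+ 1 / 10) (ι 10) refl
    where
    eq : ∀ b x y → x * y ≡ 1ℚ → b * x * y ≡ b
    eq b x y e = trans (*-assoc b x y) (trans (cong (b *_) e) (*-identityʳ b))

  -- With t = κ‖c‖, the recurrence bounds |Re c| and |Re cv| by 3t. As Im v ≠ 0 these two numbers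
  -- control c: β‖c‖ ≤ 9t follows, hence c = 0, and the first strict hypothesis then reads 0 < 0.
  none : ∀ c → - (κ * ‖ c ‖) < re c → - (κ * ‖ c ‖) < s₁ c → - (κ * ‖ c ‖) < s₂ c → - (κ * ‖ c ‖) < s₃ c → ⊥
  none c n₀ n₁ n₂ n₃ = <-irrefl (sym c≡0) n₀
    where
    m = ‖ c ‖
    t = κ * m
    p = re c
    q = im c
    0≤m = 0≤‖‖ c
    0≤t : 0ℚ ≤ t
    0≤t = 0≤* (<⇒≤ 0<κ) 0≤m
    3t = t + t + t
    low : ∀ {x} → - t < x → - t ≤ x
    low n = <⇒≤ n
    low3 : ∀ {x} → - t ≤ x → - 3t ≤ x
    low3 le = ≤-trans (neg-antimono-≤ (≤-by (0≤+ 0≤t 0≤t) (eq t))) le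
      where
      eq : ∀ t → t + t + t ≡ t + (t + t)
      eq = solve-∀ ℚ-ring
    ∣p∣≤ : ∣ p ∣ ≤ 3t
    ∣p∣≤ = abs-≤ (low3 (low n₀)) (upper 0≤t (rec c) (low n₁) (low n₂))
    ∣s₁∣≤ : ∣ s₁ c ∣ ≤ 3t
    ∣s₁∣≤ = abs-≤ (low3 (low n₁)) (upper 0≤t (rec₃ c) (low n₂) (low n₃))
    qb : ∣ q ∣ * β ≤ 3t + 3t
    qb = ≤-trans (≤-reflexive (trans (sym (∣p*q∣≡∣p∣*∣q∣ q b)) (cong ∣_∣ (trans (eq p q a b) (cong (λ w → p * a - w) (sym (re-* c v)))))))
         (≤-trans (∣p-q∣≤∣p∣+∣q∣ (p * a) (s₁ c)) (+-mono-≤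
           (≤-trans (≤-reflexive (∣p*q∣≡∣p∣*∣q∣ p a)) (≤-trans (*-mono (0≤∣p∣ p) ∣p∣≤ (0≤∣p∣ a) (≼-re v≼1)) (≤-reflexive (*-identityʳ 3t)))) ∣s₁∣≤))
      where
      eq : ∀ p q a b → q * b ≡ p * a - (p * a - q * b)
      eq = solve-∀ ℚ-ring
    pb : ∣ p ∣ * β ≤ 3t
    pb = ≤-trans (*-mono (0≤∣p∣ p) ∣p∣≤ (0≤∣p∣ b) β≤1) (≤-reflexive (*-identityʳ 3t))
    mβ : m * β ≤ 3t + (3t + 3t)
    mβ = ≤-trans (≤-reflexive (*-distribʳ-+ β ∣ p ∣ ∣ q ∣)) (+-mono-≤ pb qb)
    mκ : m * κ ≤ 0ℚ
    mκ = ≤-by (≤⇒0≤ (≤-trans (≤-reflexive (cong (m *_) ten-κ)) mβ)) (eq κ m)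
      where
      eq : ∀ k m → 0ℚ ≡ m * k + ((k * m + k * m + k * m) + ((k * m + k * m + k * m) + (k * m + k * m + k * m)) - m * (k * ι 10))
      eq = solve-∀ ℚ-ring
    m≡0 : m ≡ 0ℚ
    m≡0 = ≤-antisym (*-cancelʳ κ 0<κ (≤-trans mκ (≤-reflexive (sym (*-zeroˡ κ))))) 0≤m
    p≡0 : p ≡ 0ℚ
    p≡0 = ∣p∣≡0⇒p≡0 p (≤-antisym (≤-trans (≤-by (0≤∣p∣ q) refl) (≤-reflexive m≡0)) (0≤∣p∣ p))
    c≡0 : p ≡ - (κ * m)
    c≡0 = trans p≡0 (sym (trans (cong (λ w → - (κ * w)) m≡0) (eq κ)))
      where
      eq : ∀ k → - (k * 0ℚ) ≡ 0ℚ
      eq = solve-∀ ℚ-ring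

case≤ : ∀ {ℓ} {A : Set ℓ} x t → (x ≤ t → A) → (t < x → A) → A
case≤ x t f g with x ≤? t
... | yes p = f p
... | no p = g (≰⇒> p)

abstract
  -- Stands in for a (k+1)-th root of -1/c: the descent survives if the rotated c merely points to
  -- the left by a fixed proportion κ of its size.
  direction : ∀ k → Σ ℚ λ κ → 0ℚ < κ × (∀ c → Σ ℂ λ ζ → ζ ≼ 1ℚ × re (c *ᶜ ζ ^ᶜ suc k) ≤ - (κ * ‖ c ‖))
  direction k = from (quarter-turn k)
    where
    1^ : ∀ n → 1ᶜ ^ᶜ n ≡ 1ᶜ
    1^ zero = refl
    1^ (suc n) = cong (1ᶜ *ᶜ_) (1^ n)
    eq : ∀ c → c *ᶜ 1ᶜ ≡ c
    eq = solve-∀ ℂ-ring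
    unit : ∀ {z} → N z ≡ 1ℚ → z ≼ 1ℚ
    unit e = mk≼ 0≤1 (≤-reflexive e)
    from : (Σ ℂ λ ξ → N ξ ≡ 1ℚ × re (ξ ^ᶜ suc k) ≤ 0ℚ × im (ξ ^ᶜ suc k) ≢ 0ℚ) →
      Σ ℚ λ κ → 0ℚ < κ × (∀ c → Σ ℂ λ ζ → ζ ≼ 1ℚ × re (c *ᶜ ζ ^ᶜ suc k) ≤ - (κ * ‖ c ‖))
    from (ξ , Nξ , re≤0 , im≢0) = κ , 0<κ , choose
      where
      v : ℂ
      v = ξ ^ᶜ suc k
      open Directions v (N-^ ξ (suc k) Nξ) re≤0 im≢0
      Nξ² : N (ξ *ᶜ ξ) ≡ 1ℚ
      Nξ² = trans (N-* ξ ξ) (cong₂ _*_ Nξ Nξ)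
      choose : ∀ c → Σ ℂ λ ζ → ζ ≼ 1ℚ × re (c *ᶜ ζ ^ᶜ suc k) ≤ - (κ * ‖ c ‖)
      choose c = case≤ (re c) t (λ p → 1ᶜ , 1≼1 , subst (λ z → re z ≤ t) (sym (trans (cong (c *ᶜ_) (1^ (suc k))) (eq c))) p) λ n₀ →
        case≤ (s₁ c) t (λ p → ξ , unit Nξ , p) λ n₁ →
        case≤ (s₂ c) t (λ p → ξ *ᶜ ξ , unit Nξ² , subst (λ z → re (c *ᶜ z) ≤ t) (sym (^-*-distrib ξ ξ (suc k))) p) λ n₂ →
        case≤ (s₃ c) t (λ p → ξ *ᶜ (ξ *ᶜ ξ) , unit (trans (N-* ξ (ξ *ᶜ ξ)) (cong₂ _*_ Nξ Nξ²)) ,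
            subst (λ z → re (c *ᶜ z) ≤ t) (sym (trans (^-*-distrib ξ (ξ *ᶜ ξ) (suc k)) (cong (v *ᶜ_) (^-*-distrib ξ ξ (suc k))))) p) λ n₃ →
        ⊥-elim (none c n₀ n₁ n₂ n₃)
        where
        t : ℚ
        t = - (κ * ‖ c ‖)

  directions : ∀ d → Σ ℚ λ κ → 0ℚ < κ × κ ≤ 1ℚ × (∀ k → k ℕ.< d → ∀ c → Σ ℂ λ ζ → ζ ≼ 1ℚ × re (c *ᶜ ζ ^ᶜ suc k) ≤ - (κ * ‖ c ‖))
  directions zero = 1ℚ , 0<1 , ≤-refl , λ k ()
  directions (suc d) = both (directions d) (direction d)
    where
    both : (Σ ℚ λ κ → 0ℚ < κ × κ ≤ 1ℚ × (∀ k → k ℕ.< d → ∀ c → Σ ℂ λ ζ → ζ ≼ 1ℚ × re (c *ᶜ ζ ^ᶜ suc k) ≤ - (κ * ‖ c ‖))) →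
      (Σ ℚ λ κ → 0ℚ < κ × (∀ c → Σ ℂ λ ζ → ζ ≼ 1ℚ × re (c *ᶜ ζ ^ᶜ suc d) ≤ - (κ * ‖ c ‖))) →
      Σ ℚ λ κ → 0ℚ < κ × κ ≤ 1ℚ × (∀ k → k ℕ.< suc d → ∀ c → Σ ℂ λ ζ → ζ ≼ 1ℚ × re (c *ᶜ ζ ^ᶜ suc k) ≤ - (κ * ‖ c ‖))
    -- Both factors are at most 1, so the product is below each of them and serves old and new
    -- exponents alike.
    both (κ , 0<κ , κ≤1 , f) (κ′ , 0<κ′ , f′) = κ * κ′′ , 0<* 0<κ 0<κ′′ , ≤-trans (*-mono (<⇒≤ 0<κ) κ≤1 (<⇒≤ 0<κ′′) κ′′≤1) ≤-refl , g
      where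
      κ′′ : ℚ
      κ′′ = κ′ ⊓ 1ℚ
      0<κ′′ : 0ℚ < κ′′
      0<κ′′ with ⊓-sel κ′ 1ℚ
      ... | inj₁ e = subst (0ℚ <_) (sym e) 0<κ′
      ... | inj₂ e = subst (0ℚ <_) (sym e) 0<1
      κ′′≤1 : κ′′ ≤ 1ℚ
      κ′′≤1 = p⊓q≤q κ′ 1ℚ
      weaken : ∀ {μ} ν c k → ν ≤ μ → (Σ ℂ λ ζ → ζ ≼ 1ℚ × re (c *ᶜ ζ ^ᶜ suc k) ≤ - (μ * ‖ c ‖)) → Σ ℂ λ ζ → ζ ≼ 1ℚ × re (c *ᶜ ζ ^ᶜ suc k) ≤ - (ν * ‖ c ‖)
      weaken ν c k le (ζ , p , q) = ζ , p , ≤-trans q (neg-antimono-≤ (*-monoʳ ‖ c ‖ (0≤‖‖ c) le))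
      g : ∀ k → k ℕ.< suc d → ∀ c → Σ ℂ λ ζ → ζ ≼ 1ℚ × re (c *ᶜ ζ ^ᶜ suc k) ≤ - (κ * κ′′ * ‖ c ‖)
      g k k<d c with k ℕₚ.≟ d
      ... | yes refl = weaken (κ * κ′′) c d (≤-trans (≤-trans (*-monoʳ κ′′ (<⇒≤ 0<κ′′) κ≤1) (≤-reflexive (*-identityˡ κ′′))) (p⊓q≤p κ′ 1ℚ)) (f′ c)
      ... | no k≢d = weaken (κ * κ′′) c k (≤-trans (*-monoˡ κ (<⇒≤ 0<κ) κ′′≤1) (≤-reflexive (*-identityʳ κ))) (f k (ℕₚ.≤∧≢⇒< (ℕₚ.≤-pred k<d) k≢d) c)

-- Kneser's descent step

ev : List ℂ → ℂ → ℂ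
ev [] z = 0ᶜ
ev (c ∷ cs) z = c +ᶜ z *ᶜ ev cs z

⟦⟧-* : ∀ a b → ⟦ a * b ⟧ ≡ ⟦ a ⟧ *ᶜ ⟦ b ⟧
⟦⟧-* a b = cong₂ _+i_ (eq₁ a b) (eq₂ a b)
  where
  eq₁ : ∀ a b → a * b ≡ a * b - 0ℚ * 0ℚ
  eq₁ = solve-∀ ℚ-ring
  eq₂ : ∀ a b → 0ℚ ≡ a * 0ℚ + 0ℚ * b
  eq₂ = solve-∀ ℚ-ring

‖‖-scale : ∀ {r} → 0ℚ ≤ r → ∀ c → ‖ ⟦ r ⟧ *ᶜ c ‖ ≡ r * ‖ c ‖
‖‖-scale {r} 0≤r (a +i b) = trans (cong₂ (λ x y → ∣ x ∣ + ∣ y ∣) (eq₁ r a b) (eq₂ r a b))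
  (trans (cong₂ _+_ (∣p*q∣≡∣p∣*∣q∣ r a) (∣p*q∣≡∣p∣*∣q∣ r b))
  (trans (cong (λ x → x * ∣ a ∣ + x * ∣ b ∣) (0≤p⇒∣p∣≡p 0≤r)) (sym (*-distribˡ-+ r ∣ a ∣ ∣ b ∣))))
  where
  eq₁ : ∀ r a b → r * a - 0ℚ * b ≡ r * a
  eq₁ = solve-∀ ℚ-ring
  eq₂ : ∀ r a b → r * b + 0ℚ * a ≡ r * b
  eq₂ = solve-∀ ℚ-ring

^≤1 : ∀ {x} k → 0ℚ ≤ x → x ≤ 1ℚ → x ^ k ≤ 1ℚ
^≤1 zero p q = ≤-refl
^≤1 (suc k) p q = ≤-trans (*-mono p q (0≤^ k p) (^≤1 k p q)) ≤-refl

^-antitone : ∀ {x j k} → 0ℚ ≤ x → x ≤ 1ℚ → j ℕ.≤ k → x ^ k ≤ x ^ j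
^-antitone {k = k} p q ℕ.z≤n = ^≤1 k p q
^-antitone {x} p q (ℕ.s≤s le) = *-monoˡ x p (^-antitone p q le)

-- rescale s r bs has j-th entry (counted from 1) s r^j b_j.
rescale : ℚ → ℚ → List ℂ → List ℂ
rescale s r [] = []
rescale s r (b ∷ bs) = ⟦ s * r ⟧ *ᶜ b ∷ rescale (s * r) r bs

length-rescale : ∀ s r bs → length (rescale s r bs) ≡ length bs
length-rescale s r [] = refl
length-rescale s r (b ∷ bs) = cong suc (length-rescale (s * r) r bs)

ev-rescale : ∀ s r bs ζ → ζ *ᶜ ev (rescale s r bs) ζ ≡ ⟦ s ⟧ *ᶜ ((⟦ r ⟧ *ᶜ ζ) *ᶜ ev bs (⟦ r ⟧ *ᶜ ζ))
ev-rescale s r [] ζ = eq ⟦ s ⟧ ⟦ r ⟧ ζ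
  where
  eq : ∀ s r z → z *ᶜ 0ᶜ ≡ s *ᶜ ((r *ᶜ z) *ᶜ 0ᶜ)
  eq = solve-∀ ℂ-ring
ev-rescale s r (b ∷ bs) ζ = trans (cong (λ x → ζ *ᶜ (⟦ s * r ⟧ *ᶜ b +ᶜ x)) (ev-rescale (s * r) r bs ζ))
  (trans (cong (λ x → ζ *ᶜ (x *ᶜ b +ᶜ x *ᶜ (⟦ r ⟧ *ᶜ ζ *ᶜ ev bs (⟦ r ⟧ *ᶜ ζ)))) (⟦⟧-* s r)) (eq ⟦ s ⟧ ⟦ r ⟧ ζ b (ev bs (⟦ r ⟧ *ᶜ ζ))))
  where
  eq : ∀ s r z b e → z *ᶜ (s *ᶜ r *ᶜ b +ᶜ s *ᶜ r *ᶜ (r *ᶜ z *ᶜ e)) ≡ s *ᶜ ((r *ᶜ z) *ᶜ (b +ᶜ (r *ᶜ z) *ᶜ e))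
  eq = solve-∀ ℂ-ring

Small Big : ℚ → List ℂ → Set
Small t = All (λ c → ‖ c ‖ ≤ t)
Big t = Any (λ c → t ≤ ‖ c ‖)

small⊎big : ∀ t cs → Small t cs ⊎ Big t cs
small⊎big t [] = inj₁ []
small⊎big t (c ∷ cs) with ≤-total ‖ c ‖ t | small⊎big t cs
... | inj₂ p | _ = inj₂ (here p)
... | inj₁ _ | inj₂ q = inj₂ (there q)
... | inj₁ p | inj₁ q = inj₁ (p ∷ q)

rescale-small : ∀ {s r M} bs → 0ℚ ≤ s → 0ℚ ≤ r → r ≤ 1ℚ → 0ℚ ≤ M → Small M bs → Small (s * r * M) (rescale s r bs)
rescale-small [] _ _ _ _ [] = []
rescale-small {s} {r} {M} (b ∷ bs) 0≤s 0≤r r≤1 0≤M (p ∷ ps) =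
  ≤-trans (≤-reflexive (‖‖-scale (0≤* 0≤s 0≤r) b)) (*-monoˡ (s * r) (0≤* 0≤s 0≤r) p)
  ∷ All.map (λ q → ≤-trans q (*-monoʳ M 0≤M (≤-trans (*-monoˡ (s * r) (0≤* 0≤s 0≤r) r≤1) (≤-reflexive (*-identityʳ (s * r))))))
      (rescale-small bs (0≤* 0≤s 0≤r) 0≤r r≤1 0≤M ps)

0≤½ : 0ℚ ≤ ½
0≤½ = nonNegative⁻¹ ½

½≤1 : ½ ≤ 1ℚ
½≤1 = ≤-by {½} {1ℚ} {½} 0≤½ refl

-- Halving r divides the j-th entry by 2^j, hence by at most 2^length; σ collects the halvings
-- already absorbed by the prefix s.
rescale-half : ∀ {t s r s′ r′ σ} bs → 0ℚ ≤ s → 0ℚ ≤ r → 0ℚ ≤ σ → 0ℚ ≤ t → s′ ≡ s * σ → r′ ≡ r * ½ →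
  Big t (rescale s r bs) → Big (t * (σ * ½ ^ length bs)) (rescale s′ r′ bs)
rescale-half {t} {s} {r} {σ = σ} (b ∷ bs) 0≤s 0≤r 0≤σ 0≤t refl refl (here p) =
  here (≤-trans (*-mono 0≤t p (0≤* 0≤σ (0≤^ (suc (length bs)) 0≤½)) (*-monoˡ σ 0≤σ
            (≤-trans (*-monoˡ ½ 0≤½ (^≤1 (length bs) 0≤½ ½≤1)) (≤-reflexive (*-identityʳ ½)))))
        (≤-reflexive (trans (cong (_* (σ * ½)) (‖‖-scale (0≤* 0≤s 0≤r) b))
           (trans (eq s r σ ½ ‖ b ‖) (sym (‖‖-scale (0≤* (0≤* 0≤s 0≤σ) (0≤* 0≤r 0≤½)) b))))))
  where
  eq : ∀ s r σ h b → s * r * b * (σ * h) ≡ s * σ * (r * h) * b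
  eq = solve-∀ ℚ-ring
rescale-half {t} {s} {r} {σ = σ} (b ∷ bs) 0≤s 0≤r 0≤σ 0≤t refl refl (there p) =
  there (subst (λ x → Big x (rescale (s * σ * (r * ½)) (r * ½) bs)) (cong (t *_) (*-assoc σ ½ (½ ^ length bs)))
    (rescale-half bs (0≤* 0≤s 0≤r) 0≤r (0≤* 0≤σ 0≤½) 0≤t (eq s r σ ½) refl p))
  where
  eq : ∀ s r σ h → s * σ * (r * h) ≡ s * r * (σ * h)
  eq = solve-∀ ℚ-ring

2ℚ : ℚ
2ℚ = 1ℚ + 1ℚ

ι≤2^ : ∀ n → ι n + 1ℚ ≤ 2ℚ ^ n
ι≤2^ zero = ≤-refl
ι≤2^ (suc n) = ≤-trans (≤-by (0≤ι n) (eq (ι n))) (*-monoˡ 2ℚ (0≤+ 0≤1 0≤1) (ι≤2^ n))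
  where
  eq : ∀ n → (1ℚ + 1ℚ) * (n + 1ℚ) ≡ 1ℚ + n + 1ℚ + n
  eq = solve-∀ ℚ-ring

sum-bound : ∀ bs → Σ ℚ λ M → 1ℚ ≤ M × Small M bs
sum-bound [] = 1ℚ , ≤-refl , []
sum-bound (b ∷ bs) with sum-bound bs
... | M , 1≤M , sm = ‖ b ‖ + M , ≤-trans 1≤M M≤ , ≤-by (≤-trans 0≤1 1≤M) refl ∷ All.map (λ p → ≤-trans p M≤) sm
  where
  M≤ : M ≤ ‖ b ‖ + M
  M≤ = ≤-by (0≤‖‖ b) (+-comm ‖ b ‖ M)

‖‖≢0 : ∀ {c} → c ≢ 0ᶜ → 0ℚ < ‖ c ‖
‖‖≢0 {a +i b} c≢0 = ≰⇒> λ p → c≢0 (cong₂ _+i_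
  (∣p∣≡0⇒p≡0 a (≤-antisym (≤-trans (≤-by (0≤∣p∣ b) refl) p) (0≤∣p∣ a)))
  (∣p∣≡0⇒p≡0 b (≤-antisym (≤-trans (≤-by (0≤∣p∣ a) (+-comm ∣ a ∣ ∣ b ∣)) p) (0≤∣p∣ b))))

-- R = 1 + t/‖b‖ for a nonzero entry b; since R ≥ 1, the further powers of R do not undo this.
enlarge : ∀ {t} bs → 0ℚ ≤ t → Any (_≢ 0ᶜ) bs → Σ ℚ λ R → 0ℚ ≤ R × Big t (rescale 1ℚ R bs)
enlarge {t} bs 0≤t nz = proj₁ (least bs nz) , ≤-trans 0≤1 (proj₁ (proj₂ (least bs nz))) , grow bs ≤-refl nz (proj₂ (least bs nz))
  where
  Enough : ℚ → (bs : List ℂ) → Any (_≢ 0ᶜ) bs → Set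
  Enough R (b ∷ _) (here _) = t ≤ R * ‖ b ‖
  Enough R (_ ∷ bs) (there p) = Enough R bs p
  least : ∀ bs (nz : Any (_≢ 0ᶜ) bs) → Σ ℚ λ R → 1ℚ ≤ R × Enough R bs nz
  least (b ∷ bs) (here p) = let (q , 0<q , e) = inv⁺ (‖‖≢0 p) in
    1ℚ + t * q , ≤-by (0≤* 0≤t (<⇒≤ 0<q)) refl ,
    ≤-by (0≤‖‖ b) (trans (eq ‖ b ‖ t q) (cong (_+ ‖ b ‖) (trans (cong (t *_) e) (*-identityʳ t))))
    where
    eq : ∀ b t q → (1ℚ + t * q) * b ≡ t * (b * q) + b
    eq = solve-∀ ℚ-ring
  least (_ ∷ bs) (there p) = least bs p
  grow : ∀ {s R} bs → 1ℚ ≤ s → (nz : Any (_≢ 0ᶜ) bs) → 1ℚ ≤ R × Enough R bs nz → Big t (rescale s R bs)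
  grow {s} {R} (b ∷ bs) 1≤s (here _) (1≤R , e) = here (≤-trans e (≤-trans
     (*-monoʳ ‖ b ‖ (0≤‖‖ b) (≤-trans (≤-reflexive (sym (*-identityˡ R))) (*-monoʳ R (≤-trans 0≤1 1≤R) 1≤s)))
     (≤-reflexive (sym (‖‖-scale (0≤* (≤-trans 0≤1 1≤s) (≤-trans 0≤1 1≤R)) b)))))
  grow {s} {R} (_ ∷ bs) 1≤s (there p) (1≤R , e) = there (grow bs (≤-trans (≤-reflexive (sym (*-identityˡ 1ℚ))) (*-mono 0≤1 1≤s 0≤1 1≤R)) p (1≤R , e))

-- Start where some entry reaches t and halve until none exceeds it. The previous radius still had
-- an entry of norm at least t, and one halving costs it at most the factor `½ ^ length bs`. Below
-- t/M all entries are small, which bounds the number of halvings.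
normalise-radius : ∀ {t} bs → 0ℚ < t → t ≤ 1ℚ → Any (_≢ 0ᶜ) bs →
  Σ ℚ λ r → 0ℚ ≤ r × Small t (rescale 1ℚ r bs) × Big (t * ½ ^ length bs) (rescale 1ℚ r bs)
normalise-radius {t} bs 0<t t≤1 nz = start (sum-bound bs) (enlarge bs (<⇒≤ 0<t) nz)
  where
  Result = Σ ℚ λ r → 0ℚ ≤ r × Small t (rescale 1ℚ r bs) × Big (t * ½ ^ length bs) (rescale 1ℚ r bs)
  half : ∀ {r} → 0ℚ ≤ r → Big t (rescale 1ℚ r bs) → Big (t * ½ ^ length bs) (rescale 1ℚ (r * ½) bs)
  half 0≤r big = subst (λ x → Big (t * x) (rescale 1ℚ _ bs)) (*-identityˡ (½ ^ length bs))
    (rescale-half bs 0≤1 0≤r 0≤1 (<⇒≤ 0<t) refl refl big)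
  half≤ : ∀ {r} → 0ℚ ≤ r → r * ½ ≤ r
  half≤ {r} 0≤r = ≤-trans (*-monoˡ r 0≤r ½≤1) (≤-reflexive (*-identityʳ r))
  loop : ∀ r₀ → (∀ {r} → 0ℚ ≤ r → r ≤ r₀ → Small t (rescale 1ℚ r bs)) →
    ∀ n r → 0ℚ ≤ r → r ≤ 2ℚ ^ n * r₀ → Big t (rescale 1ℚ r bs) → Result
  loop r₀ sm zero r 0≤r le big = r * ½ , 0≤* 0≤r 0≤½ , sm (0≤* 0≤r 0≤½) (≤-trans (half≤ 0≤r) (≤-trans le (≤-reflexive (*-identityˡ r₀)))) , half 0≤r big
  loop r₀ sm (suc n) r 0≤r le big = next (small⊎big t (rescale 1ℚ (r * ½) bs))
    where
    eq : ∀ p r → (1ℚ + 1ℚ) * p * r * ½ ≡ p * r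
    eq = solve-∀ ℚ-ring
    next : Small t (rescale 1ℚ (r * ½) bs) ⊎ Big t (rescale 1ℚ (r * ½) bs) → Result
    next (inj₁ s) = r * ½ , 0≤* 0≤r 0≤½ , s , half 0≤r big
    next (inj₂ b) = loop r₀ sm n (r * ½) (0≤* 0≤r 0≤½) (≤-trans (*-monoʳ ½ 0≤½ le) (≤-reflexive (eq (2ℚ ^ n) r₀))) b
  start : (Σ ℚ λ M → 1ℚ ≤ M × Small M bs) → (Σ ℚ λ R → 0ℚ ≤ R × Big t (rescale 1ℚ R bs)) → Result
  start (M , 1≤M , sm) (R , 0≤R , big) = loop r₀ small (proj₁ n) R 0≤R R≤ big
    where
    0<M = <-≤-trans 0<1 1≤M
    M⁻¹ = proj₁ (inv⁺ 0<M)
    0<M⁻¹ = proj₁ (proj₂ (inv⁺ 0<M))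
    MM⁻¹ = proj₂ (proj₂ (inv⁺ 0<M))
    r₀ = t * M⁻¹
    0<r₀ = 0<* 0<t 0<M⁻¹
    M⁻¹≤1 : M⁻¹ ≤ 1ℚ
    M⁻¹≤1 = ≤-trans (≤-reflexive (sym (*-identityˡ M⁻¹))) (≤-trans (*-monoʳ M⁻¹ (<⇒≤ 0<M⁻¹) 1≤M) (≤-reflexive MM⁻¹))
    r₀≤1 : r₀ ≤ 1ℚ
    r₀≤1 = *-mono (<⇒≤ 0<t) t≤1 (<⇒≤ 0<M⁻¹) M⁻¹≤1
    small : ∀ {r} → 0ℚ ≤ r → r ≤ r₀ → Small t (rescale 1ℚ r bs)
    small {r} 0≤r r≤r₀ = All.map (λ p → ≤-trans p (≤-trans (≤-reflexive (cong (_* M) (*-identityˡ r))) (≤-trans (*-monoʳ M (<⇒≤ 0<M) r≤r₀)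
        (≤-reflexive (trans (eq t M⁻¹ M) (trans (cong (t *_) MM⁻¹) (*-identityʳ t)))))))
      (rescale-small bs 0≤1 0≤r (≤-trans r≤r₀ r₀≤1) (<⇒≤ 0<M) sm)
      where
      eq : ∀ t m n → t * m * n ≡ t * (n * m)
      eq = solve-∀ ℚ-ring
    r₀⁻¹ = inv⁺ 0<r₀
    n = archimedean (R * proj₁ r₀⁻¹)
    R≤ : R ≤ 2ℚ ^ proj₁ n * r₀
    R≤ = ≤-trans (≤-reflexive (trans (sym (*-identityʳ R)) (trans (cong (R *_) (sym (proj₂ (proj₂ r₀⁻¹)))) (eq R r₀ (proj₁ r₀⁻¹)))))
           (*-monoʳ r₀ (<⇒≤ 0<r₀) (≤-trans (proj₂ n) (≤-trans (≤-by 0≤1 refl) (ι≤2^ (proj₁ n)))))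
      where
      eq : ∀ a b c → a * (b * c) ≡ a * c * b
      eq = solve-∀ ℚ-ring

data Dom (ρ : ℚ) : List ℂ → ℕ → ℂ → Set where
  here : ∀ {x cs} → Small ρ cs → Dom ρ (x ∷ cs) 0 x
  there : ∀ {x y cs k} → ‖ y ‖ ≤ ρ → Dom ρ cs k x → Dom ρ (y ∷ cs) (suc k) x

small-ev : ∀ {ρ ζ cs} → 0ℚ ≤ ρ → ζ ≼ 1ℚ → Small ρ cs → ζ *ᶜ ev cs ζ ≼ ι (length cs) * ρ
small-ev {ρ} {ζ} {[]} 0≤ρ p [] = subst₂ _≼_ (eq ζ) (sym (*-zeroˡ ρ)) (0≼ ≤-refl)
  where
  eq : ∀ z → 0ᶜ ≡ z *ᶜ 0ᶜ
  eq = solve-∀ ℂ-ring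
small-ev {ρ} {ζ} {c ∷ cs} 0≤ρ p (q ∷ qs) = subst (ζ *ᶜ _ ≼_) (eq ρ (ι (length cs)))
    (≼-* p (≼-+ (≼-mono (≼‖‖ c) q) (small-ev 0≤ρ p qs)))
  where
  eq : ∀ r n → 1ℚ * (r + n * r) ≡ (1ℚ + n) * r
  eq = solve-∀ ℚ-ring

dom-ev : ∀ {ρ ζ cs k x} → 0ℚ ≤ ρ → ζ ≼ 1ℚ → Dom ρ cs k x →
  Σ ℂ λ R → ζ *ᶜ ev cs ζ ≡ x *ᶜ ζ ^ᶜ suc k +ᶜ R × R ≼ ι (length cs) * ρ
dom-ev {ρ} {ζ} {x ∷ cs} 0≤ρ p (here sm) = ζ *ᶜ (ζ *ᶜ ev cs ζ) , eq ζ x (ev cs ζ) ,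
  ≼-mono (≼-* p (small-ev 0≤ρ p sm)) (≤-by 0≤ρ (eq′ ρ (ι (length cs))))
  where
  eq : ∀ z x e → z *ᶜ (x +ᶜ z *ᶜ e) ≡ x *ᶜ (z *ᶜ 1ᶜ) +ᶜ z *ᶜ (z *ᶜ e)
  eq = solve-∀ ℂ-ring
  eq′ : ∀ r n → (1ℚ + n) * r ≡ 1ℚ * (n * r) + r
  eq′ = solve-∀ ℚ-ring
dom-ev {ρ} {ζ} {y ∷ cs} {suc k} {x} 0≤ρ p (there q d) = let (R , e , b) = dom-ev 0≤ρ p d in
  ζ *ᶜ (y +ᶜ R) , trans (cong (λ w → ζ *ᶜ (y +ᶜ w)) e) (eq ζ y x (ζ ^ᶜ suc k) R) ,
  subst (ζ *ᶜ (y +ᶜ R) ≼_) (eq′ ρ (ι (length cs))) (≼-* p (≼-+ (≼-mono (≼‖‖ y) q) b))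
  where
  eq : ∀ z y x w R → z *ᶜ (y +ᶜ (x *ᶜ w +ᶜ R)) ≡ x *ᶜ (z *ᶜ w) +ᶜ z *ᶜ (y +ᶜ R)
  eq = solve-∀ ℂ-ring
  eq′ : ∀ r n → 1ℚ * (r + n * r) ≡ (1ℚ + n) * r
  eq′ = solve-∀ ℚ-ring

-- x is the first entry reaching the threshold G l, where l counts the entries after it.
data First (G : ℕ → ℚ) : List ℂ → ℕ → ℂ → ℕ → Set where
  here : ∀ {x cs} → G (length cs) ≤ ‖ x ‖ → First G (x ∷ cs) 0 x (length cs)
  there : ∀ {x y cs k l} → ‖ y ‖ ≤ G (suc l) → First G cs k x l → First G (y ∷ cs) (suc k) x l

first-l< : ∀ {G cs k x l} → First G cs k x l → l ℕ.< length cs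
first-l< (here _) = ℕₚ.≤-refl
first-l< (there _ f) = ℕₚ.m<n⇒m<1+n (first-l< f)

first-k< : ∀ {G cs k x l} → First G cs k x l → k ℕ.< length cs
first-k< (here _) = ℕ.s≤s ℕ.z≤n
first-k< (there _ f) = ℕ.s≤s (first-k< f)

first-small : ∀ {G cs k x l t} → First G cs k x l → Small t cs → ‖ x ‖ ≤ t
first-small (here _) (p ∷ _) = p
first-small (there _ f) (_ ∷ ps) = first-small f ps

first-≥ : ∀ {G cs k x l} → First G cs k x l → G l ≤ ‖ x ‖
first-≥ (here p) = p
first-≥ (there _ f) = first-≥ f

-- `G 0` is the largest threshold, so an entry of that size passes the test at its own position.
-- Entries that failed before were measured against thresholds no larger than `G (suc l)`.
first : ∀ {G} → (∀ {i j} → i ℕ.≤ j → G j ≤ G i) → ∀ cs → Big (G 0) cs → ∃[ k ] ∃[ x ] ∃[ l ] First G cs k x l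
first {G} anti (c ∷ cs) big with ≤-total (G (length cs)) ‖ c ‖
... | inj₁ p = _ , _ , _ , here p
first {G} anti (c ∷ cs) (here p) | inj₂ _ = _ , _ , _ , here (≤-trans (anti ℕ.z≤n) p)
first {G} anti (c ∷ cs) (there big) | inj₂ q = let (k , x , l , f) = first anti cs big in
  _ , _ , _ , there (≤-trans q (anti (first-l< f))) f

-- Entries before x are at most `G (suc l)`, and shrinking only helps them. Entries after x carry at
-- least one factor θ more than the scale φ of x, so they are at most `φ * θ * t`.
first⇒dom : ∀ {G ρ θ t s φ cs k x l} → 0ℚ ≤ s → s ≤ 1ℚ → 0ℚ ≤ θ → θ ≤ 1ℚ → 0ℚ ≤ t → φ ≡ s * θ ^ suc k →
  First G cs k x l → Small t cs → G (suc l) ≤ ρ → φ * θ * t ≤ ρ → Dom ρ (rescale s θ cs) k (⟦ φ ⟧ *ᶜ x)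
first⇒dom {ρ = ρ} {θ} {t} {s} {φ} {x ∷ cs} 0≤s s≤1 0≤θ θ≤1 0≤t e (here _) (_ ∷ sm) _ q =
  subst (λ y → Dom ρ (y ∷ rescale (s * θ) θ cs) 0 (⟦ φ ⟧ *ᶜ x)) (cong (λ y → ⟦ y ⟧ *ᶜ x) φ≡)
    (here (All.map (λ r → ≤-trans r (≤-trans (≤-reflexive (cong (λ y → y * θ * t) (sym φ≡))) q))
      (rescale-small cs (0≤* 0≤s 0≤θ) 0≤θ θ≤1 0≤t sm)))
  where
  φ≡ : φ ≡ s * θ
  φ≡ = trans e (cong (s *_) (*-identityʳ θ))
first⇒dom {ρ = ρ} {θ} {t} {s} {φ} {y ∷ cs} {suc k} 0≤s s≤1 0≤θ θ≤1 0≤t e (there r f) (_ ∷ sm) p q =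
  there (≤-trans (≤-reflexive (‖‖-scale (0≤* 0≤s 0≤θ) y)) (≤-trans (*-mono (0≤* 0≤s 0≤θ) sθ≤1 (0≤‖‖ y) r) (≤-trans (≤-reflexive (*-identityˡ _)) p)))
    (first⇒dom (0≤* 0≤s 0≤θ) sθ≤1 0≤θ θ≤1 0≤t (trans e (sym (*-assoc s θ (θ ^ suc k)))) f sm p q)
  where
  sθ≤1 : s * θ ≤ 1ℚ
  sθ≤1 = *-mono 0≤s s≤1 0≤θ θ≤1

-- In |1 + X + R|² = 1 + 2 Re (X + R) + |X + R|² the linear part is at most -14τt and the quadratic
-- part at most 4t² ≤ 4τt.
descent-estimate : ∀ {X R τ t} → 0ℚ ≤ τ → 0ℚ ≤ t → τ ≤ 1ℚ → t ≤ τ → re X ≤ - (ι 8 * τ * t) → X ≼ t → R ≼ τ * t →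
  N (1ᶜ +ᶜ (X +ᶜ R)) ≤ 1ℚ - τ * t
descent-estimate {a +i b} {c +i d} {τ} {t} 0≤τ 0≤t τ≤1 t≤τ reX X≼ R≼ =
  ≤-by (0≤+ (0≤+ (0≤+ (≤⇒0≤ reX) (≤⇒0≤ reX)) (0≤+ (≤⇒0≤ c≤) (≤⇒0≤ c≤)))
        (0≤+ (≤⇒0≤ Ns) (0≤+ (0≤* (0≤ι 4) (0≤* 0≤t (≤⇒0≤ t≤τ))) (0≤* (0≤ι 9) (0≤* 0≤τ 0≤t)))))
    (eq a b c d τ t)
  where
  c≤ : c ≤ τ * t
  c≤ = ≤-trans (p≤∣p∣ c) (≼-re R≼)
  Ns : N ((a +i b) +ᶜ (c +i d)) ≤ (t + t) * (t + t)
  Ns = N≤ (≼-mono (≼-+ X≼ R≼) (+-monoʳ-≤ t (≤-trans (*-monoʳ t 0≤t τ≤1) (≤-reflexive (*-identityˡ t)))))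
  eq : ∀ a b c d τ t → 1ℚ - τ * t ≡ ((1ℚ + (a + c)) * (1ℚ + (a + c)) + (0ℚ + (b + d)) * (0ℚ + (b + d)))
     + (((- (ι 8 * τ * t) - a) + (- (ι 8 * τ * t) - a) + ((τ * t - c) + (τ * t - c)))
       + ((((t + t) * (t + t) - ((a + c) * (a + c) + (b + d) * (b + d)))) + (ι 4 * (t * (τ - t)) + ι 9 * (τ * t))))
  eq = solve-∀ ℚ-ring

≼1-^ : ∀ {z} k → z ≼ 1ℚ → z ^ᶜ k ≼ 1ℚ
≼1-^ zero p = 1≼1
≼1-^ (suc k) p = ≼-* p (≼1-^ k p)

antitone : ∀ {G : ℕ → ℚ} → (∀ i → G (suc i) ≤ G i) → ∀ {i j} → i ℕ.≤ j → G j ≤ G i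
antitone {G} step {i} {zero} ℕ.z≤n = ≤-refl
antitone {G} step {i} {suc j} le with i ℕₚ.≟ suc j
... | yes refl = ≤-refl
... | no i≢ = ≤-trans (step j) (antitone step (ℕₚ.≤-pred (ℕₚ.≤∧≢⇒< le i≢)))

module Kneser (d : ℕ) (κ : ℚ) (0<κ : 0ℚ < κ) (κ≤1 : κ ≤ 1ℚ)
  (dir : ∀ k → k ℕ.< d → ∀ c → Σ ℂ λ ζ → ζ ≼ 1ℚ × re (c *ᶜ ζ ^ᶜ suc k) ≤ - (κ * ‖ c ‖)) where

  -- κ/8, so that the gain κt from `dir` is the 8τt that `descent-estimate` requires.
  τ : ℚ
  τ = κ * (ℤ.+ 1 / 8)

  0<τ : 0ℚ < τ
  0<τ = 0<* 0<κ (positive⁻¹ (ℤ.+ 1 / 8))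

  8τ≡κ : ι 8 * τ ≡ κ
  8τ≡κ = eq κ (ℤ.+ 1 / 8) (ι 8) refl
    where
    eq : ∀ b x y → x * y ≡ 1ℚ → y * (b * x) ≡ b
    eq b x y e = trans (*-comm y (b * x)) (trans (*-assoc b x y) (trans (cong (b *_) e) (*-identityʳ b)))

  τ≤1 : τ ≤ 1ℚ
  τ≤1 = ≤-trans (≤-by (0≤* (0≤ι 7) (<⇒≤ 0<τ)) (trans (sym 8τ≡κ) (eq τ))) κ≤1
    where
    eq : ∀ t → ι 8 * t ≡ t + ι 7 * t
    eq = solve-∀ ℚ-ring

  -- d error terms of relative size η stay within τ; the denominator d + 1 also covers d = 0.
  η : ℚ
  η = τ * (ℤ.+ 1 / suc d)

  0<η : 0ℚ < η
  0<η = 0<* 0<τ (0<recip d)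

  dη≤τ : ι d * η ≤ τ
  dη≤τ = ≤-by (<⇒≤ 0<η) (trans (sym (trans (cong (τ *_) (recip d)) (*-identityʳ τ))) (eq τ (ι d) (ℤ.+ 1 / suc d)))
    where
    eq : ∀ t n r → t * ((1ℚ + n) * r) ≡ n * (t * r) + t * r
    eq = solve-∀ ℚ-ring

  η≤1 : η ≤ 1ℚ
  η≤1 = *-mono (<⇒≤ 0<τ) τ≤1 (<⇒≤ (0<recip d)) (recip≤1 d)

  τ⁻¹ : ℚ
  τ⁻¹ = proj₁ (inv⁺ 0<τ)

  0<τ⁻¹ : 0ℚ < τ⁻¹
  0<τ⁻¹ = proj₁ (proj₂ (inv⁺ 0<τ))

  -- The solution of θτ = ηg: one more factor θ brings an entry of size at most τ down to η times an
  -- entry of size g.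
  θ-of : ℚ → ℚ
  θ-of g = η * g * τ⁻¹

  θτ : ∀ g → θ-of g * τ ≡ η * g
  θτ g = trans (eq η g τ⁻¹ τ) (trans (cong (η * g *_) (proj₂ (proj₂ (inv⁺ 0<τ)))) (*-identityʳ (η * g)))
    where
    eq : ∀ e g i t → e * g * i * t ≡ e * g * (t * i)
    eq = solve-∀ ℚ-ring

  -- Chosen so that, after shrinking the radius by θ-of (G l), the first entry with
  -- norm ≥ G l dominates both the earlier (≤ G (suc l)) and the later (≤ τ) entries.
  G : ℕ → ℚ
  G zero = τ * ½ ^ d
  G (suc i) = η * (θ-of (G i) ^ d * G i)

  0<½ : 0ℚ < ½
  0<½ = positive⁻¹ ½

  0<θ : ∀ {g} → 0ℚ < g → 0ℚ < θ-of g
  0<θ p = 0<* (0<* 0<η p) 0<τ⁻¹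

  θ≤1 : ∀ {g} → 0ℚ < g → g ≤ τ → θ-of g ≤ 1ℚ
  θ≤1 {g} p q = *-cancelʳ τ 0<τ (≤-trans (≤-reflexive (θτ g)) (*-mono (<⇒≤ 0<η) η≤1 (<⇒≤ p) q))

  0<G : ∀ i → 0ℚ < G i
  0<G zero = 0<* 0<τ (0<^ d 0<½)
  0<G (suc i) = 0<* 0<η (0<* (0<^ d (0<θ (0<G i))) (0<G i))

  G≤τ : ∀ i → G i ≤ τ
  G-step : ∀ i → G (suc i) ≤ G i
  G-shrunk : ∀ i → G (suc i) ≤ θ-of (G i) ^ d * G i

  G≤τ zero = ≤-trans (*-monoˡ τ (<⇒≤ 0<τ) (^≤1 d 0≤½ ½≤1)) (≤-reflexive (*-identityʳ τ))
  G≤τ (suc i) = ≤-trans (G-step i) (G≤τ i)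

  G-shrunk i = ≤-trans (*-monoʳ _ (<⇒≤ (0<* (0<^ d (0<θ (0<G i))) (0<G i))) η≤1) (≤-reflexive (*-identityˡ _))

  G-step i = ≤-trans (G-shrunk i) (≤-trans (*-monoʳ (G i) (<⇒≤ (0<G i)) (^≤1 d (<⇒≤ (0<θ (0<G i))) (θ≤1 (0<G i) (G≤τ i)))) (≤-reflexive (*-identityˡ (G i))))

  module _ (cs : List ℂ) (len : length cs ≡ d) (sm : Small τ cs) {k x l} (f : First G cs k x l) where
    θ : ℚ
    θ = θ-of (G l)
    0≤θ : 0ℚ ≤ θ
    0≤θ = <⇒≤ (0<θ (0<G l))
    θ≤1′ : θ ≤ 1ℚ
    θ≤1′ = θ≤1 (0<G l) (G≤τ l)
    k<d : k ℕ.< d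
    k<d = subst (k ℕ.<_) len (first-k< f)
    l<d : l ℕ.< d
    l<d = subst (l ℕ.<_) len (first-l< f)
    φ : ℚ
    φ = θ ^ suc k
    0≤φ : 0ℚ ≤ φ
    0≤φ = 0≤^ (suc k) 0≤θ
    x′ : ℂ
    x′ = ⟦ φ ⟧ *ᶜ x
    t : ℚ
    t = ‖ x′ ‖
    t≡ : t ≡ φ * ‖ x ‖
    t≡ = ‖‖-scale 0≤φ x
    shrunk≤t : θ ^ d * G l ≤ t
    shrunk≤t = ≤-trans (*-mono (0≤^ d 0≤θ) (^-antitone 0≤θ θ≤1′ k<d) (<⇒≤ (0<G l)) (first-≥ f)) (≤-reflexive (sym t≡))
    t≤τ : t ≤ τ
    t≤τ = ≤-trans (≤-reflexive t≡) (≤-trans (*-mono 0≤φ (^≤1 (suc k) 0≤θ θ≤1′) (0≤‖‖ x) (first-small f sm)) (≤-reflexive (*-identityˡ τ)))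
    -- The gain τt is thereby at least `τ * G d`, which depends on d and κ but on no coefficient.
    G≤t : G d ≤ t
    G≤t = ≤-trans (antitone G-step l<d) (≤-trans (G-shrunk l) shrunk≤t)
    dom : Dom (η * t) (rescale 1ℚ θ cs) k x′
    dom = first⇒dom 0≤1 ≤-refl 0≤θ θ≤1′ (<⇒≤ 0<τ) (sym (*-identityˡ φ)) f sm (*-monoˡ η (<⇒≤ 0<η) shrunk≤t)
      (≤-trans (≤-reflexive (trans (*-assoc φ θ τ) (trans (cong (φ *_) (θτ (G l))) (eq φ η (G l)))))
        (*-monoˡ η (<⇒≤ 0<η) (≤-trans (*-monoˡ φ 0≤φ (first-≥ f)) (≤-reflexive (sym t≡)))))
      where
      eq : ∀ a b c → a * (b * c) ≡ b * (a * c)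
      eq = solve-∀ ℚ-ring
    descend-scaled : Σ ℂ λ z → N (1ᶜ +ᶜ z *ᶜ ev cs z) ≤ 1ℚ - τ * G d
    descend-scaled = from (dir k k<d x′)
      where
      0≤t : 0ℚ ≤ t
      0≤t = 0≤‖‖ x′
      from : (Σ ℂ λ ζ → ζ ≼ 1ℚ × re (x′ *ᶜ ζ ^ᶜ suc k) ≤ - (κ * t)) → Σ ℂ λ z → N (1ᶜ +ᶜ z *ᶜ ev cs z) ≤ 1ℚ - τ * G d
      from (ζ , ζ≼1 , re≤) = let (R , e , R≼) = dom-ev (0≤* (<⇒≤ 0<η) 0≤t) ζ≼1 dom in
        ⟦ θ ⟧ *ᶜ ζ , ≤-trans (≤-reflexive (cong (λ w → N (1ᶜ +ᶜ w)) (trans (one (ev-rescale 1ℚ θ cs ζ)) e)))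
          (≤-trans (descent-estimate (<⇒≤ 0<τ) 0≤t τ≤1 t≤τ
              (≤-trans re≤ (≤-reflexive (cong (λ w → - (w * t)) (sym 8τ≡κ))))
              (subst (x′ *ᶜ ζ ^ᶜ suc k ≼_) (*-identityʳ t) (≼-* (≼‖‖ x′) (≼1-^ (suc k) ζ≼1)))
              (≼-mono R≼ (≤-trans (≤-reflexive (trans (cong (λ m → ι m * (η * t)) (trans (length-rescale 1ℚ θ cs) len)) (sym (*-assoc (ι d) η t)))) (*-monoʳ t 0≤t dη≤τ))))
            (+-monoʳ-≤ 1ℚ (neg-antimono-≤ (*-monoˡ τ (<⇒≤ 0<τ) G≤t))))
        where
        one : ∀ {a b} → a ≡ 1ᶜ *ᶜ b → b ≡ a
        one {a} {b} p = trans (eq b) (sym p)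
          where
          eq : ∀ b → b ≡ 1ᶜ *ᶜ b
          eq = solve-∀ ℂ-ring

  descend : ∀ bs → length bs ≡ d → Any (_≢ 0ᶜ) bs → Σ ℂ λ w → N (1ᶜ +ᶜ w *ᶜ ev bs w) ≤ 1ℚ - τ * G d
  descend bs refl nz = from (normalise-radius bs 0<τ τ≤1 nz)
    where
    eq : ∀ b → 1ᶜ *ᶜ b ≡ b
    eq = solve-∀ ℂ-ring
    from : (Σ ℚ λ r → 0ℚ ≤ r × Small τ (rescale 1ℚ r bs) × Big (τ * ½ ^ length bs) (rescale 1ℚ r bs)) →
      Σ ℂ λ w → N (1ᶜ +ᶜ w *ᶜ ev bs w) ≤ 1ℚ - τ * G d
    from (r , 0≤r , sm , big) =
      -- `G zero` was set to the lower bound that `normalise-radius` returns.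
      let (_ , _ , _ , f) = first {G} (antitone G-step) (rescale 1ℚ r bs) big
          (z , le) = descend-scaled (rescale 1ℚ r bs) (length-rescale 1ℚ r bs) sm f
      in ⟦ r ⟧ *ᶜ z , ≤-trans (≤-reflexive (cong (λ w → N (1ᶜ +ᶜ w)) (sym (trans (ev-rescale 1ℚ r bs z) (eq (⟦ r ⟧ *ᶜ z *ᶜ ev bs (⟦ r ⟧ *ᶜ z))))))) le

abstract
  -- c is quantified before the coefficients, so the same factor 1 - c serves at every point of the
  -- search for a root.
  kneser : ∀ d → Σ ℚ λ c → 0ℚ < c × (∀ bs → length bs ≡ d → Any (_≢ 0ᶜ) bs → Σ ℂ λ w → N (1ᶜ +ᶜ w *ᶜ ev bs w) ≤ 1ℚ - c)
  kneser d = from (directions d)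
    where
    from : (Σ ℚ λ κ → 0ℚ < κ × κ ≤ 1ℚ × (∀ k → k ℕ.< d → ∀ c → Σ ℂ λ ζ → ζ ≼ 1ℚ × re (c *ᶜ ζ ^ᶜ suc k) ≤ - (κ * ‖ c ‖))) →
      Σ ℚ λ c → 0ℚ < c × (∀ bs → length bs ≡ d → Any (_≢ 0ᶜ) bs → Σ ℂ λ w → N (1ᶜ +ᶜ w *ᶜ ev bs w) ≤ 1ℚ - c)
    from (κ , 0<κ , κ≤1 , dir) = τ * G d , 0<* 0<τ (0<G d) , descend
      where open Kneser d κ 0<κ κ≤1 dir

-- Approximate factorisation of monic polynomials

-- A vector c of length d stands for the monic polynomial c₀ + c₁ x + … + x^d.
evM : ∀ {d} → Vec ℂ d → ℂ → ℂ
evM [] z = 1ᶜ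
evM (c ∷ cs) z = c +ᶜ z *ᶜ evM cs z

-- c + (z + x) p(x), for the monic p.
mulLin : ∀ {d} → ℂ → ℂ → Vec ℂ d → Vec ℂ (suc d)
mulLin c z [] = (c +ᶜ z) ∷ []
mulLin c z (h ∷ hs) = (c +ᶜ z *ᶜ h) ∷ mulLin h z hs

evM-mulLin : ∀ {d} c z (p : Vec ℂ d) w → evM (mulLin c z p) w ≡ c +ᶜ (z +ᶜ w) *ᶜ evM p w
evM-mulLin c z [] w = eq c z w
  where
  eq : ∀ c z w → c +ᶜ z +ᶜ w *ᶜ 1ᶜ ≡ c +ᶜ (z +ᶜ w) *ᶜ 1ᶜ
  eq = solve-∀ ℂ-ring
evM-mulLin c z (h ∷ hs) w = trans (cong (λ e → c +ᶜ z *ᶜ h +ᶜ w *ᶜ e) (evM-mulLin h z hs w)) (eq c z w h (evM hs w))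
  where
  eq : ∀ c z w h e → c +ᶜ z *ᶜ h +ᶜ w *ᶜ (h +ᶜ (z +ᶜ w) *ᶜ e) ≡ c +ᶜ (z +ᶜ w) *ᶜ (h +ᶜ w *ᶜ e)
  eq = solve-∀ ℂ-ring

translate : ∀ {d} → ℂ → Vec ℂ d → Vec ℂ d
translate z [] = []
translate z (c ∷ cs) = mulLin c z (translate z cs)

evM-translate : ∀ {d} z (p : Vec ℂ d) w → evM (translate z p) w ≡ evM p (z +ᶜ w)
evM-translate z [] w = refl
evM-translate z (c ∷ cs) w = trans (evM-mulLin c z (translate z cs) w) (cong (λ e → c +ᶜ (z +ᶜ w) *ᶜ e) (evM-translate z cs w))

-- Synthetic division: the coefficients of Q_z(x) = (p(x) - p(z))/(x - z) are the values at z of the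
-- tails of p.
quotM : ∀ {d} → Vec ℂ (suc d) → ℂ → Vec ℂ d
quotM (c ∷ []) z = []
quotM (c ∷ cs@(_ ∷ _)) z = evM cs z ∷ quotM cs z

divisionM : ∀ {d} (p : Vec ℂ (suc d)) z → mulLin (evM p z) (-ᶜ z) (quotM p z) ≡ p
divisionM (c ∷ []) z = cong (_∷ []) (eq c z)
  where
  eq : ∀ c z → c +ᶜ z *ᶜ 1ᶜ +ᶜ -ᶜ z ≡ c
  eq = solve-∀ ℂ-ring
divisionM (c ∷ cs@(_ ∷ _)) z = cong₂ _∷_ (eq c z (evM cs z)) (divisionM cs z)
  where
  eq : ∀ c z e → c +ᶜ z *ᶜ e +ᶜ -ᶜ z *ᶜ e ≡ c
  eq = solve-∀ ℂ-ring

scaledList : ∀ {d} → ℂ → Vec ℂ d → List ℂ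
scaledList k [] = k ∷ []
scaledList k (b ∷ bs) = k *ᶜ b ∷ scaledList k bs

ev-scaledList : ∀ {d} k (p : Vec ℂ d) w → ev (scaledList k p) w ≡ k *ᶜ evM p w
ev-scaledList k [] w = eq k w
  where
  eq : ∀ k w → k +ᶜ w *ᶜ 0ᶜ ≡ k *ᶜ 1ᶜ
  eq = solve-∀ ℂ-ring
ev-scaledList k (b ∷ bs) w = trans (cong (λ e → k *ᶜ b +ᶜ w *ᶜ e) (ev-scaledList k bs w)) (eq k b w (evM bs w))
  where
  eq : ∀ k b w e → k *ᶜ b +ᶜ w *ᶜ (k *ᶜ e) ≡ k *ᶜ (b +ᶜ w *ᶜ e)
  eq = solve-∀ ℂ-ring

length-scaledList : ∀ {d} k (p : Vec ℂ d) → length (scaledList k p) ≡ suc d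
length-scaledList k [] = refl
length-scaledList k (b ∷ bs) = cong suc (length-scaledList k bs)

scaledList-≢0 : ∀ {d k} (p : Vec ℂ d) → k ≢ 0ᶜ → Any (_≢ 0ᶜ) (scaledList k p)
scaledList-≢0 [] k≢0 = here k≢0
scaledList-≢0 (b ∷ bs) k≢0 = there (scaledList-≢0 bs k≢0)

module ApproxRoot {d : ℕ} (P : Vec ℂ (suc d)) (c : ℚ) (0<c : 0ℚ < c)
  (kn : ∀ bs → length bs ≡ suc d → Any (_≢ 0ᶜ) bs → Σ ℂ λ w → N (1ᶜ +ᶜ w *ᶜ ev bs w) ≤ 1ℚ - c) where

  -- Dividing Q by its value a at 0 gives the shape 1 + w b(w) of the descent step, and the leading
  -- coefficient 1/a of b is nonzero.
  improve-translated : ∀ (Q : Vec ℂ (suc d)) → evM Q 0ᶜ ≢ 0ᶜ → Σ ℂ λ w → N (evM Q w) ≤ N (evM Q 0ᶜ) * (1ℚ - c)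
  improve-translated (a ∷ as) Q≢0 = w , ≤-trans (≤-reflexive (trans (cong N factor) (N-* a _)))
      (≤-trans (*-monoˡ (N a) (0≤N a) (proj₂ found)) (≤-reflexive (cong (λ x → N x * (1ℚ - c)) (eq₀ a (evM as 0ᶜ)))))
    where
    eq₀ : ∀ a e → a ≡ a +ᶜ 0ᶜ *ᶜ e
    eq₀ = solve-∀ ℂ-ring
    inv : Σ ℂ λ b → a *ᶜ b ≡ 1ᶜ
    inv = inv-ℂ (λ a≡0 → Q≢0 (trans (sym (eq₀ a (evM as 0ᶜ))) a≡0))
    a⁻¹ : ℂ
    a⁻¹ = proj₁ inv
    a⁻¹≢0 : a⁻¹ ≢ 0ᶜ
    a⁻¹≢0 e = 1≢0 (cong re (trans (sym (proj₂ inv)) (trans (cong (a *ᶜ_) e) (eq a))))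
      where
      eq : ∀ a → a *ᶜ 0ᶜ ≡ 0ᶜ
      eq = solve-∀ ℂ-ring
    found : Σ ℂ λ w → N (1ᶜ +ᶜ w *ᶜ ev (scaledList a⁻¹ as) w) ≤ 1ℚ - c
    found = kn (scaledList a⁻¹ as) (length-scaledList a⁻¹ as) (scaledList-≢0 as a⁻¹≢0)
    w : ℂ
    w = proj₁ found
    factor : a +ᶜ w *ᶜ evM as w ≡ a *ᶜ (1ᶜ +ᶜ w *ᶜ ev (scaledList a⁻¹ as) w)
    factor = sym (trans (cong (λ e → a *ᶜ (1ᶜ +ᶜ w *ᶜ e)) (ev-scaledList a⁻¹ as w))
      (trans (eq a a⁻¹ w (evM as w)) (trans (cong (λ e → a +ᶜ e *ᶜ (w *ᶜ evM as w)) (proj₂ inv)) (eq′ a (w *ᶜ evM as w)))))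
      where
      eq : ∀ a b w e → a *ᶜ (1ᶜ +ᶜ w *ᶜ (b *ᶜ e)) ≡ a +ᶜ a *ᶜ b *ᶜ (w *ᶜ e)
      eq = solve-∀ ℂ-ring
      eq′ : ∀ a e → a +ᶜ 1ᶜ *ᶜ e ≡ a +ᶜ e
      eq′ = solve-∀ ℂ-ring

  improve : ∀ z → evM P z ≢ 0ᶜ → Σ ℂ λ w → N (evM P w) ≤ N (evM P z) * (1ℚ - c)
  improve z ne = from (improve-translated (translate z P) (λ e → ne (trans (sym at0) e)))
    where
    eq : ∀ z → z +ᶜ 0ᶜ ≡ z
    eq = solve-∀ ℂ-ring
    at0 : evM (translate z P) 0ᶜ ≡ evM P z
    at0 = trans (evM-translate z P 0ᶜ) (cong (evM P) (eq z))
    from : (Σ ℂ λ w → N (evM (translate z P) w) ≤ N (evM (translate z P) 0ᶜ) * (1ℚ - c)) → Σ ℂ λ w → N (evM P w) ≤ N (evM P z) * (1ℚ - c)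
    from (w , le) = z +ᶜ w , subst₂ (λ x y → N x ≤ N y * (1ℚ - c)) (evM-translate z P w) at0 le

  -- While |P(z)|² > ε², one improvement lowers it by at least cε²; n counts the improvements that
  -- can still occur.
  search : ∀ ε → 0ℚ < ε → ∀ n z → N (evM P z) ≤ ε * ε + ι n * (c * (ε * ε)) → Σ ℂ λ z → evM P z ≼ ε
  search ε 0<ε zero z le = z , mk≼ (<⇒≤ 0<ε) (≤-trans le (≤-reflexive (eq (ε * ε) (c * (ε * ε)))))
    where
    eq : ∀ a b → a + 0ℚ * b ≡ a
    eq = solve-∀ ℚ-ring
  search ε 0<ε (suc n) z le = case≤ (N (evM P z)) (ε * ε) (λ p → z , mk≼ (<⇒≤ 0<ε) p) λ p →
      let (w , q) = improve z (λ e → <-irrefl refl (<-≤-trans (≤-<-trans (0≤sq ε) p) (≤-reflexive (cong N e)))) in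
      search ε 0<ε n w (≤-trans q (≤-by (0≤+ (≤⇒0≤ le) (0≤* (<⇒≤ 0<c) (≤⇒0≤ (<⇒≤ p)))) (eq (N (evM P z)) (ε * ε) (ι n) c)))
    where
    eq : ∀ m e n c → e + n * (c * e) ≡ m * (1ℚ - c) + ((e + (1ℚ + n) * (c * e) - m) + c * (m - e))
    eq = solve-∀ ℚ-ring

  root : ∀ ε → 0ℚ < ε → Σ ℂ λ z → evM P z ≼ ε
  root ε 0<ε = search ε 0<ε (proj₁ n) 0ᶜ (≤-trans (≤-trans (≤-reflexive (sym (trans (cong (m *_) (proj₂ (proj₂ i))) (*-identityʳ m))))
      (≤-trans (≤-reflexive (eq m cε (proj₁ i))) (*-monoʳ cε (<⇒≤ 0<cε) (proj₂ n)))) (≤-by (0≤sq ε) (+-comm (ε * ε) _)))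
    where
    m : ℚ
    m = N (evM P 0ᶜ)
    cε : ℚ
    cε = c * (ε * ε)
    0<cε : 0ℚ < cε
    0<cε = 0<* 0<c (0<* 0<ε 0<ε)
    i = inv⁺ 0<cε
    n = archimedean (m * proj₁ i)
    eq : ∀ a b c → a * (b * c) ≡ a * c * b
    eq = solve-∀ ℚ-ring

abstract
  approx-root : ∀ {d} (P : Vec ℂ (suc d)) ε → 0ℚ < ε → Σ ℂ λ z → evM P z ≼ ε
  approx-root {d} P = ApproxRoot.root P (proj₁ (kneser (suc d))) (proj₁ (proj₂ (kneser (suc d)))) (proj₂ (proj₂ (kneser (suc d))))

data Close (e : ℚ) : ∀ {d} → Vec ℂ d → Vec ℂ d → Set where
  [] : Close e [] []
  _∷_ : ∀ {d c c′} {p p′ : Vec ℂ d} → c -ᶜ c′ ≼ e → Close e p p′ → Close e (c ∷ p) (c′ ∷ p′)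

close-ev : ∀ {e d z} {p p′ : Vec ℂ d} → z ≼ 1ℚ → Close e p p′ → evM p z -ᶜ evM p′ z ≼ ι d * e
close-ev {e} _ [] = subst₂ _≼_ refl (sym (*-zeroˡ e)) (0≼ ≤-refl)
close-ev {e} {suc d} {z} {c ∷ p} {c′ ∷ p′} z≼1 (q ∷ qs) = subst₂ _≼_ (eq c c′ z (evM p z) (evM p′ z)) (eq′ e (ι d)) (≼-+ q (≼-* z≼1 (close-ev z≼1 qs)))
  where
  eq : ∀ c c′ z e e′ → (c -ᶜ c′) +ᶜ z *ᶜ (e -ᶜ e′) ≡ (c +ᶜ z *ᶜ e) -ᶜ (c′ +ᶜ z *ᶜ e′)
  eq = solve-∀ ℂ-ring
  eq′ : ∀ e n → e + 1ℚ * (n * e) ≡ (1ℚ + n) * e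
  eq′ = solve-∀ ℚ-ring

close-mulLin : ∀ {E e₁ e₂ ζ c c′ w d} {p p′ : Vec ℂ d} → 0ℚ ≤ e₂ → c -ᶜ c′ ≼ e₁ → w ≼ ζ → Close e₂ p p′ →
  e₁ + ζ * e₂ ≤ E → e₂ + ζ * e₂ ≤ E → Close E (mulLin c w p) (mulLin c′ w p′)
close-mulLin {E} {e₁} {e₂} {ζ} {c} {c′} {w} 0≤e₂ q b [] le₁ le₂ =
  subst (_≼ E) (eq c c′ w) (≼-mono q (≤-trans (≤-by (0≤* (0≤bound b) 0≤e₂) refl) le₁)) ∷ []
  where
  eq : ∀ c c′ w → c -ᶜ c′ ≡ (c +ᶜ w) -ᶜ (c′ +ᶜ w)
  eq = solve-∀ ℂ-ring
close-mulLin {E} {e₁} {e₂} {ζ} {c} {c′} {w} {p = h ∷ hs} {h′ ∷ hs′} 0≤e₂ q b (r ∷ rs) le₁ le₂ =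
  subst (_≼ E) (eq c c′ w h h′) (≼-mono (≼-+ q (≼-* b r)) le₁) ∷ close-mulLin 0≤e₂ r b rs le₂ le₂
  where
  eq : ∀ c c′ w h h′ → (c -ᶜ c′) +ᶜ w *ᶜ (h -ᶜ h′) ≡ (c +ᶜ w *ᶜ h) -ᶜ (c′ +ᶜ w *ᶜ h′)
  eq = solve-∀ ℂ-ring

rootsPoly : ∀ {d} → Vec ℂ d → Vec ℂ d
rootsPoly [] = []
rootsPoly (z ∷ zs) = mulLin 0ᶜ (-ᶜ z) (rootsPoly zs)

evM-rootsPoly : ∀ {d} z (zs : Vec ℂ d) w → evM (rootsPoly (z ∷ zs)) w ≡ (w -ᶜ z) *ᶜ evM (rootsPoly zs) w
evM-rootsPoly z zs w = trans (evM-mulLin 0ᶜ (-ᶜ z) (rootsPoly zs) w) (eq z w (evM (rootsPoly zs) w))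
  where
  eq : ∀ z w e → 0ᶜ +ᶜ (-ᶜ z +ᶜ w) *ᶜ e ≡ (w -ᶜ z) *ᶜ e
  eq = solve-∀ ℂ-ring

abstract
  -- Divide by x - z at an approximate root z, replace the remainder P(z) by 0, and recurse on the
  -- quotient.
  approx-factorisation : ∀ {d} (P : Vec ℂ d) ε → 0ℚ < ε → Σ (Vec ℂ d) λ zs → Close ε P (rootsPoly zs)
  approx-factorisation [] ε 0<ε = [] , []
  approx-factorisation {suc d} P ε 0<ε = from (approx-root P (ε * ½) (0<* 0<ε (positive⁻¹ ½)))
    where
    from : (Σ ℂ λ z → evM P z ≼ ε * ½) → Σ (Vec ℂ (suc d)) λ zs → Close ε P (rootsPoly zs)
    from (z , b) = z ∷ proj₁ rest , subst (λ p → Close ε p (rootsPoly (z ∷ proj₁ rest))) (divisionM P z)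
        (close-mulLin (<⇒≤ 0<e) (subst (_≼ ε * ½) (eq (evM P z)) b) (≼-neg (≼‖‖ z)) (proj₂ rest)
          (≤-by (<⇒≤ 0<e) (trans (half ε) (trans (cong (ε * ½ +_) (trans (sym (proj₂ (proj₂ i′))) (eq′ m e))) (sym (+-assoc (ε * ½) (m * e) e)))))
          (≤-by (0≤* (<⇒≤ 0<ε) 0≤½) (trans (half ε) (cong (_+ ε * ½) (trans (sym (proj₂ (proj₂ i′))) (eq″ m e))))))
      where
      m : ℚ
      m = ‖ z ‖
      0<m+1 : 0ℚ < 1ℚ + m
      0<m+1 = 0<+ 0<1 (0≤‖‖ z)
      -- Multiplying back by x - z enlarges the error e of the quotient at most by 1 + ‖z‖. That
      -- product gets one half of ε, the dropped remainder the other.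
      i′ : Σ ℚ λ e → 0ℚ < e × (1ℚ + m) * e ≡ ε * ½
      i′ = let (i , 0<i , q) = inv⁺ 0<m+1 in ε * ½ * i , 0<* (0<* 0<ε (positive⁻¹ ½)) 0<i ,
             trans (assoc (1ℚ + m) (ε * ½) i) (trans (cong (ε * ½ *_) q) (*-identityʳ (ε * ½)))
        where
        assoc : ∀ a b c → a * (b * c) ≡ b * (a * c)
        assoc = solve-∀ ℚ-ring
      e : ℚ
      e = proj₁ i′
      0<e : 0ℚ < e
      0<e = proj₁ (proj₂ i′)
      rest : Σ (Vec ℂ d) λ zs → Close e (quotM P z) (rootsPoly zs)
      rest = approx-factorisation (quotM P z) e 0<e
      eq : ∀ a → a ≡ a -ᶜ 0ᶜ
      eq = solve-∀ ℂ-ring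
      half : ∀ ε → ε ≡ ε * ½ + ε * ½
      half = solve-∀ ℚ-ring
      eq′ : ∀ m e → (1ℚ + m) * e ≡ m * e + e
      eq′ = solve-∀ ℚ-ring
      eq″ : ∀ m e → (1ℚ + m) * e ≡ e + m * e
      eq″ = solve-∀ ℚ-ring

-- Refining an approximate small root

prodAt : ∀ {d} → Vec ℂ d → ℂ → ℂ
prodAt [] w = 1ᶜ
prodAt (z ∷ zs) w = (w -ᶜ z) *ᶜ prodAt zs w

evM-roots : ∀ {d} (zs : Vec ℂ d) w → evM (rootsPoly zs) w ≡ prodAt zs w
evM-roots [] w = refl
evM-roots (z ∷ zs) w = trans (evM-rootsPoly z zs w) (cong ((w -ᶜ z) *ᶜ_) (evM-roots zs w))

-- If every root were further than h from w, the product of the distances would exceed the given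
-- bound.
nearest : ∀ {d} (zs : Vec ℂ (suc d)) w h → 0ℚ < h → N (prodAt zs w) ≤ h ^ suc d * h ^ suc d →
  Σ ℂ λ z → w -ᶜ z ≼ h × prodAt zs z ≡ 0ᶜ
nearest {zero} (z ∷ []) w h 0<h le = z , mk≼ (<⇒≤ 0<h) (base (w -ᶜ z) h le) , eq′ z 1ᶜ
  where
  eq : ∀ a → a *ᶜ 1ᶜ ≡ a
  eq = solve-∀ ℂ-ring
  base : ∀ a h → N (a *ᶜ 1ᶜ) ≤ (h * 1ℚ) * (h * 1ℚ) → N a ≤ h * h
  base a h le = subst₂ _≤_ (cong N (eq a)) (cong₂ _*_ (*-identityʳ h) (*-identityʳ h)) le
  eq′ : ∀ z e → (z -ᶜ z) *ᶜ e ≡ 0ᶜ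
  eq′ = solve-∀ ℂ-ring
nearest {suc d} (z ∷ zs) w h 0<h le = case≤ (N (w -ᶜ z)) (h * h)
    (λ p → found z (mk≼ (<⇒≤ 0<h) p) (eq′ z (prodAt zs z)))
    λ p → lift (nearest zs w h 0<h (rest≤ (w -ᶜ z) (prodAt zs w) (h ^ suc d) (<⇒≤ p) le))
  where
  eq′ : ∀ z e → (z -ᶜ z) *ᶜ e ≡ 0ᶜ
  eq′ = solve-∀ ℂ-ring
  eq″ : ∀ a → a *ᶜ 0ᶜ ≡ 0ᶜ
  eq″ = solve-∀ ℂ-ring
  eq : ∀ h H → (h * H) * (h * H) ≡ H * H * (h * h)
  eq = solve-∀ ℚ-ring
  found : ∀ z₁ → w -ᶜ z₁ ≼ h → (z₁ -ᶜ z) *ᶜ prodAt zs z₁ ≡ 0ᶜ → Σ ℂ λ z₁ → w -ᶜ z₁ ≼ h × (z₁ -ᶜ z) *ᶜ prodAt zs z₁ ≡ 0ᶜ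
  found z₁ p q = z₁ , p , q
  lift : (Σ ℂ λ z₁ → w -ᶜ z₁ ≼ h × prodAt zs z₁ ≡ 0ᶜ) → Σ ℂ λ z₁ → w -ᶜ z₁ ≼ h × (z₁ -ᶜ z) *ᶜ prodAt zs z₁ ≡ 0ᶜ
  lift (z₁ , p , q) = z₁ , p , trans (cong ((z₁ -ᶜ z) *ᶜ_) q) (eq″ (z₁ -ᶜ z))
  rest≤ : ∀ a E H → h * h ≤ N a → N (a *ᶜ E) ≤ (h * H) * (h * H) → N E ≤ H * H
  rest≤ a E H p le = *-cancelʳ (h * h) (0<* 0<h 0<h) (≤-trans (*-monoˡ (N E) (0≤N E) p)
    (≤-trans (≤-reflexive (trans (*-comm (N E) (N a)) (sym (N-* a E))))
      (≤-trans le (≤-reflexive (eq h H)))))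

½^≤recip : ∀ m → ½ ^ m ≤ ℤ.+ 1 / suc m
½^≤recip m = *-cancelʳ (ι (suc m)) (0<ι m) (≤-trans (*-monoˡ (½ ^ m) (0≤^ m 0≤½) (≤-trans (≤-reflexive (+-comm 1ℚ (ι m))) (ι≤2^ m)))
    (≤-reflexive (trans (cancel m) (sym (trans (*-comm _ (ι (suc m))) (recip m))))))
  where
  eq : ∀ a b → ½ * a * ((1ℚ + 1ℚ) * b) ≡ a * b
  eq = solve-∀ ℚ-ring
  cancel : ∀ m → ½ ^ m * 2ℚ ^ m ≡ 1ℚ
  cancel zero = refl
  cancel (suc m) = trans (eq (½ ^ m) (2ℚ ^ m)) (cancel m)

4× : ℚ → ℚ
4× q = (q + q) + (q + q)

-- A root in the open unit disc with explicit rates of convergence instead of a limit; the fixed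
-- `gap` keeps |λ| < 1 strict in the limit.
record SmallRoot {d} (P : Vec ℂ d) : Set where
  field
    root : ℕ → ℂ
    gap : ℚ
    0<gap : 0ℚ < gap
    gap≤1 : gap ≤ 1ℚ
    root≼ : ∀ k → root k ≼ 1ℚ - gap
    root-cauchy : ∀ m p q → m ℕ.≤ p → m ℕ.≤ q → root p -ᶜ root q ≼ ℤ.+ 1 / suc m
    root-zero : ∀ m p → m ℕ.≤ p → evM P (root p) ≼ ℤ.+ 1 / suc m

module Refine {d : ℕ} (P : Vec ℂ (suc d)) (q : ℚ) (0<q : 0ℚ < q) (4q≤1 : 4× q ≤ 1ℚ) where
  η : ℕ → ℚ
  η k = q * ½ ^ k

  0<η : ∀ k → 0ℚ < η k
  0<η k = 0<* 0<q (0<^ k (positive⁻¹ ½))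

  0≤q : 0ℚ ≤ q
  0≤q = <⇒≤ 0<q

  q≤1 : q ≤ 1ℚ
  q≤1 = ≤-trans (≤-by (0≤+ (0≤+ 0≤q 0≤q) 0≤q) (eq q)) 4q≤1
    where
    eq : ∀ q → (q + q) + (q + q) ≡ q + (q + q + q)
    eq = solve-∀ ℚ-ring

  η-half : ∀ k → η (suc k) + η (suc k) ≡ η k
  η-half k = eq q (½ ^ k)
    where
    eq : ∀ q h → q * (½ * h) + q * (½ * h) ≡ q * h
    eq = solve-∀ ℚ-ring

  η≤½^ : ∀ k → 4× (η k) ≤ ½ ^ k
  η≤½^ k = ≤-trans (≤-reflexive (eq q (½ ^ k))) (≤-trans (*-monoʳ (½ ^ k) (0≤^ k 0≤½) 4q≤1) (≤-reflexive (*-identityˡ (½ ^ k))))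
    where
    eq : ∀ q h → ((q * h + q * h) + (q * h + q * h)) ≡ ((q + q) + (q + q)) * h
    eq = solve-∀ ℚ-ring

  -- Radius allowed at stage k. All steps from stage k on add up to at most 2 η_k, so iterates that
  -- start within `ρ 0` = 1 - 4q never leave the disc of radius 1 - 2q.
  ρ : ℕ → ℚ
  ρ k = 1ℚ - (q + q) - (η k + η k)

  -- |P(z)| and the error of the factorisation each take one half of η_k^(d+1), the bound under
  -- which `nearest` moves z by at most η_k.
  tol : ℕ → ℚ
  tol k = η k ^ suc d * ½

  η-antitone : ∀ {j k} → j ℕ.≤ k → η k ≤ η j
  η-antitone le = *-monoˡ q 0≤q (^-antitone 0≤½ ½≤1 le)

  η≤1 : ∀ k → η k ≤ 1ℚ
  η≤1 k = ≤-trans (*-mono 0≤q q≤1 (0≤^ k 0≤½) (^≤1 k 0≤½ ½≤1)) ≤-refl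

  ^-mono : ∀ {a b} n → 0ℚ ≤ a → a ≤ b → a ^ n ≤ b ^ n
  ^-mono zero p le = ≤-refl
  ^-mono (suc n) p le = *-mono p le (0≤^ n p) (^-mono n p le)

  0<tol : ∀ k → 0ℚ < tol k
  0<tol k = 0<* (0<^ (suc d) (0<η k)) (positive⁻¹ ½)

  tol-mono : ∀ k → tol (suc k) ≤ tol k
  tol-mono k = *-monoʳ ½ 0≤½ (^-mono (suc d) (<⇒≤ (0<η (suc k))) (η-antitone (ℕₚ.n≤1+n k)))

  tol≤η : ∀ k → tol k ≤ η k
  tol≤η k = ≤-trans (*-mono (0≤^ (suc d) 0≤ηk) (≤-trans (*-monoˡ (η k) 0≤ηk (^≤1 d 0≤ηk (η≤1 k))) (≤-reflexive (*-identityʳ (η k)))) 0≤½ ½≤1) (≤-reflexive (*-identityʳ (η k)))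
    where
    0≤ηk = <⇒≤ (0<η k)

  ρ≤1 : ∀ k → ρ k ≤ 1ℚ - (q + q)
  ρ≤1 k = ≤-by (0≤+ (<⇒≤ (0<η k)) (<⇒≤ (0<η k))) (eq q (η k))
    where
    eq : ∀ q h → 1ℚ - (q + q) ≡ 1ℚ - (q + q) - (h + h) + (h + h)
    eq = solve-∀ ℚ-ring

  1-2q≤1 : 1ℚ - (q + q) ≤ 1ℚ
  1-2q≤1 = ≤-by (0≤+ 0≤q 0≤q) (eq q)
    where
    eq : ∀ q → 1ℚ ≡ 1ℚ - (q + q) + (q + q)
    eq = solve-∀ ℚ-ring

  Stage : ℕ → ℂ → Set
  Stage k z = z ≼ ρ k × evM P z ≼ tol k

  abstract
    -- P is factorised afresh with a smaller error and z moves to the nearest exact root of the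
    -- approximant, where |P| is at most that error.
    step : ∀ k z → Stage k z → Σ ℂ λ z′ → Stage (suc k) z′ × z -ᶜ z′ ≼ η k
    step k z (z≼ , Pz) = from (approx-factorisation P e 0<e)
      where
      e : ℚ
      e = tol (suc k) * (ℤ.+ 1 / suc d)
      0<e : 0ℚ < e
      0<e = 0<* (0<tol (suc k)) (0<recip d)
      de≡ : ι (suc d) * e ≡ tol (suc k)
      de≡ = trans (eq (ι (suc d)) (tol (suc k)) (ℤ.+ 1 / suc d)) (trans (cong (tol (suc k) *_) (recip d)) (*-identityʳ _))
        where
        eq : ∀ a b c → a * (b * c) ≡ b * (a * c)
        eq = solve-∀ ℚ-ring
      z≼1 : z ≼ 1ℚ
      z≼1 = ≼-mono z≼ (≤-trans (ρ≤1 k) 1-2q≤1)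
      from : (Σ (Vec ℂ (suc d)) λ zs → Close e P (rootsPoly zs)) → Σ ℂ λ z′ → Stage (suc k) z′ × z -ᶜ z′ ≼ η k
      from (zs , cl) = finish (nearest zs z (η k) (0<η k) (N≤ Πz))
        where
        Π : ℂ → ℂ
        Π = prodAt zs
        err : ∀ {w} → w ≼ 1ℚ → evM P w -ᶜ Π w ≼ tol (suc k)
        err {w} w≼1 = subst₂ (λ x y → evM P w -ᶜ x ≼ y) (evM-roots zs w) de≡ (close-ev w≼1 cl)
        Πz : Π z ≼ η k ^ suc d
        Πz = subst (_≼ η k ^ suc d) (eq (evM P z) (Π z)) (≼-mono (≼-sub Pz (err z≼1)) (≤-trans (+-monoʳ-≤ (tol k) (tol-mono k)) (≤-reflexive (eq′ (η k ^ suc d)))))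
          where
          eq : ∀ a b → a -ᶜ (a -ᶜ b) ≡ b
          eq = solve-∀ ℂ-ring
          eq′ : ∀ x → x * ½ + x * ½ ≡ x
          eq′ = solve-∀ ℚ-ring
        finish : (Σ ℂ λ z′ → z -ᶜ z′ ≼ η k × Π z′ ≡ 0ᶜ) → Σ ℂ λ z′ → Stage (suc k) z′ × z -ᶜ z′ ≼ η k
        finish (z′ , near , Πz′) = z′ , (z′≼ , subst (_≼ tol (suc k)) (trans (cong (λ w → evM P z′ -ᶜ w) Πz′) (eq₂ (evM P z′))) (err z′≼1)) , near
          where
          eq₂ : ∀ a → a -ᶜ 0ᶜ ≡ a
          eq₂ = solve-∀ ℂ-ring
          eq₃ : ∀ a b → a -ᶜ (a -ᶜ b) ≡ b
          eq₃ = solve-∀ ℂ-ring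
          eq₄ : ∀ q h → 1ℚ - (q + q) - (h + h) + h ≡ 1ℚ - (q + q) - h
          eq₄ = solve-∀ ℚ-ring
          z′≼ : z′ ≼ ρ (suc k)
          z′≼ = subst₂ _≼_ (eq₃ z z′) (trans (eq₄ q (η k)) (cong (λ w → 1ℚ - (q + q) - w) (sym (η-half k)))) (≼-sub z≼ near)
          z′≼1 : z′ ≼ 1ℚ
          z′≼1 = ≼-mono z′≼ (≤-trans (ρ≤1 (suc k)) 1-2q≤1)

  refine : ∀ z → z ≼ 1ℚ - 4× q → evM P z ≼ tol 0 → SmallRoot P
  refine z₀ z₀≼ Pz₀ = record
    { root = λ k → proj₁ (stages k) ; gap = q + q ; 0<gap = 0<+ 0<q 0≤q
    ; gap≤1 = ≤-trans (≤-by (0≤+ 0≤q 0≤q) refl) 4q≤1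
    ; root≼ = λ k → ≼-mono (proj₁ (proj₂ (stages k))) (ρ≤1 k)
    -- Both iterates lie within 2 η_m of iterate m, and 4q ≤ 1 turns 4 η_m into a bound by ½^m.
    ; root-cauchy = λ m i j m≤i m≤j → ≼-mono (subst (_≼ _) (eqd (r i) (r j) (r m)) (≼-sub (from-m m j m≤j) (from-m m i m≤i))) (≤-trans (η≤½^ m) (½^≤recip m))
    ; root-zero = λ m p m≤p → ≼-mono (proj₂ (proj₂ (stages p))) (≤-trans (tol≤η p) (≤-trans (η-antitone m≤p) (≤-trans (≤-by (0≤+ (0≤+ (0η m) (0η m)) (0η m)) (eq4 (η m))) (≤-trans (η≤½^ m) (½^≤recip m)))))
    }
    where
    stages : ∀ k → Σ ℂ (Stage k)
    stages zero = z₀ , subst (z₀ ≼_) (eq q) z₀≼ , Pz₀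
      where
      eq : ∀ q → 1ℚ - ((q + q) + (q + q)) ≡ 1ℚ - (q + q) - (q * 1ℚ + q * 1ℚ)
      eq = solve-∀ ℚ-ring
    stages (suc k) = proj₁ (step k (proj₁ (stages k)) (proj₂ (stages k))) , proj₁ (proj₂ (step k (proj₁ (stages k)) (proj₂ (stages k))))
    r : ℕ → ℂ
    r k = proj₁ (stages k)
    0η : ∀ k → 0ℚ ≤ η k
    0η k = <⇒≤ (0<η k)
    eq4 : ∀ h → (h + h) + (h + h) ≡ h + (h + h + h)
    eq4 = solve-∀ ℚ-ring
    r-step : ∀ k → r k -ᶜ r (suc k) ≼ η k
    r-step k = proj₂ (proj₂ (step k (proj₁ (stages k)) (proj₂ (stages k))))
    eqd : ∀ i j m → (m -ᶜ j) -ᶜ (m -ᶜ i) ≡ i -ᶜ j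
    eqd = solve-∀ ℂ-ring
    tele : ∀ m j → r m -ᶜ r (j ℕ.+ m) ≼ (η m + η m) - (η (j ℕ.+ m) + η (j ℕ.+ m))
    tele m zero = subst₂ _≼_ (eq (r m)) (eq′ (η m)) (0≼ ≤-refl)
      where
      eq : ∀ a → 0ᶜ ≡ a -ᶜ a
      eq = solve-∀ ℂ-ring
      eq′ : ∀ h → 0ℚ ≡ (h + h) - (h + h)
      eq′ = solve-∀ ℚ-ring
    tele m (suc j) = subst₂ _≼_ (eq (r m) (r (j ℕ.+ m)) (r (suc (j ℕ.+ m)))) (trans (eq′ (η m) (η (j ℕ.+ m))) (cong (λ w → (η m + η m) - w) (sym (η-half (j ℕ.+ m)))))
        (≼-+ (tele m j) (r-step (j ℕ.+ m)))
      where
      eq : ∀ a b c → (a -ᶜ b) +ᶜ (b -ᶜ c) ≡ a -ᶜ c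
      eq = solve-∀ ℂ-ring
      eq′ : ∀ h k → (h + h) - (k + k) + k ≡ (h + h) - k
      eq′ = solve-∀ ℚ-ring
    from-m : ∀ m p → m ℕ.≤ p → r m -ᶜ r p ≼ η m + η m
    from-m m p m≤p = subst (λ p → r m -ᶜ r p ≼ η m + η m) (ℕₚ.m∸n+n≡m m≤p)
      (≼-mono (tele m (p ℕ.∸ m)) (≤-by (0≤+ (0η (p ℕ.∸ m ℕ.+ m)) (0η (p ℕ.∸ m ℕ.+ m))) (eq (η m + η m) (η (p ℕ.∸ m ℕ.+ m) + η (p ℕ.∸ m ℕ.+ m)))))
      where
      eq : ∀ a b → a ≡ a - b + b
      eq = solve-∀ ℚ-ring

-- Minimal polynomials of rational matrices

sumF-cong : ∀ {n} {f g : Fin n → ℚ} → (∀ i → f i ≡ g i) → sumF f ≡ sumF g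
sumF-cong {zero} e = refl
sumF-cong {suc n} e = cong₂ _+_ (e zero) (sumF-cong (λ i → e (suc i)))

sumF-+ : ∀ {n} (f g : Fin n → ℚ) → sumF (λ i → f i + g i) ≡ sumF f + sumF g
sumF-+ {zero} f g = refl
sumF-+ {suc n} f g = trans (cong (λ s → f zero + g zero + s) (sumF-+ (λ i → f (suc i)) (λ i → g (suc i)))) (eq (f zero) (g zero) _ _)
  where
  eq : ∀ a b c d → a + b + (c + d) ≡ (a + c) + (b + d)
  eq = solve-∀ ℚ-ring

sumF-* : ∀ {n} c (f : Fin n → ℚ) → sumF (λ i → c * f i) ≡ c * sumF f
sumF-* {zero} c f = sym (*-zeroʳ c)
sumF-* {suc n} c f = trans (cong (c * f zero +_) (sumF-* c (λ i → f (suc i)))) (sym (*-distribˡ-+ c (f zero) _))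

sumF-0 : ∀ n → sumF {n} (λ _ → 0ℚ) ≡ 0ℚ
sumF-0 zero = refl
sumF-0 (suc n) = trans (+-identityˡ _) (sumF-0 n)

sumF-swap : ∀ {m n} (f : Fin m → Fin n → ℚ) → sumF (λ i → sumF (f i)) ≡ sumF (λ j → sumF (λ i → f i j))
sumF-swap {zero} {n} f = sym (sumF-0 n)
sumF-swap {suc m} f = trans (cong (sumF (f zero) +_) (sumF-swap (λ i → f (suc i)))) (sym (sumF-+ (f zero) (λ j → sumF (λ i → f (suc i) j))))

δ : ∀ {n} → Fin n → Fin n → ℚ
δ zero zero = 1ℚ
δ zero (suc _) = 0ℚ
δ (suc _) zero = 0ℚ
δ (suc i) (suc j) = δ i j

sumF-δ : ∀ {n} (i : Fin n) (x : Vecℚ n) → sumF (λ j → δ i j * x j) ≡ x i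
sumF-δ {suc n} zero x = trans (cong₂ _+_ (*-identityˡ (x zero)) (trans (sumF-cong (λ j → *-zeroˡ (x (suc j)))) (sumF-0 n))) (+-identityʳ _)
sumF-δ (suc i) x = trans (cong₂ _+_ (*-zeroˡ (x zero)) (sumF-δ i (λ j → x (suc j)))) (+-identityˡ _)

δ-sym : ∀ {n} (i j : Fin n) → δ i j ≡ δ j i
δ-sym zero zero = refl
δ-sym zero (suc j) = refl
δ-sym (suc i) zero = refl
δ-sym (suc i) (suc j) = δ-sym i j

dot : ∀ {n} → Vecℚ n → Vecℚ n → ℚ
dot f x = sumF (λ i → f i * x i)

dot-cong : ∀ {n} (f : Vecℚ n) {x y : Vecℚ n} → x ≈ y → dot f x ≡ dot f y
dot-cong f e = sumF-cong (λ i → cong (f i *_) (e i))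

dot-+ : ∀ {n} (f x y : Vecℚ n) → dot f (λ i → x i + y i) ≡ dot f x + dot f y
dot-+ f x y = trans (sumF-cong (λ i → *-distribˡ-+ (f i) (x i) (y i))) (sumF-+ (λ i → f i * x i) (λ i → f i * y i))

dot-* : ∀ {n} (f : Vecℚ n) c (x : Vecℚ n) → dot f (λ i → c * x i) ≡ c * dot f x
dot-* f c x = trans (sumF-cong (λ i → eq (f i) c (x i))) (sumF-* c (λ i → f i * x i))
  where
  eq : ∀ a b c → a * (b * c) ≡ b * (a * c)
  eq = solve-∀ ℚ-ring

dot-0 : ∀ {n} (f : Vecℚ n) {x : Vecℚ n} → (∀ i → x i ≡ 0ℚ) → dot f x ≡ 0ℚ
dot-0 {n} f e = trans (sumF-cong (λ i → trans (cong (f i *_) (e i)) (*-zeroʳ (f i)))) (sumF-0 n)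

comb : ∀ {m j} → Vec ℚ j → (ℕ → Vecℚ m) → Vecℚ m
comb [] u i = 0ℚ
comb (c ∷ cs) u i = c * u 0 i + comb cs (λ k → u (suc k)) i

comb-cong : ∀ {m j} (cs : Vec ℚ j) {u v : ℕ → Vecℚ m} → (∀ k → u k ≈ v k) → comb cs u ≈ comb cs v
comb-cong [] e i = refl
comb-cong (c ∷ cs) e i = cong₂ _+_ (cong (c *_) (e 0 i)) (comb-cong cs (λ k → e (suc k)) i)

dot-comb : ∀ {m j} (f : Vecℚ m) (cs : Vec ℚ j) u → (∀ k → k ℕ.< j → dot f (u k) ≡ 0ℚ) → dot f (comb cs u) ≡ 0ℚ
dot-comb f [] u e = dot-0 f (λ _ → refl)
dot-comb f (c ∷ cs) u e = trans (dot-+ f (λ i → c * u 0 i) (comb cs (λ k → u (suc k))))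
  (trans (cong₂ _+_ (trans (dot-* f c (u 0)) (trans (cong (c *_) (e 0 (ℕ.s≤s ℕ.z≤n))) (*-zeroʳ c)))
     (dot-comb f cs (λ k → u (suc k)) (λ k k<j → e (suc k) (ℕ.s≤s k<j)))) (+-identityʳ 0ℚ))

-- Gaussian elimination over ℚ

zero-or-pivot : ∀ {m} (w : Vecℚ m) → (∀ i → w i ≡ 0ℚ) ⊎ (Σ (Fin m) λ i → Σ ℚ λ q → w i * q ≡ 1ℚ)
zero-or-pivot w with any? (λ i → ¬? (w i ≟ 0ℚ))
... | yes (i , p) = inj₂ (i , inv≢ p)
... | no p = inj₁ λ i → decidable-stable (w i ≟ 0ℚ) λ ne → p (i , ne)

-- One elimination step: `proj` subtracts the multiple of w that clears coordinate i, and so kills w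
-- itself.
module Pivot {m} (w : Vecℚ m) (i : Fin m) (q : ℚ) (wq : w i * q ≡ 1ℚ) where
  proj : Vecℚ m → Vecℚ m
  proj x l = x l - x i * q * w l

  proj-i : ∀ x → proj x i ≡ 0ℚ
  proj-i x = trans (eq (x i) q (w i)) (trans (cong (λ e → x i - x i * e) wq) (eq′ (x i)))
    where
    eq : ∀ x q w → x - x * q * w ≡ x - x * (w * q)
    eq = solve-∀ ℚ-ring
    eq′ : ∀ x → x - x * 1ℚ ≡ 0ℚ
    eq′ = solve-∀ ℚ-ring

  proj-w : ∀ l → proj w l ≡ 0ℚ
  proj-w l = trans (cong (λ e → w l - e * w l) wq) (eq (w l))
    where
    eq : ∀ x → x - 1ℚ * x ≡ 0ℚ
    eq = solve-∀ ℚ-ring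

  comb-proj : ∀ {j} (cs : Vec ℚ j) v l → comb cs (λ k → proj (v k)) l ≡ proj (comb cs v) l
  comb-proj [] v l = eq q (w l)
    where
    eq : ∀ q w → 0ℚ ≡ 0ℚ - 0ℚ * q * w
    eq = solve-∀ ℚ-ring
  comb-proj (c ∷ cs) v l = trans (cong (c * proj (v 0) l +_) (comb-proj cs (λ k → v (suc k)) l))
      (eq c (v 0 l) (v 0 i) q (w l) (comb cs (λ k → v (suc k)) l) (comb cs (λ k → v (suc k)) i))
    where
    eq : ∀ c a b q w s t → c * (a - b * q * w) + (s - t * q * w) ≡ (c * a + s) - (c * b + t) * q * w
    eq = solve-∀ ℚ-ring

  lift-span : ∀ {j} (cs : Vec ℚ j) v x → (∀ l → proj x l ≡ comb cs (λ k → proj (v k)) l) →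
    Σ ℚ λ c → ∀ l → x l ≡ c * w l + comb cs v l
  lift-span cs v x e = (x i - comb cs v i) * q , λ l →
      trans (eq (x l) (x i * q * w l)) (trans (cong (_+ x i * q * w l) (trans (e l) (comb-proj cs v l))) (eq′ (comb cs v l) (comb cs v i) q (w l) (x i)))
    where
    eq : ∀ a b → a ≡ a - b + b
    eq = solve-∀ ℚ-ring
    eq′ : ∀ s t q w x → s - t * q * w + x * q * w ≡ (x - t) * q * w + s
    eq′ = solve-∀ ℚ-ring

  -- The transpose of `proj`; functionals obtained in this way vanish on w.
  pullback : Vecℚ m → Vecℚ m
  pullback f l = f l - dot f w * q * δ i l

  dot-pullback : ∀ f x → dot (pullback f) x ≡ dot f (proj x)
  dot-pullback f x = trans (sumF-cong (λ l → eq₁ (f l) (dot f w * q) (δ i l) (x l)))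
    (trans (sumF-+ (λ l → f l * x l) (λ l → - (dot f w * q) * (δ i l * x l)))
    (trans (cong (dot f x +_) (trans (sumF-* (- (dot f w * q)) (λ l → δ i l * x l)) (cong (- (dot f w * q) *_) (sumF-δ i x))))
    (sym (trans (dot-cong f (λ l → eq₂ (x l) (x i * q) (w l))) (trans (dot-+ f x (λ l → - (x i * q) * w l))
      (cong (dot f x +_) (trans (dot-* f (- (x i * q)) w) (eq₃ (x i) q (dot f w)))))))))
    where
    eq₁ : ∀ f d e x → (f - d * e) * x ≡ f * x + - d * (e * x)
    eq₁ = solve-∀ ℚ-ring
    eq₂ : ∀ x a w → x - a * w ≡ x + - a * w
    eq₂ = solve-∀ ℚ-ring
    eq₃ : ∀ x q d → - (x * q) * d ≡ - (d * q) * x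
    eq₃ = solve-∀ ℚ-ring

InSpan : ∀ {m} → (ℕ → Vecℚ m) → ℕ → Set
InSpan u j = Σ (Vec ℚ j) λ cs → ∀ i → u j i ≡ comb cs u i

-- Each pivot removes one coordinate, so a dependence appears after at most m of them.
dependent : ∀ m (u : ℕ → Vecℚ m) → Σ ℕ (InSpan u)
dependent zero u = 0 , [] , λ ()
dependent (suc m) u = go (zero-or-pivot (u 0))
  where
  go : (∀ i → u 0 i ≡ 0ℚ) ⊎ (Σ (Fin (suc m)) λ i → Σ ℚ λ q → u 0 i * q ≡ 1ℚ) → Σ ℕ (InSpan u)
  go (inj₁ e) = 0 , [] , e
  go (inj₂ (i , q , wq)) = extend (dependent m (λ k l → proj (u (suc k)) (punchIn i l)))
    where
    open Pivot (u 0) i q wq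
    extend : Σ ℕ (InSpan (λ k l → proj (u (suc k)) (punchIn i l))) → Σ ℕ (InSpan u)
    extend (j , cs , e) = suc j , proj₁ lifted ∷ cs , proj₂ lifted
      where
      comb-punch : ∀ {j} (cs : Vec ℚ j) (v : ℕ → Vecℚ (suc m)) l → comb cs (λ k l → v k (punchIn i l)) l ≡ comb cs v (punchIn i l)
      comb-punch [] v l = refl
      comb-punch (c ∷ cs) v l = cong (c * v 0 (punchIn i l) +_) (comb-punch cs (λ k → v (suc k)) l)
      full : ∀ l → proj (u (suc j)) l ≡ comb cs (λ k → proj (u (suc k))) l
      full l with i ≟ᶠ l
      ... | yes refl = trans (proj-i (u (suc j))) (sym (trans (comb-proj cs (λ k → u (suc k)) i) (proj-i (comb cs (λ k → u (suc k))))))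
      ... | no i≢l = subst (λ l → proj (u (suc j)) l ≡ comb cs (λ k → proj (u (suc k))) l) (punchIn-punchOut i≢l)
              (trans (e (punchOut i≢l)) (comb-punch cs (λ k → proj (u (suc k))) (punchOut i≢l)))
      lifted = lift-span cs (λ k → u (suc k)) (u (suc j)) full

-- A dual certificate that u_d lies outside the span of its predecessors. Unlike the bare negation
-- of `InSpan` it yields numerical bounds.
Separated : ∀ {m} → (ℕ → Vecℚ m) → ℕ → Set
Separated {m} u d = Σ (Vecℚ m) λ f → dot f (u d) ≡ 1ℚ × (∀ k → k ℕ.< d → dot f (u k) ≡ 0ℚ)

-- Elimination with pivot u_0: a combination is lifted through the projection, a separating
-- functional is pulled back along it.
span-or-separated : ∀ {m} d (u : ℕ → Vecℚ m) → InSpan u d ⊎ Separated u d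
span-or-separated {m} zero u = go (zero-or-pivot (u 0))
  where
  go : (∀ i → u 0 i ≡ 0ℚ) ⊎ (Σ (Fin m) λ i → Σ ℚ λ q → u 0 i * q ≡ 1ℚ) → InSpan u 0 ⊎ Separated u 0
  go (inj₁ e) = inj₁ ([] , e)
  go (inj₂ (i , q , wq)) = inj₂ ((λ l → q * δ i l) , trans (sumF-cong (λ l → *-assoc q (δ i l) (u 0 l)))
    (trans (sumF-* q (λ l → δ i l * u 0 l)) (trans (cong (q *_) (sumF-δ i (u 0))) (trans (*-comm q (u 0 i)) wq))) , λ _ ())
span-or-separated {m} (suc d) u = go (zero-or-pivot (u 0))
  where
  Goal = InSpan u (suc d) ⊎ Separated u (suc d)
  go : (∀ i → u 0 i ≡ 0ℚ) ⊎ (Σ (Fin m) λ i → Σ ℚ λ q → u 0 i * q ≡ 1ℚ) → Goal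
  go (inj₁ e) = from (span-or-separated d (λ k → u (suc k)))
    where
    from : InSpan (λ k → u (suc k)) d ⊎ Separated (λ k → u (suc k)) d → Goal
    from (inj₁ (cs , p)) = inj₁ (0ℚ ∷ cs , λ i → trans (p i) (eq (u 0 i) _))
      where
      eq : ∀ a b → b ≡ 0ℚ * a + b
      eq = solve-∀ ℚ-ring
    from (inj₂ (f , p , z)) = inj₂ (f , p , λ { zero _ → dot-0 f e ; (suc k) (ℕ.s≤s k<d) → z k k<d })
  go (inj₂ (i , q , wq)) = from (span-or-separated d (λ k → proj (u (suc k))))
    where
    open Pivot (u 0) i q wq
    from : InSpan (λ k → proj (u (suc k))) d ⊎ Separated (λ k → proj (u (suc k))) d → Goal
    from (inj₁ (cs , p)) = inj₁ (proj₁ lifted ∷ cs , proj₂ lifted)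
      where lifted = lift-span cs (λ k → u (suc k)) (u (suc d)) p
    from (inj₂ (f , p , z)) = inj₂ (pullback f , trans (dot-pullback f (u (suc d))) p ,
      λ { zero _ → trans (dot-pullback f (u 0)) (dot-0 f proj-w) ; (suc k) (ℕ.s≤s k<d) → trans (dot-pullback f (u (suc k))) (z k k<d) })

module Powers {n : ℕ} (A : Mat n) where
  ·-cong : ∀ {x y : Vecℚ n} → x ≈ y → (A · x) ≈ (A · y)
  ·-cong e i = sumF-cong (λ j → cong (A i j *_) (e j))

  ·-+ : ∀ (x y : Vecℚ n) i → (A · (λ j → x j + y j)) i ≡ (A · x) i + (A · y) i
  ·-+ x y i = dot-+ (A i) x y

  ·-* : ∀ c (x : Vecℚ n) i → (A · (λ j → c * x j)) i ≡ c * (A · x) i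
  ·-* c x i = dot-* (A i) c x

  pw : ℕ → Vecℚ n → Vecℚ n
  pw zero x = x
  pw (suc k) x = A · pw k x

  actQ : ∀ {d} → Vec ℚ d → Vecℚ n → Vecℚ n
  actQ [] x = x
  actQ (c ∷ cs) x i = c * x i + (A · actQ cs x) i

  ·-comb : ∀ {j} (cs : Vec ℚ j) (u : ℕ → Vecℚ n) i → (A · comb cs u) i ≡ comb cs (λ k → A · u k) i
  ·-comb [] u i = dot-0 (A i) (λ _ → refl)
  ·-comb (c ∷ cs) u i = trans (·-+ (λ j → c * u 0 j) (comb cs (λ k → u (suc k))) i) (cong₂ _+_ (·-* c (u 0) i) (·-comb cs (λ k → u (suc k)) i))

  actQ-comb : ∀ {d} (cs : Vec ℚ d) x i → actQ cs x i ≡ comb cs (λ k → pw k x) i + pw d x i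
  actQ-comb [] x i = sym (+-identityˡ (x i))
  actQ-comb {suc d} (c ∷ cs) x i = trans (cong (c * x i +_) (trans (·-cong (actQ-comb cs x) i)
      (trans (·-+ (comb cs (λ k → pw k x)) (pw d x) i) (cong (_+ (A · pw d x) i) (·-comb cs (λ k → pw k x) i)))))
    (sym (+-assoc (c * x i) _ _))

  pw-basis : ∀ k (x : Vecℚ n) i → pw k x i ≡ sumF (λ l → x l * pw k (δ l) i)
  pw-basis zero x i = sym (trans (sumF-cong (λ l → trans (*-comm (x l) (δ l i)) (cong (_* x l) (δ-sym l i)))) (sumF-δ i x))
  pw-basis (suc k) x i = trans (·-cong (pw-basis k x) i)
    (trans (sumF-cong (λ j → sym (sumF-* (A i j) (λ l → x l * pw k (δ l) j))))
    (trans (sumF-swap (λ j l → A i j * (x l * pw k (δ l) j)))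
    (sumF-cong (λ l → trans (sumF-cong (λ j → eq (A i j) (x l) (pw k (δ l) j))) (sumF-* (x l) (λ j → A i j * pw k (δ l) j))))))
    where
    eq : ∀ a b c → a * (b * c) ≡ b * (a * c)
    eq = solve-∀ ℚ-ring

  comb-basis : ∀ {j} (cs : Vec ℚ j) k (x : Vecℚ n) i → comb cs (λ r → pw (r ℕ.+ k) x) i ≡ sumF (λ l → x l * comb cs (λ r → pw (r ℕ.+ k) (δ l)) i)
  comb-basis [] k x i = sym (trans (sumF-cong (λ l → *-zeroʳ (x l))) (sumF-0 n))
  comb-basis (c ∷ cs) k x i = trans (cong₂ (λ a b → c * a + b) (pw-basis k x i) (trans (shift cs x) (comb-basis cs (suc k) x i)))
    (sym (trans (sumF-cong (λ l → trans (cong (λ b → x l * (c * pw k (δ l) i + b)) (shift cs (δ l))) (eq (x l) c (pw k (δ l) i) _)))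
      (trans (sumF-+ (λ l → c * (x l * pw k (δ l) i)) (λ l → x l * comb cs (λ r → pw (r ℕ.+ suc k) (δ l)) i)) (cong (_+ _) (sumF-* c (λ l → x l * pw k (δ l) i))))))
    where
    eq : ∀ x c p s → x * (c * p + s) ≡ c * (x * p) + x * s
    eq = solve-∀ ℚ-ring
    shift : ∀ {j} (cs : Vec ℚ j) y → comb cs (λ r → pw (suc r ℕ.+ k) y) i ≡ comb cs (λ r → pw (r ℕ.+ suc k) y) i
    shift cs y = comb-cong cs (λ r l → cong (λ s → pw s y l) (sym (ℕₚ.+-suc r k))) i

  entry : Fin (n ℕ.* n) → Fin n × Fin n
  entry = remQuot n

  -- The matrix of an operator as a vector with n² coordinates, which turns a relation between
  -- powers of A into one between vectors.
  flat : (Vecℚ n → Vecℚ n) → Vecℚ (n ℕ.* n)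
  flat F p = F (δ (proj₂ (entry p))) (proj₁ (entry p))

  flat-all : ∀ (P : Fin n → Fin n → Set) → (∀ p → P (proj₁ (entry p)) (proj₂ (entry p))) → ∀ i l → P i l
  flat-all P h i l = subst (λ e → P (proj₁ e) (proj₂ e)) (remQuot-combine i l) (h (combine i l))

  comb-flat : ∀ {j} (cs : Vec ℚ j) (F : ℕ → Vecℚ n → Vecℚ n) p →
    comb cs (λ k → flat (F k)) p ≡ comb cs (λ k → F k (δ (proj₂ (entry p)))) (proj₁ (entry p))
  comb-flat [] F p = refl
  comb-flat (c ∷ cs) F p = cong (c * flat (F 0) p +_) (comb-flat cs (λ k → F (suc k)) p)

  Annihilates : ∀ {d} → Vec ℚ d → Set
  Annihilates P = ∀ x i → actQ P x i ≡ 0ℚ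

  -- Equality of matrix entries is equality on the basis vectors, and linearity carries it to all x.
  -- The signs change because the polynomial is x^d minus the combination.
  span⇒annihilator : ∀ {d} → InSpan (λ k → flat (pw k)) d → Σ (Vec ℚ d) Annihilates
  span⇒annihilator {d} (cs , e) = Vec.map (λ c → - c) cs , λ x i → trans (actQ-comb (Vec.map (λ c → - c) cs) x i)
      (trans (cong₂ _+_ (neg-comb cs (λ k → pw k x) i) (trans (pw-basis d x i) (trans (sumF-cong (λ l → cong (x l *_) (rel i l)))
        (sym (comb₀ x i))))) (+-inverseˡ (comb cs (λ k → pw k x) i)))
    where
    neg-comb : ∀ {j} (cs : Vec ℚ j) (u : ℕ → Vecℚ n) i → comb (Vec.map (λ c → - c) cs) u i ≡ - comb cs u i
    neg-comb [] u i = refl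
    neg-comb (c ∷ cs) u i = trans (cong (- c * u 0 i +_) (neg-comb cs (λ k → u (suc k)) i)) (eq c (u 0 i) _)
      where
      eq : ∀ c u s → - c * u + - s ≡ - (c * u + s)
      eq = solve-∀ ℚ-ring
    rel : ∀ i l → pw d (δ l) i ≡ comb cs (λ k → pw k (δ l)) i
    rel = flat-all _ (λ p → trans (e p) (comb-flat cs pw p))
    un0 : ∀ y i → comb cs (λ k → pw k y) i ≡ comb cs (λ k → pw (k ℕ.+ 0) y) i
    un0 y i = comb-cong cs (λ k l → cong (λ s → pw s y l) (sym (ℕₚ.+-identityʳ k))) i
    comb₀ : ∀ x i → comb cs (λ k → pw k x) i ≡ sumF (λ l → x l * comb cs (λ k → pw k (δ l)) i)
    comb₀ x i = trans (un0 x i) (trans (comb-basis cs 0 x i) (sumF-cong (λ l → cong (x l *_) (sym (un0 (δ l) i)))))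

  -- Quantitative form of the claim that no monic polynomial of degree d annihilates A: f is 1 on
  -- all of them, so their entries cannot all be small, whatever the coefficients.
  Normalised : ℕ → Vecℚ (n ℕ.* n) → Set
  Normalised d f = ∀ (cs : Vec ℚ d) → dot f (flat (actQ cs)) ≡ 1ℚ

  separated⇒normalised : ∀ {d} → Separated (λ k → flat (pw k)) d → Σ (Vecℚ (n ℕ.* n)) (Normalised d)
  separated⇒normalised {d} (f , one , z) = f , λ cs → trans (dot-cong f (λ p → trans (actQ-comb cs (δ (proj₂ (entry p))) (proj₁ (entry p)))
      (cong (_+ flat (pw d) p) (sym (comb-flat cs pw p)))))
    (trans (dot-+ f (comb cs (λ k → flat (pw k))) (flat (pw d))) (trans (cong₂ _+_ (dot-comb f cs (λ k → flat (pw k)) z) one) (+-identityˡ 1ℚ)))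

  MinimalPolynomial : Set
  MinimalPolynomial = Σ ℕ λ d → Σ (Vec ℚ (suc d)) Annihilates × Σ (Vecℚ (n ℕ.* n)) (Normalised d)

  abstract
    minimal-polynomial : Fin n → MinimalPolynomial
    minimal-polynomial i₀ = start (dependent (n ℕ.* n) (λ k → flat (pw k)))
      where
      shrink : ∀ d → Σ (Vec ℚ d) Annihilates → MinimalPolynomial
      -- Degree 0 would make the identity vanish, which the coordinate i₀ refutes.
      shrink zero ([] , ann) = ⊥-elim (1≢0 (ann (λ _ → 1ℚ) i₀))
      shrink (suc d) P = next (span-or-separated d (λ k → flat (pw k)))
        where
        next : InSpan (λ k → flat (pw k)) d ⊎ Separated (λ k → flat (pw k)) d → MinimalPolynomial
        next (inj₁ s) = shrink d (span⇒annihilator s)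
        next (inj₂ s) = d , P , separated⇒normalised s
      start : Σ ℕ (InSpan (λ k → flat (pw k))) → MinimalPolynomial
      start (d , s) = shrink d (span⇒annihilator s)

-- Complex polynomials in A

addL : List ℂ → List ℂ → List ℂ
addL [] q = q
addL (a ∷ p) [] = a ∷ p
addL (a ∷ p) (b ∷ q) = a +ᶜ b ∷ addL p q

scaleL : ℂ → List ℂ → List ℂ
scaleL c [] = []
scaleL c (a ∷ p) = c *ᶜ a ∷ scaleL c p

mulL : List ℂ → List ℂ → List ℂ
mulL [] q = []
mulL (a ∷ p) q = addL (scaleL a q) (0ᶜ ∷ mulL p q)

Sup : ℚ → List ℂ → Set
Sup r = All (_≼ r)

sup-mono : ∀ {r s p} → r ≤ s → Sup r p → Sup s p
sup-mono le = All.map (λ b → ≼-mono b le)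

sup-add : ∀ {r s} p q → 0ℚ ≤ r → 0ℚ ≤ s → Sup r p → Sup s q → Sup (r + s) (addL p q)
sup-add {r} {s} [] q 0≤r 0≤s _ bs = sup-mono (≤-by 0≤r (+-comm r s)) bs
sup-add (a ∷ p) [] 0≤r 0≤s as _ = sup-mono (≤-by 0≤s refl) as
sup-add (a ∷ p) (b ∷ q) 0≤r 0≤s (x ∷ as) (y ∷ bs) = ≼-+ x y ∷ sup-add p q 0≤r 0≤s as bs

sup-scale : ∀ {c r s} p → c ≼ r → Sup s p → Sup (r * s) (scaleL c p)
sup-scale [] b [] = []
sup-scale (a ∷ p) b (x ∷ xs) = ≼-* b x ∷ sup-scale p b xs

-- Each coefficient of the product is a sum of at most `length p` products.
sup-mul : ∀ {r s} p q → 0ℚ ≤ r → 0ℚ ≤ s → Sup r p → Sup s q → Sup (ι (length p) * (r * s)) (mulL p q)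
sup-mul [] q 0≤r 0≤s [] bs = []
sup-mul {r} {s} (a ∷ p) q 0≤r 0≤s (x ∷ xs) bs = sup-mono (≤-reflexive (eq (r * s) (ι (length p))))
    (sup-add (scaleL a q) (0ᶜ ∷ mulL p q) 0≤rs (0≤* (0≤ι (length p)) 0≤rs) (sup-scale q x bs) (0≼ (0≤* (0≤ι (length p)) 0≤rs) ∷ sup-mul p q 0≤r 0≤s xs bs))
  where
  0≤rs : 0ℚ ≤ r * s
  0≤rs = 0≤* 0≤r 0≤s
  eq : ∀ a n → a + n * a ≡ (1ℚ + n) * a
  eq = solve-∀ ℚ-ring

length-scaleL : ∀ c p → length (scaleL c p) ≡ length p
length-scaleL c [] = refl
length-scaleL c (a ∷ p) = cong suc (length-scaleL c p)

infix 4 _≋_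
_≋_ : ∀ {I : Set} → (I → ℂ) → (I → ℂ) → Set
v ≋ w = ∀ i → v i ≡ w i

module Operator {n : ℕ} (A : Mat n) where
  open Powers A

  V : Set
  V = Fin n → ℂ

  X : V → V
  X v i = (A · (λ j → re (v j))) i +i (A · (λ j → im (v j))) i

  X-cong : ∀ {v w} → v ≋ w → X v ≋ X w
  X-cong e i = cong₂ _+i_ (·-cong (λ j → cong re (e j)) i) (·-cong (λ j → cong im (e j)) i)

  X-+ : ∀ v w → X (λ j → v j +ᶜ w j) ≋ (λ i → X v i +ᶜ X w i)
  X-+ v w i = cong₂ _+i_ (trans (·-cong (λ j → re-+ (v j) (w j)) i) (·-+ (λ j → re (v j)) (λ j → re (w j)) i))
                         (trans (·-cong (λ j → im-+ (v j) (w j)) i) (·-+ (λ j → im (v j)) (λ j → im (w j)) i))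

  X-* : ∀ c v → X (λ j → c *ᶜ v j) ≋ (λ i → c *ᶜ X v i)
  X-* (a +i b) v i = cong₂ _+i_
      (trans (·-cong (λ j → trans (re-* (a +i b) (v j)) (eq a b (re (v j)) (im (v j)))) i)
        (trans (·-+ (λ j → a * re (v j)) (λ j → - b * im (v j)) i) (trans (cong₂ _+_ (·-* a (λ j → re (v j)) i) (·-* (- b) (λ j → im (v j)) i)) (sym (eq a b _ _)))))
      (trans (·-cong (λ j → im-* (a +i b) (v j)) i)
        (trans (·-+ (λ j → a * im (v j)) (λ j → b * re (v j)) i) (cong₂ _+_ (·-* a (λ j → im (v j)) i) (·-* b (λ j → re (v j)) i))))
    where
    eq : ∀ a b x y → a * x - b * y ≡ a * x + - b * y
    eq = solve-∀ ℚ-ring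

  X-0 : ∀ i → X (λ _ → 0ᶜ) i ≡ 0ᶜ
  X-0 i = cong₂ _+i_ (dot-0 (A i) (λ _ → refl)) (dot-0 (A i) (λ _ → refl))

  -- Lists stand for arbitrary polynomials in A, vectors (in `actM`) for monic ones with implicit
  -- leading coefficient.
  act : List ℂ → V → V
  act [] v i = 0ᶜ
  act (c ∷ cs) v i = c *ᶜ v i +ᶜ X (act cs v) i

  actM : ∀ {d} → Vec ℂ d → V → V
  actM [] v = v
  actM (c ∷ cs) v i = c *ᶜ v i +ᶜ X (actM cs v) i

  act-cong : ∀ p {v w} → v ≋ w → act p v ≋ act p w
  act-cong [] e i = refl
  act-cong (c ∷ cs) e i = cong₂ _+ᶜ_ (cong (c *ᶜ_) (e i)) (X-cong (act-cong cs e) i)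

  actM-cong : ∀ {d} (p : Vec ℂ d) {v w} → v ≋ w → actM p v ≋ actM p w
  actM-cong [] e = e
  actM-cong (c ∷ cs) e i = cong₂ _+ᶜ_ (cong (c *ᶜ_) (e i)) (X-cong (actM-cong cs e) i)

  act-+ : ∀ p v w → act p (λ j → v j +ᶜ w j) ≋ (λ i → act p v i +ᶜ act p w i)
  act-+ [] v w i = refl
  act-+ (c ∷ cs) v w i = trans (cong (c *ᶜ (v i +ᶜ w i) +ᶜ_) (trans (X-cong (act-+ cs v w) i) (X-+ (act cs v) (act cs w) i)))
      (eq c (v i) (w i) (X (act cs v) i) (X (act cs w) i))
    where
    eq : ∀ c v w a b → c *ᶜ (v +ᶜ w) +ᶜ (a +ᶜ b) ≡ (c *ᶜ v +ᶜ a) +ᶜ (c *ᶜ w +ᶜ b)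
    eq = solve-∀ ℂ-ring

  act-* : ∀ p c v → act p (λ j → c *ᶜ v j) ≋ (λ i → c *ᶜ act p v i)
  act-* [] c v i = eq c
    where
    eq : ∀ c → 0ᶜ ≡ c *ᶜ 0ᶜ
    eq = solve-∀ ℂ-ring
  act-* (a ∷ p) c v i = trans (cong (a *ᶜ (c *ᶜ v i) +ᶜ_) (trans (X-cong (act-* p c v) i) (X-* c (act p v) i))) (eq a c (v i) (X (act p v) i))
    where
    eq : ∀ a c v x → a *ᶜ (c *ᶜ v) +ᶜ c *ᶜ x ≡ c *ᶜ (a *ᶜ v +ᶜ x)
    eq = solve-∀ ℂ-ring

  act-X : ∀ p v → act p (X v) ≋ X (act p v)
  act-X [] v i = sym (X-0 i)
  act-X (c ∷ p) v i = trans (cong (c *ᶜ X v i +ᶜ_) (X-cong (act-X p v) i))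
    (sym (trans (X-+ (λ j → c *ᶜ v j) (X (act p v)) i) (cong (_+ᶜ X (X (act p v)) i) (X-* c v i))))

  actM-X : ∀ {d} (p : Vec ℂ d) v → actM p (X v) ≋ X (actM p v)
  actM-X [] v i = refl
  actM-X (c ∷ p) v i = trans (cong (c *ᶜ X v i +ᶜ_) (X-cong (actM-X p v) i))
    (sym (trans (X-+ (λ j → c *ᶜ v j) (X (actM p v)) i) (cong (_+ᶜ X (X (actM p v)) i) (X-* c v i))))

  act-comm : ∀ p q v → act p (act q v) ≋ act q (act p v)
  act-comm [] q v i = sym (zero-vec q i)
    where
    zero-vec : ∀ q → act q (λ _ → 0ᶜ) ≋ (λ _ → 0ᶜ)
    zero-vec [] i = refl
    zero-vec (c ∷ q) i = trans (cong (c *ᶜ 0ᶜ +ᶜ_) (trans (X-cong (zero-vec q) i) (X-0 i))) (eq c)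
      where
      eq : ∀ c → c *ᶜ 0ᶜ +ᶜ 0ᶜ ≡ 0ᶜ
      eq = solve-∀ ℂ-ring
  act-comm (c ∷ p) q v i = trans (cong (c *ᶜ act q v i +ᶜ_) (trans (X-cong (act-comm p q v) i) (sym (act-X q (act p v) i))))
    (trans (cong (_+ᶜ act q (X (act p v)) i) (sym (act-* q c v i))) (sym (act-+ q (λ j → c *ᶜ v j) (X (act p v)) i)))

  act-addL : ∀ p q v → act (addL p q) v ≋ (λ i → act p v i +ᶜ act q v i)
  act-addL [] q v i = eq (act q v i)
    where
    eq : ∀ a → a ≡ 0ᶜ +ᶜ a
    eq = solve-∀ ℂ-ring
  act-addL (a ∷ p) [] v i = eq (act (a ∷ p) v i)
    where
    eq : ∀ a → a ≡ a +ᶜ 0ᶜ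
    eq = solve-∀ ℂ-ring
  act-addL (a ∷ p) (b ∷ q) v i = trans (cong ((a +ᶜ b) *ᶜ v i +ᶜ_) (trans (X-cong (act-addL p q v) i) (X-+ (act p v) (act q v) i)))
      (eq a b (v i) (X (act p v) i) (X (act q v) i))
    where
    eq : ∀ a b v x y → (a +ᶜ b) *ᶜ v +ᶜ (x +ᶜ y) ≡ (a *ᶜ v +ᶜ x) +ᶜ (b *ᶜ v +ᶜ y)
    eq = solve-∀ ℂ-ring

  act-scaleL : ∀ c p v → act (scaleL c p) v ≋ (λ i → c *ᶜ act p v i)
  act-scaleL c [] v i = eq c
    where
    eq : ∀ c → 0ᶜ ≡ c *ᶜ 0ᶜ
    eq = solve-∀ ℂ-ring
  act-scaleL c (a ∷ p) v i = trans (cong (c *ᶜ a *ᶜ v i +ᶜ_) (trans (X-cong (act-scaleL c p v) i) (X-* c (act p v) i))) (eq c a (v i) (X (act p v) i))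
    where
    eq : ∀ c a v x → c *ᶜ a *ᶜ v +ᶜ c *ᶜ x ≡ c *ᶜ (a *ᶜ v +ᶜ x)
    eq = solve-∀ ℂ-ring

  act-mulL : ∀ p q v → act (mulL p q) v ≋ act p (act q v)
  act-mulL [] q v i = refl
  act-mulL (a ∷ p) q v i = trans (act-addL (scaleL a q) (0ᶜ ∷ mulL p q) v i)
    (cong₂ _+ᶜ_ (act-scaleL a q v i) (trans (eq (v i) (X (act (mulL p q) v) i)) (X-cong (act-mulL p q v) i)))
    where
    eq : ∀ v x → 0ᶜ *ᶜ v +ᶜ x ≡ x
    eq = solve-∀ ℂ-ring

  actM-mulLin : ∀ {d} c z (p : Vec ℂ d) v → actM (mulLin c z p) v ≋ (λ i → c *ᶜ v i +ᶜ (z *ᶜ actM p v i +ᶜ X (actM p v) i))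
  actM-mulLin c z [] v i = eq c z (v i) (X v i)
    where
    eq : ∀ c z v x → (c +ᶜ z) *ᶜ v +ᶜ x ≡ c *ᶜ v +ᶜ (z *ᶜ v +ᶜ x)
    eq = solve-∀ ℂ-ring
  actM-mulLin c z (h ∷ p) v i = trans (cong ((c +ᶜ z *ᶜ h) *ᶜ v i +ᶜ_)
       (trans (X-cong (actM-mulLin h z p v) i) (trans (X-+ (λ j → h *ᶜ v j) (λ j → z *ᶜ actM p v j +ᶜ X (actM p v) j) i)
         (cong₂ _+ᶜ_ (X-* h v i) (trans (X-+ (λ j → z *ᶜ actM p v j) (X (actM p v)) i) (cong (_+ᶜ X (X (actM p v)) i) (X-* z (actM p v) i)))))))
    (trans (eq c z h (v i) (X v i) (X (actM p v) i) (X (X (actM p v)) i))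
      (cong (λ y → c *ᶜ v i +ᶜ (z *ᶜ (h *ᶜ v i +ᶜ X (actM p v) i) +ᶜ y)) (sym (trans (X-+ (λ j → h *ᶜ v j) (X (actM p v)) i) (cong (_+ᶜ X (X (actM p v)) i) (X-* h v i))))))
    where
    eq : ∀ c z h v xv xp xxp → (c +ᶜ z *ᶜ h) *ᶜ v +ᶜ (h *ᶜ xv +ᶜ (z *ᶜ xp +ᶜ xxp)) ≡ c *ᶜ v +ᶜ (z *ᶜ (h *ᶜ v +ᶜ xp) +ᶜ (h *ᶜ xv +ᶜ xxp))
    eq = solve-∀ ℂ-ring

  -- P = (x - z) Q_z + P(z), read in A. Here z is arbitrary, so P(z) remains as an error term.
  actM-quot : ∀ {d} (P : Vec ℂ (suc d)) z v i →
    X (actM (quotM P z) v) i ≡ z *ᶜ actM (quotM P z) v i +ᶜ (actM P v i -ᶜ evM P z *ᶜ v i)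
  actM-quot P z v i = trans (eq (evM P z *ᶜ v i) z (actM (quotM P z) v i) (X (actM (quotM P z) v) i))
      (cong (λ y → z *ᶜ actM (quotM P z) v i +ᶜ (y -ᶜ evM P z *ᶜ v i)) (trans (sym (actM-mulLin (evM P z) (-ᶜ z) (quotM P z) v i)) (cong (λ p → actM p v i) (divisionM P z))))
    where
    eq : ∀ e z q x → x ≡ z *ᶜ q +ᶜ ((e +ᶜ (-ᶜ z *ᶜ q +ᶜ x)) -ᶜ e)
    eq = solve-∀ ℂ-ring

  module Factor (z μ : ℂ) (zμ : z *ᶜ μ ≡ 1ᶜ) (B : ℚ) (μ≼B : μ ≼ B) (1≤B : 1ℚ ≤ B) where
    tri geo : ℕ → ℂ → List ℂ
    tri zero c = []
    tri (suc k) c = ⟦ ι (suc k) ⟧ *ᶜ c ∷ tri k (c *ᶜ μ)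
    geo zero c = []
    geo (suc k) c = c *ᶜ μ ∷ geo k (c *ᶜ μ)

    -- (1 - μ x) (k + (k-1) μ x + … + μ^(k-1) x^(k-1)) = k - (μ x + … + μ^k x^k)
    tri-geo : ∀ k c v i → act (tri k c) v i -ᶜ μ *ᶜ X (act (tri k c) v) i ≡ ⟦ ι k ⟧ *ᶜ c *ᶜ v i -ᶜ X (act (geo k c) v) i
    tri-geo zero c v i = trans (cong (λ x → 0ᶜ -ᶜ μ *ᶜ x) (X-0 i)) (trans (eq μ c (v i)) (cong (λ x → 0ᶜ *ᶜ c *ᶜ v i -ᶜ x) (sym (X-0 i))))
      where
      eq : ∀ m c v → 0ᶜ -ᶜ m *ᶜ 0ᶜ ≡ 0ᶜ *ᶜ c *ᶜ v -ᶜ 0ᶜ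
      eq = solve-∀ ℂ-ring
    tri-geo (suc k) c v i = trans (cong₂ (λ a x → κ *ᶜ c *ᶜ v i +ᶜ a -ᶜ μ *ᶜ x) refl
          (trans (X-+ (λ j → κ *ᶜ c *ᶜ v j) (X T) i) (cong (_+ᶜ X (X T) i) (X-* (κ *ᶜ c) v i))))
        (trans (eq₁ κ c μ (v i) (X v i) (X T i) (X (X T) i)) (trans (cong (λ y → κ *ᶜ c *ᶜ v i -ᶜ μ *ᶜ (κ *ᶜ c) *ᶜ X v i +ᶜ y) inner)
        (trans (cong (λ κ′ → κ *ᶜ c *ᶜ v i -ᶜ μ *ᶜ (κ′ *ᶜ c) *ᶜ X v i +ᶜ (⟦ ι k ⟧ *ᶜ (c *ᶜ μ) *ᶜ X v i -ᶜ X (X Gk) i)) suc-κ)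
        (trans (eq₂ κ c μ (v i) (X v i) ⟦ ι k ⟧ (X (X Gk) i))
          (cong (λ y → κ *ᶜ c *ᶜ v i -ᶜ y) (sym (trans (X-+ (λ j → c *ᶜ μ *ᶜ v j) (X Gk) i) (cong (_+ᶜ X (X Gk) i) (X-* (c *ᶜ μ) v i)))))))))
      where
      κ = ⟦ ι (suc k) ⟧
      T = act (tri k (c *ᶜ μ)) v
      Gk = act (geo k (c *ᶜ μ)) v
      suc-κ : ⟦ ι (suc k) ⟧ ≡ 1ᶜ +ᶜ ⟦ ι k ⟧
      suc-κ = refl
      eq₁ : ∀ κ c μ v xv xt xxt → κ *ᶜ c *ᶜ v +ᶜ xt -ᶜ μ *ᶜ (κ *ᶜ c *ᶜ xv +ᶜ xxt) ≡ κ *ᶜ c *ᶜ v -ᶜ μ *ᶜ (κ *ᶜ c) *ᶜ xv +ᶜ (xt -ᶜ μ *ᶜ xxt)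
      eq₁ = solve-∀ ℂ-ring
      eq₂ : ∀ κ c μ v xv k g → κ *ᶜ c *ᶜ v -ᶜ μ *ᶜ ((1ᶜ +ᶜ k) *ᶜ c) *ᶜ xv +ᶜ (k *ᶜ (c *ᶜ μ) *ᶜ xv -ᶜ g) ≡ κ *ᶜ c *ᶜ v -ᶜ (c *ᶜ μ *ᶜ xv +ᶜ g)
      eq₂ = solve-∀ ℂ-ring
      inner : X T i -ᶜ μ *ᶜ X (X T) i ≡ ⟦ ι k ⟧ *ᶜ (c *ᶜ μ) *ᶜ X v i -ᶜ X (X Gk) i
      inner = trans (sub-X T (X T)) (trans (X-cong (tri-geo k (c *ᶜ μ) v) i) (trans (X-+ (λ j → ⟦ ι k ⟧ *ᶜ (c *ᶜ μ) *ᶜ v j) (λ j → -ᶜ X Gk j) i)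
                (cong₂ _+ᶜ_ (X-* (⟦ ι k ⟧ *ᶜ (c *ᶜ μ)) v i) (X-neg (X Gk)))))
        where
        neg≡ : ∀ a → -ᶜ a ≡ -ᶜ 1ᶜ *ᶜ a
        neg≡ = solve-∀ ℂ-ring
        X-neg : ∀ w → X (λ j → -ᶜ w j) i ≡ -ᶜ X w i
        X-neg w = trans (X-cong (λ j → neg≡ (w j)) i) (trans (X-* (-ᶜ 1ᶜ) w i) (sym (neg≡ (X w i))))
        sub-X : ∀ w y → X w i -ᶜ μ *ᶜ X y i ≡ X (λ j → w j -ᶜ μ *ᶜ y j) i
        sub-X w y = sym (trans (X-+ w (λ j → -ᶜ (μ *ᶜ y j)) i) (cong (X w i +ᶜ_) (trans (X-neg (λ j → μ *ᶜ y j)) (cong (λ x → -ᶜ x) (X-* μ y i)))))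

    1≤B^ : ∀ k → 1ℚ ≤ B ^ k
    1≤B^ zero = ≤-refl
    1≤B^ (suc k) = ≤-trans (≤-reflexive (sym (*-identityˡ 1ℚ))) (*-mono 0≤1 1≤B 0≤1 (1≤B^ k))

    sup-geo : ∀ k {c r} → c ≼ r → Sup (r * B ^ k) (geo k c)
    sup-geo zero b = []
    sup-geo (suc k) {c} {r} b = ≼-mono (≼-* b μ≼B) (*-monoˡ r (0≤bound b) (≤-trans (≤-reflexive (sym (*-identityʳ B)))
        (*-monoˡ B (0≤bound μ≼B) (1≤B^ k)))) ∷ subst (λ x → Sup x (geo k (c *ᶜ μ))) (*-assoc r B (B ^ k)) (sup-geo k (≼-* b μ≼B))

    sup-tri : ∀ k {c r} → c ≼ r → Sup (ι k * (r * B ^ k)) (tri k c)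
    sup-tri zero b = []
    sup-tri (suc k) {c} {r} b =
      ≼-mono (≼-* (re≼ (≤-reflexive (0≤p⇒∣p∣≡p (0≤ι (suc k))))) b) (*-monoˡ (ι (suc k)) (0≤ι (suc k)) (≤-trans (≤-reflexive (sym (*-identityʳ r))) (*-monoˡ r 0≤r (1≤B^ (suc k)))))
      ∷ sup-mono (≤-trans (*-monoʳ {ι k} {ι (suc k)} (r * B * B ^ k) (0≤* (0≤* 0≤r (0≤bound μ≼B)) (≤-trans 0≤1 (1≤B^ k))) (≤-by 0≤1 (+-comm 1ℚ (ι k)))) (≤-reflexive (cong (ι (suc k) *_) (*-assoc r B (B ^ k)))))
          (sup-tri k (≼-* b μ≼B))
      where
      0≤r = 0≤bound b

    length-geo : ∀ k c → length (geo k c) ≡ k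
    length-geo zero c = refl
    length-geo (suc k) c = cong suc (length-geo k (c *ᶜ μ))

    length-tri : ∀ k c → length (tri k c) ≡ k
    length-tri zero c = refl
    length-tri (suc k) c = cong suc (length-tri k (c *ᶜ μ))

    module _ (k : ℕ) (B^≤2 : B ^ suc k ≤ 2ℚ) where
      K = suc k
      c₀ : ℂ
      c₀ = ⟦ ℤ.+ 1 / K ⟧
      -- `S` is -μ `tri` / K and `q` is -(μx + ... + μ^K x^K)/K. As (x - z)(-μ) = 1 - μx, the
      -- identity `tri-geo` becomes (x - z) S = 1 + q.
      S q : List ℂ
      S = scaleL (-ᶜ μ) (tri K c₀)
      q = 0ᶜ ∷ scaleL (-ᶜ 1ᶜ) (geo K c₀)

      ιc₀ : ⟦ ι K ⟧ *ᶜ c₀ ≡ 1ᶜ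
      ιc₀ = trans (sym (⟦⟧-* (ι K) (ℤ.+ 1 / K))) (cong ⟦_⟧ (recip k))

      factor : ∀ v i → X (act S v) i -ᶜ z *ᶜ act S v i ≡ v i +ᶜ act q v i
      factor v i = trans (cong₂ (λ a b → a -ᶜ z *ᶜ b) (trans (X-cong (act-scaleL (-ᶜ μ) (tri K c₀) v) i) (X-* (-ᶜ μ) T i)) (act-scaleL (-ᶜ μ) (tri K c₀) v i))
          (trans (eq₁ z μ (T i) (X T i)) (trans (cong (λ w → w *ᶜ T i -ᶜ μ *ᶜ X T i) zμ) (trans (eq₂ (T i) (μ *ᶜ X T i)) (trans (tri-geo K c₀ v i)
          (trans (cong (λ w → w *ᶜ v i -ᶜ X Gg i) ιc₀) (trans (eq₃ (v i) (X Gg i)) (cong (λ w → v i +ᶜ (0ᶜ *ᶜ v i +ᶜ w)) (sym (trans (X-cong (act-scaleL (-ᶜ 1ᶜ) (geo K c₀) v) i) (X-* (-ᶜ 1ᶜ) Gg i))))))))))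
        where
        T = act (tri K c₀) v
        Gg = act (geo K c₀) v
        eq₁ : ∀ z m t x → -ᶜ m *ᶜ x -ᶜ z *ᶜ (-ᶜ m *ᶜ t) ≡ z *ᶜ m *ᶜ t -ᶜ m *ᶜ x
        eq₁ = solve-∀ ℂ-ring
        eq₂ : ∀ t x → 1ᶜ *ᶜ t -ᶜ x ≡ t -ᶜ x
        eq₂ = solve-∀ ℂ-ring
        eq₃ : ∀ v g → 1ᶜ *ᶜ v -ᶜ g ≡ v +ᶜ (0ᶜ *ᶜ v +ᶜ -ᶜ 1ᶜ *ᶜ g)
        eq₃ = solve-∀ ℂ-ring

      r₀ : ℚ
      r₀ = ℤ.+ 1 / K

      c₀≼ : c₀ ≼ r₀
      c₀≼ = re≼ (≤-reflexive (0≤p⇒∣p∣≡p (<⇒≤ (0<recip k))))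

      sup-q : Sup (r₀ * 2ℚ) q
      sup-q = 0≼ (0≤* (<⇒≤ (0<recip k)) (0≤+ 0≤1 0≤1)) ∷ sup-mono (≤-trans (≤-reflexive (*-identityˡ _)) (*-monoˡ r₀ (<⇒≤ (0<recip k)) B^≤2)) (sup-scale (geo K c₀) (≼-neg 1≼1) (sup-geo K c₀≼))

      length-q : length q ≡ suc K
      length-q = cong suc (trans (length-scaleL (-ᶜ 1ᶜ) (geo K c₀)) (length-geo K c₀))

      sup-S : Sup (2ℚ * 2ℚ) S
      sup-S = sup-mono (*-mono (0≤bound μ≼B) (≤-trans (≤-trans (≤-reflexive (sym (*-identityʳ B))) (*-monoˡ B (0≤bound μ≼B) (1≤B^ k))) B^≤2)
            (0≤* (0≤ι K) (0≤* (<⇒≤ (0<recip k)) (≤-trans 0≤1 (1≤B^ K))))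
            (≤-trans (≤-reflexive (trans (sym (*-assoc (ι K) r₀ (B ^ K))) (trans (cong (_* B ^ K) (recip k)) (*-identityˡ (B ^ K))))) B^≤2))
          (sup-scale (tri K c₀) (≼-neg μ≼B) (sup-tri K c₀≼))

      length-S : length S ≡ K
      length-S = trans (length-scaleL (-ᶜ μ) (tri K c₀)) (length-tri K c₀)

-- Multiples of the minimal polynomial close to 1

-- Size of q for a product of d factors, in units of σ. Joining q₁ ≤ σ to q′ ≤ σw costs σ + σw +
-- 4σw, where 4 bounds σ times the length of q₁.
weight : ℕ → ℚ
weight zero = 0ℚ
weight (suc d) = 1ℚ + ι 5 * weight d

0≤weight : ∀ d → 0ℚ ≤ weight d
0≤weight zero = ≤-refl
0≤weight (suc d) = 0≤+ 0≤1 (0≤* (0≤ι 5) (0≤weight d))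

-- One factor contributes k + 1 coefficients of modulus at most 4; the roots themselves do not
-- enter.
cofactorBound : ℕ → ℕ → ℚ
cofactorBound k zero = 1ℚ
cofactorBound k (suc d) = ι (suc k) * (2ℚ * 2ℚ * cofactorBound k d)

0<2 : 0ℚ < 2ℚ
0<2 = 0<+ 0<1 0≤1

0<cofactorBound : ∀ k d → 0ℚ < cofactorBound k d
0<cofactorBound k zero = 0<1
0<cofactorBound k (suc d) = 0<* (0<ι k) (0<* (0<* 0<2 0<2) (0<cofactorBound k d))

InvertibleWithin : ℚ → ℂ → Set
InvertibleWithin B z = Σ ℂ λ μ → z *ᶜ μ ≡ 1ᶜ × μ ≼ B

diffL : ∀ {d} → Vec ℂ d → Vec ℂ d → List ℂ
diffL [] [] = []
diffL (a ∷ p) (b ∷ q) = a -ᶜ b ∷ diffL p q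

length-diffL : ∀ {d} (p q : Vec ℂ d) → length (diffL p q) ≡ d
length-diffL [] [] = refl
length-diffL (a ∷ p) (b ∷ q) = cong suc (length-diffL p q)

sup-diffL : ∀ {e d} {p q : Vec ℂ d} → Close e p q → Sup e (diffL p q)
sup-diffL [] = []
sup-diffL (b ∷ bs) = b ∷ sup-diffL bs

-- An upper bound for (1 + x)^k as long as kx < 1; at kx = ½ it gives (1 + x)^k ≤ 2.
bernoulli : ∀ {x} k → 0ℚ ≤ x → (1ℚ + x) ^ k * (1ℚ - ι k * x) ≤ 1ℚ
bernoulli {x} zero 0≤x = ≤-reflexive (eq x)
  where
  eq : ∀ x → 1ℚ * (1ℚ - 0ℚ * x) ≡ 1ℚ
  eq = solve-∀ ℚ-ring
bernoulli {x} (suc k) 0≤x = ≤-trans (≤-by (0≤* (0≤^ k (0≤+ 0≤1 0≤x)) (0≤* (0≤ι (suc k)) (0≤* 0≤x 0≤x))) (eq x ((1ℚ + x) ^ k) (ι k))) (bernoulli k 0≤x)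
  where
  eq : ∀ x p k → p * (1ℚ - k * x) ≡ (1ℚ + x) * p * (1ℚ - (1ℚ + k) * x) + p * ((1ℚ + k) * (x * x))
  eq = solve-∀ ℚ-ring

min⁺ : ∀ {a b} → 0ℚ < a → 0ℚ < b → Σ ℚ λ e → 0ℚ < e × e ≤ a × e ≤ b
min⁺ {a} {b} p q with ≤-total a b
... | inj₁ le = a , p , ≤-refl , le
... | inj₂ le = b , q , le , ≤-refl

-- The roots of the approximant are Gaussian rationals, so comparing each with h is a decision
-- between rationals.
big-or-root : ∀ {d} (zs : Vec ℂ d) h → 0ℚ ≤ h → VAll.All (λ z → h * h < N z) zs ⊎ (Σ ℂ λ z → z ≼ h × prodAt zs z ≡ 0ᶜ)
big-or-root [] h 0≤h = inj₁ []
big-or-root (z ∷ zs) h 0≤h = case≤ (N z) (h * h) (λ p → inj₂ (z , mk≼ 0≤h p , eq z (prodAt zs z))) λ p → next p (big-or-root zs h 0≤h)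
  where
  eq : ∀ z e → (z -ᶜ z) *ᶜ e ≡ 0ᶜ
  eq = solve-∀ ℂ-ring
  eq′ : ∀ a → a *ᶜ 0ᶜ ≡ 0ᶜ
  eq′ = solve-∀ ℂ-ring
  next : h * h < N z → VAll.All (λ z → h * h < N z) zs ⊎ (Σ ℂ λ z → z ≼ h × prodAt zs z ≡ 0ᶜ) →
    VAll.All (λ z → h * h < N z) (z ∷ zs) ⊎ (Σ ℂ λ w → w ≼ h × prodAt (z ∷ zs) w ≡ 0ᶜ)
  next p (inj₁ ps) = inj₁ (p ∷ ps)
  next p (inj₂ (w , b , e)) = inj₂ (w , b , trans (cong ((w -ᶜ z) *ᶜ_) e) (eq′ (w -ᶜ z)))

-- |μ| = 1/|z| < 1/h ≤ B.
big⇒invertible : ∀ {h B z} → 0ℚ ≤ B → 1ℚ ≤ B * h → h * h < N z → InvertibleWithin B z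
big⇒invertible {h} {B} {z} 0≤B 1≤Bh big = from (inv-ℂ (λ e → <-irrefl refl (<-≤-trans (≤-<-trans (0≤sq h) big) (≤-reflexive (cong N e)))))
  where
  from : (Σ ℂ λ μ → z *ᶜ μ ≡ 1ᶜ) → InvertibleWithin B z
  from (μ , e) = μ , e , mk≼ 0≤B (≤-trans (≤-trans (≤-reflexive (sym (*-identityʳ (N μ)))) (*-monoˡ (N μ) (0≤N μ) 1≤))
      (≤-trans (≤-reflexive (eq (N μ) B h)) (≤-trans (*-monoˡ (B * B) (0≤* 0≤B 0≤B) (≤-trans (*-monoˡ (N μ) (0≤N μ) (<⇒≤ big)) (≤-reflexive Nμz))) (≤-reflexive (*-identityʳ (B * B))))))
    where
    1≤ : 1ℚ ≤ (B * h) * (B * h)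
    1≤ = ≤-trans (≤-reflexive (sym (*-identityˡ 1ℚ))) (*-mono 0≤1 1≤Bh 0≤1 1≤Bh)
    eq : ∀ n b h → n * ((b * h) * (b * h)) ≡ (b * b) * (n * (h * h))
    eq = solve-∀ ℚ-ring
    Nμz : N μ * N z ≡ 1ℚ
    Nμz = trans (*-comm (N μ) (N z)) (trans (sym (N-* z μ)) (cong N e))

module Reduction {n : ℕ} (A : Mat n) where
  open Powers A
  open Operator A

  act-diffL : ∀ {d} (p q : Vec ℂ d) v → actM p v ≋ (λ i → actM q v i +ᶜ act (diffL p q) v i)
  act-diffL [] [] v i = eq (v i)
    where
    eq : ∀ a → a ≡ a +ᶜ 0ᶜ
    eq = solve-∀ ℂ-ring
  act-diffL (a ∷ p) (b ∷ q) v i = trans (cong (a *ᶜ v i +ᶜ_) (trans (X-cong (act-diffL p q v) i) (X-+ (actM q v) (act (diffL p q) v) i)))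
      (eq a b (v i) (X (actM q v) i) (X (act (diffL p q) v) i))
    where
    eq : ∀ a b v x y → a *ᶜ v +ᶜ (x +ᶜ y) ≡ (b *ᶜ v +ᶜ x) +ᶜ ((a -ᶜ b) *ᶜ v +ᶜ y)
    eq = solve-∀ ℂ-ring

  module Product (B : ℚ) (1≤B : 1ℚ ≤ B) (k : ℕ) (B^≤2 : B ^ suc k ≤ 2ℚ) where
    r₀ σ : ℚ
    r₀ = ℤ.+ 1 / suc k
    σ = r₀ * 2ℚ

    0≤σ : 0ℚ ≤ σ
    0≤σ = 0≤* (<⇒≤ (0<recip k)) (<⇒≤ 0<2)

    Cofactor : ∀ {d} → Vec ℂ d → Set
    Cofactor {d} zs = Σ (List ℂ) λ S → Σ (List ℂ) λ q →
      (∀ v i → actM (rootsPoly zs) (act S v) i ≡ v i +ᶜ act q v i) × Sup (cofactorBound k d) S × Sup (σ * weight d) q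

    -- (1 + q₁)(1 + q′) = 1 + q₁ + q′ + q₁q′, while the cofactors multiply.
    extend : ∀ {d} z (zs : Vec ℂ d) → InvertibleWithin B z → Cofactor zs → Cofactor (z ∷ zs)
    extend {d} z zs (μ , zμ , μ≼B) (S′ , q′ , id′ , supS′ , supq′) = mulL S₁ S′ , addL q₁ (addL q′ (mulL q₁ q′)) , identity , bound-S , bound-q
      where
      module F = Factor z μ zμ B μ≼B 1≤B
      S₁ q₁ : List ℂ
      S₁ = F.S k B^≤2
      q₁ = F.q k B^≤2
      identity : ∀ v i → actM (rootsPoly (z ∷ zs)) (act (mulL S₁ S′) v) i ≡ v i +ᶜ act (addL q₁ (addL q′ (mulL q₁ q′))) v i
      identity v i = trans (actM-mulLin 0ᶜ (-ᶜ z) (rootsPoly zs) w i)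
          (trans (cong₂ (λ a b → 0ᶜ *ᶜ w i +ᶜ (-ᶜ z *ᶜ a +ᶜ b)) (Y≡ i) (trans (X-cong Y≡ i) (X-+ y (act q′ y) i)))
          (trans (cong (λ a → 0ᶜ *ᶜ w i +ᶜ (-ᶜ z *ᶜ (y i +ᶜ act q′ y i) +ᶜ (X y i +ᶜ a))) (sym (act-X q′ y i)))
          (trans (eq₁ z (w i) (y i) (act q′ y i) (X y i) (act q′ (X y) i))
          (trans (cong₂ _+ᶜ_ (F.factor k B^≤2 v i) (trans (sym combine-q′) (act-cong q′ (F.factor k B^≤2 v) i)))
          (trans (cong (v i +ᶜ act q₁ v i +ᶜ_) (act-+ q′ v (act q₁ v) i))
          (trans (cong (λ a → v i +ᶜ act q₁ v i +ᶜ (act q′ v i +ᶜ a)) (trans (act-comm q′ q₁ v i) (sym (act-mulL q₁ q′ v i))))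
          (trans (eq₂ (v i) (act q₁ v i) (act q′ v i) (act (mulL q₁ q′) v i))
            (cong (v i +ᶜ_) (sym (trans (act-addL q₁ (addL q′ (mulL q₁ q′)) v i) (cong (act q₁ v i +ᶜ_) (act-addL q′ (mulL q₁ q′) v i))))))))))))
        where
        w y : V
        w = act (mulL S₁ S′) v
        y = act S₁ v
        Y≡ : actM (rootsPoly zs) w ≋ (λ j → y j +ᶜ act q′ y j)
        Y≡ j = trans (actM-cong (rootsPoly zs) (λ l → trans (act-mulL S₁ S′ v l) (act-comm S₁ S′ v l)) j) (id′ y j)
        eq₁ : ∀ z w y a b c → 0ᶜ *ᶜ w +ᶜ (-ᶜ z *ᶜ (y +ᶜ a) +ᶜ (b +ᶜ c)) ≡ (b -ᶜ z *ᶜ y) +ᶜ (c +ᶜ -ᶜ z *ᶜ a)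
        eq₁ = solve-∀ ℂ-ring
        eq₂ : ∀ v a b c → v +ᶜ a +ᶜ (b +ᶜ c) ≡ v +ᶜ (a +ᶜ (b +ᶜ c))
        eq₂ = solve-∀ ℂ-ring
        eq₃ : ∀ z a → -ᶜ (z *ᶜ a) ≡ -ᶜ z *ᶜ a
        eq₃ = solve-∀ ℂ-ring
        combine-q′ : act q′ (λ j → X y j -ᶜ z *ᶜ y j) i ≡ act q′ (X y) i +ᶜ -ᶜ z *ᶜ act q′ y i
        combine-q′ = trans (act-+ q′ (X y) (λ j → -ᶜ (z *ᶜ y j)) i) (cong (act q′ (X y) i +ᶜ_)
          (trans (act-cong q′ (λ j → eq₃ z (y j)) i) (act-* q′ (-ᶜ z) y i)))
      bound-S : Sup (cofactorBound k (suc d)) (mulL S₁ S′)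
      bound-S = subst (λ m → Sup (ι m * (2ℚ * 2ℚ * cofactorBound k d)) (mulL S₁ S′)) (F.length-S k B^≤2)
        (sup-mul S₁ S′ (<⇒≤ (0<* 0<2 0<2)) (<⇒≤ (0<cofactorBound k d)) (F.sup-S k B^≤2) supS′)
      0≤σw : 0ℚ ≤ σ * weight d
      0≤σw = 0≤* 0≤σ (0≤weight d)
      bound-q : Sup (σ * weight (suc d)) (addL q₁ (addL q′ (mulL q₁ q′)))
      bound-q = sup-mono total (sup-add q₁ _ 0≤σ (0≤+ 0≤σw (0≤* (0≤ι (length q₁)) (0≤* 0≤σ 0≤σw))) (F.sup-q k B^≤2)
                  (sup-add q′ _ 0≤σw (0≤* (0≤ι (length q₁)) (0≤* 0≤σ 0≤σw)) supq′ (sup-mul q₁ q′ 0≤σ 0≤σw (F.sup-q k B^≤2) supq′)))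
        where
        lenσ : ι (suc (suc k)) * σ ≤ ι 4
        lenσ = ≤-trans (≤-reflexive (trans (eq r₀ (ι (suc k)) ) (cong (λ a → (r₀ + a) * 2ℚ) (recip k)))) (≤-trans (*-monoʳ 2ℚ (<⇒≤ 0<2) (+-monoˡ-≤ 1ℚ (recip≤1 k))) (≤-reflexive refl))
          where
          eq : ∀ r n → (1ℚ + n) * (r * (1ℚ + 1ℚ)) ≡ (r + n * r) * (1ℚ + 1ℚ)
          eq = solve-∀ ℚ-ring
        total : σ + (σ * weight d + ι (length q₁) * (σ * (σ * weight d))) ≤ σ * weight (suc d)
        total = ≤-trans (+-monoʳ-≤ σ (+-monoʳ-≤ (σ * weight d) (≤-trans (≤-reflexive (trans (cong (λ m → ι m * (σ * (σ * weight d))) (F.length-q k B^≤2)) (sym (*-assoc (ι (suc (suc k))) σ (σ * weight d)))))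
                    (*-monoʳ (σ * weight d) 0≤σw lenσ)))) (≤-reflexive (eq σ (weight d)))
          where
          eq : ∀ s w → s + (s * w + ι 4 * (s * w)) ≡ s * (1ℚ + ι 5 * w)
          eq = solve-∀ ℚ-ring

    cofactor : ∀ {d} (zs : Vec ℂ d) → VAll.All (InvertibleWithin B) zs → Cofactor zs
    cofactor [] [] = 1ᶜ ∷ [] , [] , (λ v i → trans (cong (1ᶜ *ᶜ v i +ᶜ_) (X-0 i)) (eq (v i))) , (1≼1 ∷ []) , []
      where
      eq : ∀ a → 1ᶜ *ᶜ a +ᶜ 0ᶜ ≡ a +ᶜ 0ᶜ
      eq = solve-∀ ℂ-ring
    cofactor (z ∷ zs) (p ∷ ps) = extend z zs p (cofactor zs ps)

  re-actM : ∀ {d} (P : Vec ℚ d) v i → re (actM (Vec.map ⟦_⟧ P) v i) ≡ actQ P (λ j → re (v j)) i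
  re-actM [] v i = refl
  re-actM (c ∷ P) v i = trans (re-+ (⟦ c ⟧ *ᶜ v i) _) (cong₂ _+_ (trans (re-* ⟦ c ⟧ (v i)) (eq c (re (v i)) (im (v i)))) (·-cong (re-actM P v) i))
    where
    eq : ∀ c a b → c * a - 0ℚ * b ≡ c * a
    eq = solve-∀ ℚ-ring

  im-actM : ∀ {d} (P : Vec ℚ d) v i → im (actM (Vec.map ⟦_⟧ P) v i) ≡ actQ P (λ j → im (v j)) i
  im-actM [] v i = refl
  im-actM (c ∷ P) v i = trans (im-+ (⟦ c ⟧ *ᶜ v i) _) (cong₂ _+_ (trans (im-* ⟦ c ⟧ (v i)) (eq c (re (v i)) (im (v i)))) (·-cong (im-actM P v) i))
    where
    eq : ∀ c a b → c * b + 0ℚ * a ≡ c * b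
    eq = solve-∀ ℚ-ring

  ext : ∀ {z w} → re z ≡ re w → im z ≡ im w → z ≡ w
  ext {_ +i _} {_ +i _} refl refl = refl

  annihilates-ℂ : ∀ {d} (P : Vec ℚ d) → Annihilates P → ∀ v i → actM (Vec.map ⟦_⟧ P) v i ≡ 0ᶜ
  annihilates-ℂ P ann v i = ext (trans (re-actM P v i) (ann _ i)) (trans (im-actM P v i) (ann _ i))

  actL : List ℚ → Vecℚ n → Vecℚ n
  actL [] x i = 0ℚ
  actL (c ∷ cs) x i = c * x i + (A · actL cs x) i

  re-act : ∀ p x i → re (act p (λ j → ⟦ x j ⟧) i) ≡ actL (List.map re p) x i
  re-act [] x i = refl
  re-act (c ∷ p) x i = trans (re-+ (c *ᶜ ⟦ x i ⟧) _) (cong₂ _+_ (trans (re-* c ⟦ x i ⟧) (eq (re c) (im c) (x i))) (·-cong (re-act p x) i))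
    where
    eq : ∀ a b x → a * x - b * 0ℚ ≡ a * x
    eq = solve-∀ ℚ-ring

  -- An annihilating polynomial 1 + m of A with tiny m. Read as x = - Σ m_j A^j x, it spreads a
  -- large vector over many small ones.
  Reduced : ℚ → Set
  Reduced ε = Σ (List ℚ) λ m → All (λ c → ∣ c ∣ ≤ ε) m × (∀ x i → x i + actL m x i ≡ 0ℚ)

  abstract
    -- Write P = R + E with R the product of the factors x - z, and R S = 1 + q. Then P(A) S(A) = 0
    -- becomes 1 + q(A) + E(A) S(A) = 0.
    height-reduction : ∀ {d} (P : Vec ℚ (suc d)) → Annihilates P → ¬ SmallRoot (Vec.map ⟦_⟧ P) → ∀ ε → 0ℚ < ε → Reduced ε
    height-reduction {d} P ann noroot ε 0<ε = choose-k (archimedean⁻ 0<ε′)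
      where
      D : ℕ
      D = suc d
      P′ : Vec ℂ D
      P′ = Vec.map ⟦_⟧ P
      W : ℚ
      W = 1ℚ + weight D
      0<½ : 0ℚ < ½
      0<½ = positive⁻¹ ½
      W-inv : Σ ℚ λ w → 0ℚ < w × W * w ≡ 1ℚ
      W-inv = inv⁺ (0<+ 0<1 (0≤weight D))
      ε′ : ℚ
      -- Makes q, bounded by 2/(k+1) times `weight D`, take at most ε/2.
      ε′ = ε * ½ * (½ * proj₁ W-inv)
      0<ε′ : 0ℚ < ε′
      0<ε′ = 0<* (0<* 0<ε 0<½) (0<* 0<½ (proj₁ (proj₂ W-inv)))
      choose-k : (Σ ℕ λ k → ℤ.+ 1 / suc k ≤ ε′) → Reduced ε
      choose-k (k , r₀≤ε′) = choose-e (min⁺ 0<e₁ 0<e₂)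
        where
        r₀ x B q : ℚ
        r₀ = ℤ.+ 1 / suc k
        -- x = 1/(2(k+1)) gives B^(k+1) ≤ 2 by Bernoulli. With 4q = x/2 the radius h = 1 - x/2
        -- satisfies B h ≥ 1, so every root outside it has an inverse bounded by B.
        x = ½ * r₀
        B = 1ℚ + x
        q = x * (½ * (½ * ½))
        0<x : 0ℚ < x
        0<x = 0<* 0<½ (0<recip k)
        1≤B : 1ℚ ≤ B
        1≤B = ≤-by (<⇒≤ 0<x) refl
        x≤1 : x ≤ 1ℚ
        x≤1 = *-mono 0≤½ ½≤1 (<⇒≤ (0<recip k)) (recip≤1 k)
        B^≤2 : B ^ suc k ≤ 2ℚ
        B^≤2 = *-cancelʳ ½ 0<½ (≤-trans (≤-reflexive (cong (B ^ suc k *_) half)) (bernoulli (suc k) (<⇒≤ 0<x)))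
          where
          eq : ∀ n r → 1ℚ - n * (½ * r) ≡ 1ℚ - ½ * (n * r)
          eq = solve-∀ ℚ-ring
          half : ½ ≡ 1ℚ - ι (suc k) * x
          half = sym (trans (eq (ι (suc k)) r₀) (cong (λ a → 1ℚ - ½ * a) (recip k)))
        0<q : 0ℚ < q
        0<q = 0<* 0<x (0<* 0<½ (0<* 0<½ 0<½))
        4q≡ : 4× q ≡ x * ½
        4q≡ = eq x
          where
          eq : ∀ x → ((x * (½ * (½ * ½)) + x * (½ * (½ * ½))) + (x * (½ * (½ * ½)) + x * (½ * (½ * ½)))) ≡ x * ½
          eq = solve-∀ ℚ-ring
        4q≤1 : 4× q ≤ 1ℚ
        4q≤1 = ≤-trans (≤-reflexive 4q≡) (*-mono (<⇒≤ 0<x) x≤1 0≤½ ½≤1)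
        h : ℚ
        h = 1ℚ - 4× q
        1≤Bh : 1ℚ ≤ B * h
        1≤Bh = ≤-by (0≤* (0≤* (<⇒≤ 0<x) 0≤½) (≤⇒0≤ x≤1)) (trans (cong (λ a → B * (1ℚ - a)) 4q≡) (eq x))
          where
          eq : ∀ x → (1ℚ + x) * (1ℚ - x * ½) ≡ 1ℚ + x * ½ * (1ℚ - x)
          eq = solve-∀ ℚ-ring
        module R = Refine P′ q 0<q 4q≤1
        Z : ℚ
        Z = cofactorBound k D
        Z-inv : Σ ℚ λ w → 0ℚ < w × Z * w ≡ 1ℚ
        Z-inv = inv⁺ (0<cofactorBound k D)
        e₁ e₂ : ℚ
        -- `e₁` makes a root of the approximant within h good enough to start the refinement; `e₂`
        -- divides by the bound `Z` on S, so that E S takes the other ε/2.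
        e₁ = R.tol 0 * (ℤ.+ 1 / D)
        e₂ = ε * ½ * (ℤ.+ 1 / D) * proj₁ Z-inv
        0<e₁ : 0ℚ < e₁
        0<e₁ = 0<* (R.0<tol 0) (0<recip d)
        0<e₂ : 0ℚ < e₂
        0<e₂ = 0<* (0<* (0<* 0<ε 0<½) (0<recip d)) (proj₁ (proj₂ Z-inv))
        choose-e : (Σ ℚ λ e → 0ℚ < e × e ≤ e₁ × e ≤ e₂) → Reduced ε
        choose-e (e , 0<e , e≤e₁ , e≤e₂) = factored (approx-factorisation P′ e 0<e)
          where
          factored : (Σ (Vec ℂ D) λ zs → Close e P′ (rootsPoly zs)) → Reduced ε
          factored (zs , cl) = decide (big-or-root zs h (≤⇒0≤ 4q≤1))
            where
            De≤ : ι D * e ≤ R.tol 0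
            De≤ = ≤-trans (*-monoˡ (ι D) (0≤ι D) e≤e₁) (≤-reflexive (trans (eq (ι D) (R.tol 0) (ℤ.+ 1 / D)) (trans (cong (R.tol 0 *_) (recip d)) (*-identityʳ _))))
              where
              eq : ∀ a b c → a * (b * c) ≡ b * (a * c)
              eq = solve-∀ ℚ-ring
            finish : Product.Cofactor B 1≤B k B^≤2 zs → Reduced ε
            finish (S , q′ , id′ , supS , supq) = List.map re m , Allₚ.map⁺ (All.map ≼-re sup-m) , λ x i →
                trans (cong (λ a → x i + a) (sym (re-act m x i))) (trans (sym (re-+ ⟦ x i ⟧ (act m (λ j → ⟦ x j ⟧) i))) (cong re (zero-m (λ j → ⟦ x j ⟧) i)))
              where
              E m : List ℂ
              E = diffL P′ (rootsPoly zs)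
              m = addL q′ (mulL E S)
              zero-m : ∀ v i → v i +ᶜ act m v i ≡ 0ᶜ
              zero-m v i = trans (cong (v i +ᶜ_) (trans (act-addL q′ (mulL E S) v i) (cong (act q′ v i +ᶜ_) (act-mulL E S v i))))
                (trans (eq (v i) (act q′ v i) (act E (act S v) i)) (trans (cong (_+ᶜ act E (act S v) i) (sym (id′ v i)))
                (trans (sym (act-diffL P′ (rootsPoly zs) (act S v) i)) (annihilates-ℂ P ann (act S v) i))))
                where
                eq : ∀ a b c → a +ᶜ (b +ᶜ c) ≡ (a +ᶜ b) +ᶜ c
                eq = solve-∀ ℂ-ring
              sup-m : Sup ε m
              sup-m = sup-mono (≤-trans (+-mono-≤ σ≤ E≤) (≤-reflexive (eqh ε)))
                (sup-add q′ (mulL E S) (0≤* (0≤* (<⇒≤ (0<recip k)) (<⇒≤ 0<2)) (0≤weight D)) (0≤* (0≤ι (length E)) (0≤* (<⇒≤ 0<e) (<⇒≤ (0<cofactorBound k D)))) supq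
                  (sup-mul E S (<⇒≤ 0<e) (<⇒≤ (0<cofactorBound k D)) (sup-diffL cl) supS))
                where
                eqh : ∀ ε → ε * ½ + ε * ½ ≡ ε
                eqh = solve-∀ ℚ-ring
                σ≤ : r₀ * 2ℚ * weight D ≤ ε * ½
                σ≤ = ≤-trans (*-mono (0≤* (<⇒≤ (0<recip k)) (<⇒≤ 0<2)) (*-monoʳ 2ℚ (<⇒≤ 0<2) r₀≤ε′) (0≤weight D) (≤-by {weight D} {W} 0≤1 (+-comm 1ℚ (weight D))))
                  (≤-reflexive (trans (eq ε (proj₁ W-inv) W) (trans (cong (ε * ½ *_) (proj₂ (proj₂ W-inv))) (*-identityʳ _))))
                  where
                  eq : ∀ ε w W → ε * ½ * (½ * w) * (1ℚ + 1ℚ) * W ≡ ε * ½ * (W * w)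
                  eq = solve-∀ ℚ-ring
                E≤ : ι (length E) * (e * Z) ≤ ε * ½
                E≤ = ≤-trans (≤-reflexive (cong (λ l → ι l * (e * Z)) (length-diffL P′ (rootsPoly zs)))) (≤-trans (*-monoˡ (ι D) (0≤ι D) (*-monoʳ Z (<⇒≤ (0<cofactorBound k D)) e≤e₂))
                  (≤-reflexive (trans (eq (ι D) (ε * ½) (ℤ.+ 1 / D) (proj₁ Z-inv) Z) (trans (cong₂ (λ a b → ε * ½ * a * b) (recip d) (proj₂ (proj₂ Z-inv))) (eq1 (ε * ½))))))
                  where
                  eq : ∀ n ε r w Z → n * (ε * r * w * Z) ≡ ε * (n * r) * (Z * w)
                  eq = solve-∀ ℚ-ring
                  eq1 : ∀ a → a * 1ℚ * 1ℚ ≡ a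
                  eq1 = solve-∀ ℚ-ring
            decide : VAll.All (λ z → h * h < N z) zs ⊎ (Σ ℂ λ z → z ≼ h × prodAt zs z ≡ 0ᶜ) → Reduced ε
            decide (inj₁ big) = finish (Product.cofactor B 1≤B k B^≤2 zs (VAll.map (big⇒invertible (≤-trans 0≤1 1≤B) 1≤Bh) big))
            decide (inj₂ (z , z≼h , Πz)) = ⊥-elim (noroot (R.refine z z≼h Pz))
              where
              eq : ∀ a → a -ᶜ 0ᶜ ≡ a
              eq = solve-∀ ℂ-ring
              h≤1 : h ≤ 1ℚ
              h≤1 = ≤-by (≤-trans (0≤* (<⇒≤ 0<x) 0≤½) (≤-reflexive (sym 4q≡))) (eqh (4× q))
                where
                eqh : ∀ a → 1ℚ ≡ 1ℚ - a + a
                eqh = solve-∀ ℚ-ring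
              Pz : evM P′ z ≼ R.tol 0
              Pz = ≼-mono (subst (_≼ ι D * e) (trans (cong (λ a → evM P′ z -ᶜ a) (trans (evM-roots zs z) Πz)) (eq (evM P′ z))) (close-ev (≼-mono z≼h h≤1) cl)) De≤

-- Construction of the digit set

IsInt : ℚ → Set
IsInt x = ∃[ z ] (x ≡ z / 1)

int-add : ∀ {x y} → IsInt x → IsInt y → IsInt (x + y)
int-add (a , p) (b , q) = a ℤ.+ b , trans (cong₂ _+_ p q) (int-+ a b)

int-mul : ∀ {x y} → IsInt x → IsInt y → IsInt (x * y)
int-mul (a , p) (b , q) = a ℤ.* b , trans (cong₂ _*_ p q) (int-* a b)

int-sub : ∀ {x y} → IsInt x → IsInt y → IsInt (x - y)
int-sub {x} {y} p q = subst IsInt (eq x y) (int-add p (int-mul (ℤ.- (ℤ.+ 1) , refl) q))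
  where
  eq : ∀ x y → x + - 1ℚ * y ≡ x - y
  eq = solve-∀ ℚ-ring

int-ι : ∀ n → IsInt (ι n)
int-ι n = ℤ.+ n , ι-/ n

int-sum : ∀ {n} (f : Fin n → ℚ) → (∀ i → IsInt (f i)) → IsInt (sumF f)
int-sum {zero} f p = int-ι 0
int-sum {suc n} f p = int-add (p zero) (int-sum (λ i → f (suc i)) (λ i → p (suc i)))

int-floor : ∀ q → Σ ℚ λ t → IsInt t × t ≤ q × q ≤ t + 1ℚ
int-floor q@(mkℚ n d-1 _) = t , (n ℤ./ℕ d , refl) , lower , upper
  where
  d : ℕ
  d = suc d-1
  t : ℚ
  t = (n ℤ./ℕ d) / 1
  r : ℕ
  r = n ℤ.%ℕ d
  split : ι d * q ≡ ι r + t * ι d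
  split = trans (den-num q) (trans (cong (λ a → a / 1) (ℤ÷.a≡a%ℕn+[a/ℕn]*n n d))
    (trans (sym (int-+ (ℤ.+ r) (n ℤ./ℕ d ℤ.* ℤ.+ d))) (cong₂ _+_ (sym (ι-/ r)) (trans (sym (int-* (n ℤ./ℕ d) (ℤ.+ d))) (cong (t *_) (sym (ι-/ d)))))))
  ι-mono : ∀ {a b} → a ℕ.≤ b → ι a ≤ ι b
  ι-mono {b = b} ℕ.z≤n = 0≤ι b
  ι-mono (ℕ.s≤s le) = +-monoʳ-≤ 1ℚ (ι-mono le)
  lower : t ≤ q
  lower = *-cancelʳ (ι d) (0<ι d-1) (≤-by (0≤ι r) (trans (*-comm q (ι d)) (trans split (+-comm (ι r) (t * ι d)))))
  upper : q ≤ t + 1ℚ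
  upper = *-cancelʳ (ι d) (0<ι d-1) (≤-trans (≤-reflexive (trans (*-comm q (ι d)) split))
    (≤-trans (+-monoˡ-≤ (t * ι d) (ι-mono (ℕₚ.<⇒≤ (ℤ÷.n%ℕd<d n d)))) (≤-reflexive (eq (ι d) t))))
    where
    eq : ∀ d t → d + t * d ≡ (t + 1ℚ) * d
    eq = solve-∀ ℚ-ring

-- t is the floor of (z - y)/L: among the numbers congruent to z modulo L one is picked next to y.
near-residue : ∀ {L} z y → 0ℚ < L → Σ ℚ λ t → IsInt t × ∣ (z - L * t) - y ∣ ≤ L
near-residue {L} z y 0<L = from (inv⁺ 0<L)
  where
  from : (Σ ℚ λ i → 0ℚ < i × L * i ≡ 1ℚ) → Σ ℚ λ t → IsInt t × ∣ (z - L * t) - y ∣ ≤ L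
  from (i , 0<i , Li) = round-down (int-floor ((z - y) * i))
    where
    back : (z - y) * i * L ≡ z - y
    back = trans (eq (z - y) i L) (trans (cong ((z - y) *_) Li) (*-identityʳ _))
      where
      eq : ∀ a b c → a * b * c ≡ a * (c * b)
      eq = solve-∀ ℚ-ring
    round-down : (Σ ℚ λ t → IsInt t × t ≤ (z - y) * i × (z - y) * i ≤ t + 1ℚ) → Σ ℚ λ t → IsInt t × ∣ (z - L * t) - y ∣ ≤ L
    round-down (t , t-int , lo , hi) = t , t-int , abs-≤
      (≤-trans (≤-trans (neg-antimono-≤ (<⇒≤ 0<L)) (≤⇒0≤ (≤-trans (*-monoʳ L (<⇒≤ 0<L) lo) (≤-reflexive back)))) (≤-reflexive (eq₁ z y t L)))
      (≤-by (≤⇒0≤ (≤-trans (≤-reflexive (sym back)) (*-monoʳ L (<⇒≤ 0<L) hi))) (eq₂ z y t L))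
      where
      eq₁ : ∀ z y t L → z - y - t * L ≡ z - L * t - y
      eq₁ = solve-∀ ℚ-ring
      eq₂ : ∀ z y t L → L ≡ z - L * t - y + ((t + 1ℚ) * L - (z - y))
      eq₂ = solve-∀ ℚ-ring

CommonDenominator : ∀ {I : Set} → (I → ℚ) → Set
CommonDenominator f = Σ ℚ λ L → 0ℚ < L × IsInt L × (∀ i → IsInt (L * f i))

common-row : ∀ {n} (f : Fin n → ℚ) → CommonDenominator f
common-row {zero} f = 1ℚ , 0<1 , int-ι 1 , λ ()
common-row {suc n} f = from (common-row (λ i → f (suc i)))
  where
  eq₁ : ∀ a b c → b * (a * c) ≡ a * b * c
  eq₁ = solve-∀ ℚ-ring
  0<den : 0ℚ < ι (↧ₙ f zero)
  0<den with f zero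
  ... | mkℚ _ d _ = 0<ι d
  from : CommonDenominator (λ i → f (suc i)) → CommonDenominator f
  from (L , 0<L , iL , p) = ι (↧ₙ f zero) * L , 0<* 0<den 0<L , int-mul (int-ι (↧ₙ f zero)) iL , λ
    { zero → subst IsInt (eq₁ (ι (↧ₙ f zero)) L (f zero)) (int-mul iL (↥ f zero , den-num (f zero)))
    ; (suc i) → subst IsInt (sym (*-assoc (ι (↧ₙ f zero)) L (f (suc i)))) (int-mul (int-ι (↧ₙ f zero)) (p i)) }

common-matrix : ∀ {m n} (f : Fin m → Fin n → ℚ) → Σ ℚ λ L → 0ℚ < L × IsInt L × (∀ i j → IsInt (L * f i j))
common-matrix {zero} f = 1ℚ , 0<1 , int-ι 1 , λ ()
common-matrix {suc m} f = from (common-row (f zero)) (common-matrix (λ i → f (suc i)))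
  where
  eq₁ : ∀ a b c → b * (a * c) ≡ a * b * c
  eq₁ = solve-∀ ℚ-ring
  from : CommonDenominator (f zero) → (Σ ℚ λ L → 0ℚ < L × IsInt L × (∀ i j → IsInt (L * f (suc i) j))) → Σ ℚ λ L → 0ℚ < L × IsInt L × (∀ i j → IsInt (L * f i j))
  from (K , 0<K , iK , p) (L , 0<L , iL , q) = K * L , 0<* 0<K 0<L , int-mul iK iL , λ
    { zero j → subst IsInt (eq₁ K L (f zero j)) (int-mul iL (p j))
    ; (suc i) j → subst IsInt (sym (*-assoc K L (f (suc i) j))) (int-mul iK (q i j)) }

abs-sum : ∀ {n} (f : Fin n → ℚ) → ∣ sumF f ∣ ≤ sumF (λ i → ∣ f i ∣)
abs-sum {zero} f = ≤-refl
abs-sum {suc n} f = ≤-trans (∣p+q∣≤∣p∣+∣q∣ (f zero) _) (+-monoʳ-≤ ∣ f zero ∣ (abs-sum (λ i → f (suc i))))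

sumF-mono : ∀ {n} {f g : Fin n → ℚ} → (∀ i → f i ≤ g i) → sumF f ≤ sumF g
sumF-mono {zero} le = ≤-refl
sumF-mono {suc n} le = +-mono-≤ (le zero) (sumF-mono (λ i → le (suc i)))

0≤sumF : ∀ {n} {f : Fin n → ℚ} → (∀ i → 0ℚ ≤ f i) → 0ℚ ≤ sumF f
0≤sumF {n} le = ≤-trans (≤-reflexive (sym (sumF-0 n))) (sumF-mono le)

term≤sum : ∀ {n} {f : Fin n → ℚ} → (∀ i → 0ℚ ≤ f i) → ∀ i → f i ≤ sumF f
term≤sum le zero = ≤-by (0≤sumF (λ i → le (suc i))) refl
term≤sum {f = f} le (suc i) = ≤-trans (term≤sum (λ j → le (suc j)) i) (≤-by (le zero) (+-comm (f zero) _))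

dot-bound : ∀ {n} (f x : Fin n → ℚ) {r} → (∀ i → ∣ x i ∣ ≤ r) → ∣ dot f x ∣ ≤ sumF (λ i → ∣ f i ∣) * r
dot-bound f x {r} b = ≤-trans (abs-sum (λ i → f i * x i)) (≤-trans (sumF-mono (λ i → ≤-trans (≤-reflexive (∣p*q∣≡∣p∣*∣q∣ (f i) (x i))) (*-monoˡ ∣ f i ∣ (0≤∣p∣ (f i)) (b i))))
  (≤-reflexive (trans (sumF-cong (λ i → *-comm ∣ f i ∣ r)) (trans (sumF-* r (λ i → ∣ f i ∣)) (*-comm r _)))))

matrixNorm : ∀ {n} → Mat n → ℚ
matrixNorm A = sumF (λ i → sumF (λ j → ∣ A i j ∣))

0≤matrixNorm : ∀ {n} (A : Mat n) → 0ℚ ≤ matrixNorm A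
0≤matrixNorm A = 0≤sumF (λ i → 0≤sumF (λ j → 0≤∣p∣ (A i j)))

matrix-bound : ∀ {n} (A : Mat n) x {r} → 0ℚ ≤ r → (∀ j → ∣ x j ∣ ≤ r) → ∀ i → ∣ (A · x) i ∣ ≤ matrixNorm A * r
matrix-bound A x {r} 0≤r b i = ≤-trans (dot-bound (A i) x b) (*-monoʳ r 0≤r (term≤sum (λ i → 0≤sumF (λ j → 0≤∣p∣ (A i j))) i))

ints : ℕ → List ℚ
ints zero = 0ℚ ∷ []
ints (suc K) = ι (suc K) ∷ - ι (suc K) ∷ ints K

cons : ∀ {n} → ℚ → Vecℚ n → Vecℚ (suc n)
cons c v zero = c
cons c v (suc i) = v i

box : ∀ n → ℕ → List (Vecℚ n)
box zero K = (λ ()) ∷ []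
box (suc n) K = concatMap (λ c → List.map (cons c) (box n K)) (ints K)

ints-int : ∀ K → All IsInt (ints K)
ints-int zero = int-ι 0 ∷ []
ints-int (suc K) = int-ι (suc K) ∷ subst IsInt (eq (ι (suc K))) (int-sub (int-ι 0) (int-ι (suc K))) ∷ ints-int K
  where
  eq : ∀ x → 0ℚ - x ≡ - x
  eq = solve-∀ ℚ-ring

ints-complete : ∀ K m → m ℕ.≤ K → Any (_≡ ι m) (ints K) × Any (_≡ - ι m) (ints K)
ints-complete zero zero le = here refl , here refl
ints-complete (suc K) m le with m ℕₚ.≟ suc K
... | yes refl = here refl , there (here refl)
... | no m≢ = let (p , q) = ints-complete K m (ℕₚ.≤-pred (ℕₚ.≤∧≢⇒< le m≢)) in there (there p) , there (there q)

int-cases : ∀ z → Σ ℕ λ m → (z / 1 ≡ ι m) ⊎ (z / 1 ≡ - ι m)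
int-cases (ℤ.+ m) = m , inj₁ (sym (ι-/ m))
int-cases -[1+ m ] = suc m , inj₂ (cong (λ x → - x) (sym (ι-/ (suc m))))

ι-cancel-≤ : ∀ {m K} → ι m ≤ ι K → m ℕ.≤ K
ι-cancel-≤ {zero} le = ℕ.z≤n
ι-cancel-≤ {suc m} {zero} le = ⊥-elim (<-irrefl refl (<-≤-trans (0<ι m) le))
ι-cancel-≤ {suc m} {suc K} le = ℕ.s≤s (ι-cancel-≤ (≤-by (≤⇒0≤ le) (eq (ι m) (ι K))))
  where
  eq : ∀ m k → k ≡ m + (1ℚ + k - (1ℚ + m))
  eq = solve-∀ ℚ-ring

∈ints : ∀ {K x} → IsInt x → ∣ x ∣ ≤ ι K → Any (_≡ x) (ints K)
∈ints {K} (z , refl) le = go (int-cases z) le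
  where
  go : ∀ {x} → (Σ ℕ λ m → (x ≡ ι m) ⊎ (x ≡ - ι m)) → ∣ x ∣ ≤ ι K → Any (_≡ x) (ints K)
  go (m , inj₁ refl) le = proj₁ (ints-complete K m (ι-cancel-≤ (≤-trans (≤-reflexive (sym (0≤p⇒∣p∣≡p (0≤ι m)))) le)))
  go (m , inj₂ refl) le = proj₂ (ints-complete K m (ι-cancel-≤ (≤-trans (≤-reflexive (sym (trans (∣-p∣≡∣p∣ (ι m)) (0≤p⇒∣p∣≡p (0≤ι m))))) le)))

box-integral : ∀ n K → All Integral (box n K)
box-integral zero K = (λ ()) ∷ []
box-integral (suc n) K = Allₚ.concat⁺ (Allₚ.map⁺ (All.map (λ c-int → Allₚ.map⁺ (All.map (λ v-int → λ { zero → c-int ; (suc i) → v-int i }) (box-integral n K))) (ints-int K)))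

∈box : ∀ {n K} (v : Vecℚ n) → Integral v → (∀ i → ∣ v i ∣ ≤ ι K) → v ∈ᵥ box n K
∈box {zero} v v-int b = here (λ ())
∈box {suc n} {K} v v-int b = Anyₚ.concatMap⁺ (λ c → List.map (cons c) (box n K)) (Any.map (λ e → Anyₚ.map⁺ (Any.map (λ e′ → λ { zero → e ; (suc i) → e′ i }) (∈box {n} {K} (λ i → v (suc i)) (λ i → v-int (suc i)) (λ i → b (suc i))))) (∈ints {K} (v-int zero) (b zero)))

-- Expansions with feedback of the rounding error

module Digits {n : ℕ} (A : Mat n) where
  open Powers A
  open Reduction A

  actL-cong : ∀ m {x y} → x ≈ y → actL m x ≈ actL m y
  actL-cong [] e i = refl
  actL-cong (c ∷ m) e i = cong₂ _+_ (cong (c *_) (e i)) (·-cong (actL-cong m e) i)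

  actL-+ : ∀ m x y i → actL m (λ j → x j + y j) i ≡ actL m x i + actL m y i
  actL-+ [] x y i = refl
  actL-+ (c ∷ m) x y i = trans (cong (c * (x i + y i) +_) (trans (·-cong (actL-+ m x y) i) (·-+ (actL m x) (actL m y) i))) (eq c (x i) (y i) _ _)
    where
    eq : ∀ c x y a b → c * (x + y) + (a + b) ≡ (c * x + a) + (c * y + b)
    eq = solve-∀ ℚ-ring

  actL-* : ∀ m c x i → actL m (λ j → c * x j) i ≡ c * actL m x i
  actL-* [] c x i = sym (*-zeroʳ c)
  actL-* (a ∷ m) c x i = trans (cong (a * (c * x i) +_) (trans (·-cong (actL-* m c x) i) (·-* c (actL m x) i))) (eq a c (x i) _)
    where
    eq : ∀ a c x y → a * (c * x) + c * y ≡ c * (a * x + y)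
    eq = solve-∀ ℚ-ring

  actL-A : ∀ m x i → actL m (A · x) i ≡ (A · actL m x) i
  actL-A [] x i = sym (dot-0 (A i) (λ _ → refl))
  actL-A (c ∷ m) x i = trans (cong (c * (A · x) i +_) (·-cong (actL-A m x) i))
    (sym (trans (·-+ (λ j → c * x j) (A · actL m x) i) (cong (_+ (A · (A · actL m x)) i) (·-* c x i))))

  actL-bound : ∀ m → Σ ℚ λ C → 0ℚ ≤ C × (∀ x {r} → 0ℚ ≤ r → (∀ j → ∣ x j ∣ ≤ r) → ∀ i → ∣ actL m x i ∣ ≤ C * r)
  actL-bound [] = 0ℚ , ≤-refl , λ x {r} _ _ i → ≤-reflexive (sym (*-zeroˡ r))
  actL-bound (c ∷ m) = from (actL-bound m)
    where
    from : (Σ ℚ λ C → 0ℚ ≤ C × (∀ x {r} → 0ℚ ≤ r → (∀ j → ∣ x j ∣ ≤ r) → ∀ i → ∣ actL m x i ∣ ≤ C * r)) →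
      Σ ℚ λ C → 0ℚ ≤ C × (∀ x {r} → 0ℚ ≤ r → (∀ j → ∣ x j ∣ ≤ r) → ∀ i → ∣ actL (c ∷ m) x i ∣ ≤ C * r)
    from (C , 0≤C , bd) = ∣ c ∣ + matrixNorm A * C , 0≤+ (0≤∣p∣ c) (0≤* (0≤matrixNorm A) 0≤C) , λ x {r} 0≤r b i →
      ≤-trans (∣p+q∣≤∣p∣+∣q∣ (c * x i) _) (≤-trans (+-mono-≤ (≤-trans (≤-reflexive (∣p*q∣≡∣p∣*∣q∣ c (x i))) (*-monoˡ ∣ c ∣ (0≤∣p∣ c) (b i)))
        (matrix-bound A (actL m x) (0≤* 0≤C 0≤r) (bd x 0≤r b) i)) (≤-reflexive (eq ∣ c ∣ (matrixNorm A) C r)))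
      where
      eq : ∀ c a d r → c * r + a * (d * r) ≡ (c + a * d) * r
      eq = solve-∀ ℚ-ring

  actL-denominator : ∀ m → Σ ℚ λ L → 0ℚ < L × IsInt L × (∀ x → Integral x → ∀ i → IsInt (L * actL m x i))
  actL-denominator [] = 1ℚ , 0<1 , int-ι 1 , λ x _ i → int-ι 0
  actL-denominator (c ∷ m) = from (common-row {1} (λ _ → c)) (common-matrix A) (actL-denominator m)
    where
    from : CommonDenominator {Fin 1} (λ _ → c) → (Σ ℚ λ L → 0ℚ < L × IsInt L × (∀ i j → IsInt (L * A i j))) →
      (Σ ℚ λ L → 0ℚ < L × IsInt L × (∀ x → Integral x → ∀ i → IsInt (L * actL m x i))) →
      Σ ℚ λ L → 0ℚ < L × IsInt L × (∀ x → Integral x → ∀ i → IsInt (L * actL (c ∷ m) x i))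
    from (J , 0<J , iJ , p) (K , 0<K , iK , q) (L , 0<L , iL , r) = J * (K * L) , 0<* 0<J (0<* 0<K 0<L) , int-mul iJ (int-mul iK iL) , λ x x-int i →
      subst IsInt (eq J K L c (x i) _) (int-add (int-mul (int-mul iK iL) (int-mul (p zero) (x-int i))) (int-mul iJ (head x x-int i)))
      where
      eq : ∀ J K L c x y → K * L * (J * c * x) + J * (K * (L * y)) ≡ J * (K * L) * (c * x + y)
      eq = solve-∀ ℚ-ring
      head : ∀ x → Integral x → ∀ i → IsInt (K * (L * (A · actL m x) i))
      head x x-int i = subst IsInt (trans (sumF-cong (λ j → *-assoc K (A i j) (L * actL m x j))) (trans (sumF-* K (λ j → A i j * (L * actL m x j))) (cong (K *_) (·-* L (actL m x) i))))
        (int-sum (λ j → K * A i j * (L * actL m x j)) (λ j → int-mul (q i j) (r x x-int j)))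

  sum-digits : List (Vecℚ n) → Vecℚ n
  sum-digits [] i = 0ℚ
  sum-digits (w ∷ ws) i = w i + (A · sum-digits ws) i

  -- The inverse of A with the two constants that fix the digit set: a bound C for its growth, and
  -- an integer L for which it maps L ℤⁿ into ℤⁿ.
  record Inverse : Set where
    field
      B : Vecℚ n → Vecℚ n
      B-cong : ∀ {x y} → x ≈ y → B x ≈ B y
      B-+ : ∀ x y i → B (λ j → x j + y j) i ≡ B x i + B y i
      AB : ∀ x i → (A · B x) i ≡ x i
      BA : ∀ x i → B (A · x) i ≡ x i
      C : ℚ
      0≤C : 0ℚ ≤ C
      B-bound : ∀ x {r} → 0ℚ ≤ r → (∀ j → ∣ x j ∣ ≤ r) → ∀ i → ∣ B x i ∣ ≤ C * r
      L : ℚ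
      0<L : 0ℚ < L
      L-int : IsInt L
      B-int : ∀ x → Integral x → Integral (B (λ j → L * x j))

  -- The constant coefficient 1 + c of the annihilating polynomial is at least ½, so (1 + c)x + A
  -- m(A)x = 0 can be solved: A⁻¹ = - m(A)/(1 + c).
  reduced⇒inverse : Fin n → Reduced ½ → Inverse
  reduced⇒inverse i₀ ([] , _ , z) = ⊥-elim (1≢0 (z (λ _ → 1ℚ) i₀))
  reduced⇒inverse i₀ (c ∷ m , (c≤ ∷ _) , z) = from (inv⁺ 0<1+c) (actL-bound m)
    where
    0<1+c : 0ℚ < 1ℚ + c
    0<1+c = <-≤-trans (positive⁻¹ ½) (≤-by (≤⇒0≤ (≤-trans -c≤ c≤)) (eq c ))
      where
      -c≤ : - c ≤ ∣ c ∣
      -c≤ = ≤-trans (p≤∣p∣ (- c)) (≤-reflexive (∣-p∣≡∣p∣ c))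
      eq : ∀ c → 1ℚ + c ≡ ½ + (½ - - c)
      eq = solve-∀ ℚ-ring
    from : (Σ ℚ λ g → 0ℚ < g × (1ℚ + c) * g ≡ 1ℚ) →
      (Σ ℚ λ C → 0ℚ ≤ C × (∀ x {r} → 0ℚ ≤ r → (∀ j → ∣ x j ∣ ≤ r) → ∀ i → ∣ actL m x i ∣ ≤ C * r)) → Inverse
    from (g , 0<g , cg) (C , 0≤C , bd) = with-den (common-row {1} (λ _ → - g)) (actL-denominator m)
      where
      B : Vecℚ n → Vecℚ n
      B x i = - g * actL m x i
      AB : ∀ x i → (A · B x) i ≡ x i
      AB x i = trans (·-* (- g) (actL m x) i) (trans (eq₁ c g (x i) ((A · actL m x) i)) (trans (cong₂ (λ a b → a * x i - g * b) cg (z x i)) (eq₂ (x i) g)))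
        where
        eq₁ : ∀ c g x y → - g * y ≡ (1ℚ + c) * g * x - g * (x + (c * x + y))
        eq₁ = solve-∀ ℚ-ring
        eq₂ : ∀ x g → 1ℚ * x - g * 0ℚ ≡ x
        eq₂ = solve-∀ ℚ-ring
      with-den : CommonDenominator {Fin 1} (λ _ → - g) → (Σ ℚ λ L → 0ℚ < L × IsInt L × (∀ x → Integral x → ∀ i → IsInt (L * actL m x i))) → Inverse
      with-den (J , 0<J , iJ , p) (L , 0<L , iL , q) = record
        { B = B
        ; B-cong = λ e i → cong (- g *_) (actL-cong m e i)
        ; B-+ = λ x y i → trans (cong (- g *_) (actL-+ m x y i)) (*-distribˡ-+ (- g) _ _)
        ; AB = AB
        -- `B` is a polynomial in A and commutes with it.
        ; BA = λ x i → trans (trans (cong (- g *_) (actL-A m x i)) (sym (·-* (- g) (actL m x) i))) (AB x i)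
        ; C = g * C ; 0≤C = 0≤* (<⇒≤ 0<g) 0≤C
        ; B-bound = λ x {r} 0≤r b i → ≤-trans (≤-reflexive (trans (∣p*q∣≡∣p∣*∣q∣ (- g) _) (cong (_* ∣ actL m x i ∣) (trans (∣-p∣≡∣p∣ g) (0≤p⇒∣p∣≡p (<⇒≤ 0<g))))))
            (≤-trans (*-monoˡ g (<⇒≤ 0<g) (bd x 0≤r b i)) (≤-reflexive (sym (*-assoc g C r))))
        ; L = J * L ; 0<L = 0<* 0<J 0<L ; L-int = int-mul iJ iL
        ; B-int = λ x x-int i → subst IsInt (trans (eq J (- g) L (actL m x i)) (cong (- g *_) (sym (actL-* m (J * L) x i)))) (int-mul (p zero) (q x x-int i))
        }
        where
        eq : ∀ J g L y → J * g * (L * y) ≡ g * (J * L * y)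
        eq = solve-∀ ℚ-ring

  module Construct (inv : Inverse) (red : ∀ ε → 0ℚ < ε → Reduced ε) where
    open Inverse inv

    -- A rounding error is at most L before division by A and at most CL after it. It does not
    -- accumulate, because the next digit is aimed at the control plus the current error.
    E : ℚ
    E = C * L

    0≤E : 0ℚ ≤ E
    0≤E = 0≤* 0≤C (<⇒≤ 0<L)

    K : ℕ
    -- A digit lies within L of its target, and a target is a control of size 1 plus an error of
    -- size E.
    K = proj₁ (archimedean (L + (1ℚ + E)))

    K≥ : L + (1ℚ + E) ≤ ι K
    K≥ = proj₂ (archimedean (L + (1ℚ + E)))

    D : List (Vecℚ n)
    D = box n K

    digit : ∀ (z y : Vecℚ n) → Integral z → (∀ i → ∣ y i ∣ ≤ 1ℚ + E) → Σ (Vecℚ n) λ d → Σ (Vecℚ n) λ t →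
      d ∈ᵥ D × Integral t × (∀ i → ∣ d i - y i ∣ ≤ L) × (∀ i → z i ≡ d i + L * t i)
    digit z y z-int y≤ = d , t , ∈box d (λ i → int-sub (z-int i) (int-mul L-int (t-int i))) d≤ , t-int , near , λ i → eq (z i) (L * t i)
      where
      t d : Vecℚ n
      t i = proj₁ (near-residue (z i) (y i) 0<L)
      d i = z i - L * t i
      t-int : Integral t
      t-int i = proj₁ (proj₂ (near-residue (z i) (y i) 0<L))
      near : ∀ i → ∣ d i - y i ∣ ≤ L
      near i = proj₂ (proj₂ (near-residue (z i) (y i) 0<L))
      eq : ∀ z s → z ≡ z - s + s
      eq = solve-∀ ℚ-ring
      d≤ : ∀ i → ∣ d i ∣ ≤ ι K
      d≤ i = ≤-trans (≤-reflexive (cong ∣_∣ (eq (d i) (y i)))) (≤-trans (∣p+q∣≤∣p∣+∣q∣ (d i - y i) (y i)) (≤-trans (+-mono-≤ (near i) (y≤ i)) K≥))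

    prepend : ∀ {d z s} → d ∈ᵥ D → (∀ i → z i ≡ d i + (A · s) i) → InDA A D s → InDA A D z
    prepend {d} d∈ e (d′ , ds , d′∈ , ds∈ , s≈) = d , d′ ∷ ds , d∈ , (d′∈ ∷ ds∈) , λ i → trans (e i) (cong (d i +_) (·-cong s≈ i))

    -- The state z stays within E of the real trajectory w₀ + A w₁ + …, whose controls wⱼ are bounded by 1.
    follow : ∀ ws (z e : Vecℚ n) → Integral z → (∀ i → ∣ e i ∣ ≤ E) → All (λ w → ∀ i → ∣ w i ∣ ≤ 1ℚ) ws →
      (∀ i → z i ≡ e i + sum-digits ws i) → InDA A D z
    -- Once the controls are exhausted the state is the error alone, small enough to be the last
    -- digit.
    follow [] z e z-int e≤ [] z≡ = z , [] , ∈box z z-int (λ i → ≤-trans (≤-reflexive (cong ∣_∣ (trans (z≡ i) (+-identityʳ (e i))))) (≤-trans (e≤ i) E≤K)) , [] , λ i → refl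
      where
      E≤K : E ≤ ι K
      E≤K = ≤-trans (≤-by (0≤+ (<⇒≤ 0<L) 0≤1) (eq L E)) K≥
        where
        eq : ∀ l e → l + (1ℚ + e) ≡ e + (l + 1ℚ)
        eq = solve-∀ ℚ-ring
    follow (w ∷ ws) z e z-int e≤ (w≤ ∷ ws≤) z≡ = step (digit z y z-int λ i → ≤-trans (∣p+q∣≤∣p∣+∣q∣ (w i) (e i)) (+-mono-≤ (w≤ i) (e≤ i)))
      where
      y : Vecℚ n
      y i = w i + e i
      step : (Σ (Vecℚ n) λ d → Σ (Vecℚ n) λ t → d ∈ᵥ D × Integral t × (∀ i → ∣ d i - y i ∣ ≤ L) × (∀ i → z i ≡ d i + L * t i)) → InDA A D z
      step (d , t , d∈ , t-int , near , split) = prepend d∈ (λ i → trans (split i) (cong (d i +_) (sym (AB (λ j → L * t j) i))))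
          (follow ws z′ e′ (B-int t t-int) (λ i → B-bound err (<⇒≤ 0<L) err≤ i) ws≤ z′≡)
        where
        z′ err e′ : Vecℚ n
        z′ = B (λ j → L * t j)
        err j = y j - d j
        e′ = B err
        err≤ : ∀ j → ∣ err j ∣ ≤ L
        err≤ j = ≤-trans (≤-reflexive (trans (sym (∣-p∣≡∣p∣ (err j))) (cong ∣_∣ (eq (y j) (d j))))) (near j)
          where
          eq : ∀ y d → - (y - d) ≡ d - y
          eq = solve-∀ ℚ-ring
        -- L t = z - d is (y - d) plus A times the remaining trajectory; dividing by A gives the new
        -- error plus that trajectory.
        z′≡ : ∀ i → z′ i ≡ e′ i + sum-digits ws i
        z′≡ i = trans (B-cong (λ j → trans (eq₁ (d j) (L * t j)) (trans (cong (_- d j) (trans (sym (split j)) (z≡ j))) (eq₂ (e j) (w j) ((A · sum-digits ws) j) (d j)))) i)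
            (trans (B-+ err (A · sum-digits ws) i) (cong (e′ i +_) (BA (sum-digits ws) i)))
          where
          eq₁ : ∀ d s → s ≡ d + s - d
          eq₁ = solve-∀ ℚ-ring
          eq₂ : ∀ e w s d → e + (w + s) - d ≡ (w + e - d) + s
          eq₂ = solve-∀ ℚ-ring

    -- With ε = 1/M and M above all |z_i|, the controls - m_j z have entries at most 1, and z = Σ
    -- A^j (- m_j z) starts with error 0.
    integral∈ : ∀ z → Integral z → InDA A D z
    integral∈ z z-int = from (inv⁺ 0<M)
      where
      M : ℚ
      M = 1ℚ + sumF (λ i → ∣ z i ∣)
      0<M : 0ℚ < M
      0<M = 0<+ 0<1 (0≤sumF (λ i → 0≤∣p∣ (z i)))
      z≤M : ∀ i → ∣ z i ∣ ≤ M
      z≤M i = ≤-trans (term≤sum (λ i → 0≤∣p∣ (z i)) i) (≤-by 0≤1 (+-comm 1ℚ (sumF (λ i → ∣ z i ∣))))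
      from : (Σ ℚ λ ε → 0ℚ < ε × M * ε ≡ 1ℚ) → InDA A D z
      from (ε , 0<ε , Mε) = use (red ε 0<ε)
        where
        controls : List ℚ → List (Vecℚ n)
        controls = List.map (λ c i → - (c * z i))
        sum-controls : ∀ m i → sum-digits (controls m) i ≡ - actL m z i
        sum-controls [] i = refl
        sum-controls (c ∷ m) i = trans (cong (- (c * z i) +_) (trans (·-cong (λ j → trans (sum-controls m j) (eq (actL m z j))) i) (·-* (- 1ℚ) (actL m z) i))) (eq′ (c * z i) _)
          where
          eq : ∀ a → - a ≡ - 1ℚ * a
          eq = solve-∀ ℚ-ring
          eq′ : ∀ a b → - a + - 1ℚ * b ≡ - (a + b)
          eq′ = solve-∀ ℚ-ring
        use : Reduced ε → InDA A D z
        use (m , m≤ , zero-m) = follow (controls m) z (λ _ → 0ℚ) z-int (λ _ → 0≤E)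
          (Allₚ.map⁺ (All.map (λ {c} c≤ i → ≤-trans (≤-reflexive (trans (∣-p∣≡∣p∣ (c * z i)) (∣p*q∣≡∣p∣*∣q∣ c (z i)))) (≤-trans (*-mono (0≤∣p∣ c) c≤ (0≤∣p∣ (z i)) (z≤M i)) (≤-reflexive (trans (*-comm ε M) Mε)))) m≤))
          (λ i → trans (eq (z i) (actL m z i)) (trans (cong (_- actL m z i) (zero-m z i)) (cong (0ℚ +_) (sym (sum-controls m i)))))
          where
          eq : ∀ a b → a ≡ a + b - b
          eq = solve-∀ ℚ-ring

    -- As in addition with carries: z is replaced by a congruent digit, and the carry A⁻¹(L t),
    -- being integral, is added to the next coefficient.
    horner∈ : ∀ z zs → Integral z → All Integral zs → InDA A D (horner A z zs)
    horner∈ z [] z-int [] = integral∈ z z-int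
    horner∈ z (y ∷ zs) z-int (y-int ∷ zs-int) = step (digit z (λ _ → 0ℚ) z-int (λ _ → 0≤+ 0≤1 0≤E))
      where
      step : (Σ (Vecℚ n) λ d → Σ (Vecℚ n) λ t → d ∈ᵥ D × Integral t × (∀ i → ∣ d i - 0ℚ ∣ ≤ L) × (∀ i → z i ≡ d i + L * t i)) → InDA A D (horner A z (y ∷ zs))
      step (d , t , d∈ , t-int , _ , split) = prepend d∈ (λ i → trans (cong (_+ (A · horner A y zs) i) (trans (split i) (cong (d i +_) (sym (AB (λ j → L * t j) i)))))
          (trans (+-assoc (d i) _ _) (cong (d i +_) (sym (trans (·-cong (shift s y zs) i) (·-+ s (horner A y zs) i))))))
          (horner∈ (s ⊕ y) zs (λ i → int-add (B-int t t-int i) (y-int i)) zs-int)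
        where
        s : Vecℚ n
        s = B (λ j → L * t j)
        shift : ∀ (s y : Vecℚ n) zs i → horner A (s ⊕ y) zs i ≡ s i + horner A y zs i
        shift s y [] i = refl
        shift s y (x ∷ xs) i = +-assoc (s i) (y i) _

    digit-integral : ∀ {d} → d ∈ᵥ D → Integral d
    digit-integral d∈ = go (box-integral n K) d∈
      where
      go : ∀ {d} {D : List (Vecℚ n)} → All Integral D → d ∈ᵥ D → Integral d
      go (p ∷ _) (here e) i = proj₁ (p i) , trans (sym (e i)) (proj₂ (p i))
      go (_ ∷ ps) (there q) = go ps q

    digitSystem : Σ (List (Vecℚ n)) λ D → All Integral D × DigitSystem A D × Finiteness A D
    digitSystem = D , box-integral n K , All.map (λ {d} d-int → d , [] , d-int , [] , λ i → refl) (box-integral n K) ,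
      (λ { v (z , zs , z-int , zs-int , v≈) → transport v≈ (horner∈ z zs z-int zs-int) }) ,
      λ { v (d , ds , d∈ , ds∈ , v≈) → d , ds , digit-integral d∈ , All.map digit-integral ds∈ , v≈ }
      where
      transport : ∀ {v w} → v ≈ w → InDA A D w → InDA A D v
      transport e (d , ds , p , q , w≈) = d , ds , p , q , λ i → trans (e i) (w≈ i)

-- Eigenvectors from small roots

evM-lipschitz : ∀ {d} (p : Vec ℂ d) → Σ ℚ λ C → 0ℚ ≤ C × (∀ {z} → z ≼ 1ℚ → evM p z ≼ C) ×
  (∀ {z w h} → z ≼ 1ℚ → w ≼ 1ℚ → z -ᶜ w ≼ h → evM p z -ᶜ evM p w ≼ C * h)
evM-lipschitz [] = 1ℚ , 0≤1 , (λ _ → 1≼1) , λ {z} {w} {h} _ _ b → subst (_≼ 1ℚ * h) refl (0≼ (0≤* 0≤1 (0≤bound b)))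
evM-lipschitz (c ∷ p) = from (evM-lipschitz p)
  where
  from : (Σ ℚ λ C → 0ℚ ≤ C × (∀ {z} → z ≼ 1ℚ → evM p z ≼ C) × (∀ {z w h} → z ≼ 1ℚ → w ≼ 1ℚ → z -ᶜ w ≼ h → evM p z -ᶜ evM p w ≼ C * h)) →
    Σ ℚ λ C → 0ℚ ≤ C × (∀ {z} → z ≼ 1ℚ → evM (c ∷ p) z ≼ C) × (∀ {z w h} → z ≼ 1ℚ → w ≼ 1ℚ → z -ᶜ w ≼ h → evM (c ∷ p) z -ᶜ evM (c ∷ p) w ≼ C * h)
  from (C , 0≤C , bd , lip) = ‖ c ‖ + (C + C) , 0≤+ (0≤‖‖ c) (0≤+ 0≤C 0≤C) ,
      (λ z≼ → ≼-mono (≼-+ (≼‖‖ c) (≼-* z≼ (bd z≼))) (≤-by 0≤C (eq₁ ‖ c ‖ C))) ,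
      λ {z} {w} {h} z≼ w≼ b → subst (_≼ (‖ c ‖ + (C + C)) * h) (eq₂ c z w (evM p z) (evM p w))
        (≼-mono (≼-+ (≼-* b (bd z≼)) (≼-* w≼ (lip z≼ w≼ b))) (≤-by (0≤* (0≤‖‖ c) (0≤bound b)) (eq₃ ‖ c ‖ C h)))
    where
    eq₁ : ∀ c d → c + (d + d) ≡ c + 1ℚ * d + d
    eq₁ = solve-∀ ℚ-ring
    eq₂ : ∀ c z w e f → (z -ᶜ w) *ᶜ e +ᶜ w *ᶜ (e -ᶜ f) ≡ (c +ᶜ z *ᶜ e) -ᶜ (c +ᶜ w *ᶜ f)
    eq₂ = solve-∀ ℂ-ring
    eq₃ : ∀ c d h → (c + (d + d)) * h ≡ h * d + 1ℚ * (d * h) + c * h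
    eq₃ = solve-∀ ℚ-ring

module Eigen {n : ℕ} (A : Mat n) where
  open Powers A
  open Operator A
  open Reduction A

  normX : ℚ
  normX = matrixNorm A + matrixNorm A

  0≤normX : 0ℚ ≤ normX
  0≤normX = 0≤+ (0≤matrixNorm A) (0≤matrixNorm A)

  X-bound : ∀ v {r} → (∀ j → v j ≼ r) → ∀ i → X v i ≼ normX * r
  X-bound v {r} b i = ≼-mono (≼‖‖ (X v i)) (≤-trans (+-mono-≤ (matrix-bound A (λ j → re (v j)) 0≤r (λ j → ≼-re (b j)) i) (matrix-bound A (λ j → im (v j)) 0≤r (λ j → ≼-im (b j)) i))
      (≤-reflexive (sym (*-distribʳ-+ r (matrixNorm A) (matrixNorm A)))))
    where
    0≤r : 0ℚ ≤ r
    0≤r = 0≤bound (b i)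

  X-sub : ∀ v w → X (λ j → v j -ᶜ w j) ≋ (λ i → X v i -ᶜ X w i)
  X-sub v w i = trans (X-+ v (λ j → -ᶜ w j) i) (cong (X v i +ᶜ_) (trans (X-cong (λ j → neg≡ (w j)) i) (trans (X-* (-ᶜ 1ᶜ) w i) (sym (neg≡ (X w i))))))
    where
    neg≡ : ∀ a → -ᶜ a ≡ -ᶜ 1ᶜ *ᶜ a
    neg≡ = solve-∀ ℂ-ring

  -- Uniform over the closed unit disc: `bound` controls error terms, and `lipschitz` turns a Cauchy
  -- sequence of approximate roots into Cauchy sequences of eigenvector entries.
  record QuotientBound {d} (P : Vec ℂ (suc d)) : Set where
    field
      C : ℚ
      0≤C : 0ℚ ≤ C
      bound : ∀ {z u r} → z ≼ 1ℚ → (∀ j → u j ≼ r) → ∀ i → actM (quotM P z) u i ≼ C * r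
      lipschitz : ∀ {z w u h r} → z ≼ 1ℚ → w ≼ 1ℚ → z -ᶜ w ≼ h → (∀ j → u j ≼ r) → ∀ i → actM (quotM P z) u i -ᶜ actM (quotM P w) u i ≼ C * (h * r)

  quotient-bound : ∀ {d} (P : Vec ℂ (suc d)) → QuotientBound P
  quotient-bound (c ∷ []) = record
    { C = 1ℚ ; 0≤C = 0≤1
    ; bound = λ {_} {u} {r} _ b i → subst (u i ≼_) (sym (*-identityˡ r)) (b i)
    ; lipschitz = λ {_} {_} {u} {h} {r} _ _ p b i → subst (_≼ 1ℚ * (h * r)) (eq (u i)) (0≼ (0≤* 0≤1 (0≤* (0≤bound p) (0≤bound (b i)))))
    }
    where
    eq : ∀ a → 0ᶜ ≡ a -ᶜ a
    eq = solve-∀ ℂ-ring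
  quotient-bound (c ∷ p@(_ ∷ _)) = from (evM-lipschitz p) (quotient-bound p)
    where
    from : (Σ ℚ λ C → 0ℚ ≤ C × (∀ {z} → z ≼ 1ℚ → evM p z ≼ C) × (∀ {z w h} → z ≼ 1ℚ → w ≼ 1ℚ → z -ᶜ w ≼ h → evM p z -ᶜ evM p w ≼ C * h)) → QuotientBound p → QuotientBound (c ∷ p)
    from (F , 0≤F , bd , lip) Q = record
      { C = F + normX * C ; 0≤C = 0≤+ 0≤F (0≤* 0≤normX 0≤C)
      ; bound = λ {z} {u} {r} z≼ b i → ≼-mono (≼-+ (≼-* (bd z≼) (b i)) (X-bound (actM (quotM p z) u) (bound z≼ b) i)) (≤-reflexive (eq₁ F normX C r))
      ; lipschitz = λ {z} {w} {u} {h} {r} z≼ w≼ zw b i → subst (_≼ (F + normX * C) * (h * r))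
          (trans (cong ((evM p z -ᶜ evM p w) *ᶜ u i +ᶜ_) (X-sub (actM (quotM p z) u) (actM (quotM p w) u) i)) (eq₂ (evM p z) (evM p w) (u i) (X (actM (quotM p z) u) i) (X (actM (quotM p w) u) i)))
          (≼-mono (≼-+ (≼-* (lip z≼ w≼ zw) (b i)) (X-bound (λ j → actM (quotM p z) u j -ᶜ actM (quotM p w) u j) (lipschitz z≼ w≼ zw b) i)) (≤-reflexive (eq₃ F normX C h r)))
      }
      where
      open QuotientBound Q
      eq₁ : ∀ f a c r → f * r + a * (c * r) ≡ (f + a * c) * r
      eq₁ = solve-∀ ℚ-ring
      eq₂ : ∀ e f u x y → (e -ᶜ f) *ᶜ u +ᶜ (x -ᶜ y) ≡ (e *ᶜ u +ᶜ x) -ᶜ (f *ᶜ u +ᶜ y)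
      eq₂ = solve-∀ ℂ-ring
      eq₃ : ∀ f a c h r → f * h * r + a * (c * (h * r)) ≡ (f + a * c) * (h * r)
      eq₃ = solve-∀ ℚ-ring

  re-actM-real : ∀ {d} (p : Vec ℂ d) (x : Vecℚ n) i → re (actM p (λ j → ⟦ x j ⟧) i) ≡ actQ (Vec.map re p) x i
  re-actM-real [] x i = refl
  re-actM-real (c ∷ p) x i = trans (re-+ (c *ᶜ ⟦ x i ⟧) _) (cong₂ _+_ (trans (re-* c ⟦ x i ⟧) (eq (re c) (im c) (x i))) (·-cong (re-actM-real p x) i))
    where
    eq : ∀ a b x → a * x - b * 0ℚ ≡ a * x
    eq = solve-∀ ℚ-ring

  unit : Fin n → V
  unit l j = ⟦ δ l j ⟧

  unit≼1 : ∀ l j → unit l j ≼ 1ℚ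
  unit≼1 l j = re≼ (∣δ∣≤1 l j)
    where
    ∣δ∣≤1 : ∀ {n} (l j : Fin n) → ∣ δ l j ∣ ≤ 1ℚ
    ∣δ∣≤1 zero zero = ≤-refl
    ∣δ∣≤1 zero (suc j) = 0≤1
    ∣δ∣≤1 (suc l) zero = 0≤1
    ∣δ∣≤1 (suc l) (suc j) = ∣δ∣≤1 l j

  entries : ∀ {d} → Vec ℂ (suc d) → ℂ → Vecℚ (n ℕ.* n)
  entries P z p = re (actM (quotM P z) (unit (proj₂ (entry p))) (proj₁ (entry p)))

  -- The real parts of the coefficients of Q_z again form a monic polynomial of degree d, on which f
  -- is 1.
  entries-normalised : ∀ {d f} → Normalised d f → ∀ (P : Vec ℂ (suc d)) z → dot f (entries P z) ≡ 1ℚ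
  entries-normalised {f = f} norm P z = trans (dot-cong f (λ p → re-actM-real (quotM P z) (δ (proj₂ (entry p))) (proj₁ (entry p)))) (norm (Vec.map re (quotM P z)))

  re-sub : ∀ z w → re (z -ᶜ w) ≡ re z - re w
  re-sub z w = trans (re-+ z (-ᶜ w)) (cong (re z +_) (re-neg w))

  im-sub : ∀ z w → im (z -ᶜ w) ≡ im z - im w
  im-sub z w = trans (im-+ z (-ᶜ w)) (cong (im z +_) (im-neg w))

  scaled-recip : ∀ {C} → 0ℚ ≤ C → ∀ m → Σ ℕ λ M → C * (ℤ.+ 1 / suc M) ≤ ℤ.+ 1 / suc m
  scaled-recip {C} 0≤C m = from (inv⁺ (0<+ 0<1 0≤C))
    where
    from : (Σ ℚ λ i → 0ℚ < i × (1ℚ + C) * i ≡ 1ℚ) → Σ ℕ λ M → C * (ℤ.+ 1 / suc M) ≤ ℤ.+ 1 / suc m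
    from (i , 0<i , e) = proj₁ arch , ≤-trans (*-mono 0≤C (≤-by {C} {1ℚ + C} 0≤1 (+-comm 1ℚ C)) (<⇒≤ (0<recip (proj₁ arch))) (proj₂ arch))
        (≤-reflexive (trans (eq (1ℚ + C) (ℤ.+ 1 / suc m) i) (trans (cong ((ℤ.+ 1 / suc m) *_) e) (*-identityʳ _))))
      where
      arch : Σ ℕ λ M → ℤ.+ 1 / suc M ≤ (ℤ.+ 1 / suc m) * i
      arch = archimedean⁻ (0<* (0<recip m) 0<i)
      eq : ∀ a b c → a * (b * c) ≡ b * (a * c)
      eq = solve-∀ ℚ-ring

  module FromRoot {d : ℕ} (P : Vec ℚ (suc d)) (ann : Annihilates P) (f : Vecℚ (n ℕ.* n)) (norm : Normalised d f)
    (R : SmallRoot (Vec.map ⟦_⟧ P)) where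
    open SmallRoot R

    P′ : Vec ℂ (suc d)
    P′ = Vec.map ⟦_⟧ P

    open QuotientBound (quotient-bound P′)

    root≼1 : ∀ k → root k ≼ 1ℚ
    root≼1 k = ≼-mono (root≼ k) (≤-by (<⇒≤ 0<gap) (eq gap))
      where
      eq : ∀ g → 1ℚ ≡ 1ℚ - g + g
      eq = solve-∀ ℚ-ring

    -- Column l of Q_z(A) at the k-th approximate root z, an approximate right eigenvector.
    vec : Fin n → ℕ → V
    vec l k = actM (quotM P′ (root k)) (unit l)

    vec-lipschitz : ∀ l i {p q h} → root p -ᶜ root q ≼ h → vec l p i -ᶜ vec l q i ≼ C * h
    vec-lipschitz l i {p} {q} {h} b = subst (λ x → vec l p i -ᶜ vec l q i ≼ C * x) (*-identityʳ h) (lipschitz (root≼1 p) (root≼1 q) b (unit≼1 l) i)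

    vec-cauchy : ∀ l i m → Σ ℕ λ N → ∀ p q → N ℕ.≤ p → N ℕ.≤ q → vec l p i -ᶜ vec l q i ≼ ℤ.+ 1 / suc m
    vec-cauchy l i m = from (scaled-recip 0≤C m)
      where
      from : (Σ ℕ λ M → C * (ℤ.+ 1 / suc M) ≤ ℤ.+ 1 / suc m) → Σ ℕ λ N → ∀ p q → N ℕ.≤ p → N ℕ.≤ q → vec l p i -ᶜ vec l q i ≼ ℤ.+ 1 / suc m
      from (M , le) = M , λ p q M≤p M≤q → ≼-mono (vec-lipschitz l i (root-cauchy M p q M≤p M≤q)) le

    re-ℝ im-ℝ : (s : ℕ → ℂ) → (∀ m → Σ ℕ λ N → ∀ p q → N ℕ.≤ p → N ℕ.≤ q → s p -ᶜ s q ≼ ℤ.+ 1 / suc m) → ℝ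
    re-ℝ s c = mkℝ (λ k → re (s k)) λ m → proj₁ (c m) , λ p q p≥ q≥ → subst (λ x → ∣ x ∣ ≤ ℤ.+ 1 / suc m) (re-sub (s p) (s q)) (≼-re (proj₂ (c m) p q p≥ q≥))
    im-ℝ s c = mkℝ (λ k → im (s k)) λ m → proj₁ (c m) , λ p q p≥ q≥ → subst (λ x → ∣ x ∣ ≤ ℤ.+ 1 / suc m) (im-sub (s p) (s q)) (≼-im (proj₂ (c m) p q p≥ q≥))

    -- (A - z) Q_z(A) e_l = - P(z) e_l, since P(A) = 0.
    residual : ∀ l m p → m ℕ.≤ p → ∀ i → X (vec l p) i -ᶜ root p *ᶜ vec l p i ≼ ℤ.+ 1 / suc m
    residual l m p m≤p i = subst₂ _≼_ (sym residual≡) (*-identityʳ _) (≼-neg (≼-* (root-zero m p m≤p) (unit≼1 l i)))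
      where
      eq : ∀ a b → a +ᶜ (0ᶜ -ᶜ b) -ᶜ a ≡ -ᶜ b
      eq = solve-∀ ℂ-ring
      residual≡ : X (vec l p) i -ᶜ root p *ᶜ vec l p i ≡ -ᶜ (evM P′ (root p) *ᶜ unit l i)
      residual≡ = trans (cong (λ x → x -ᶜ root p *ᶜ vec l p i) (trans (actM-quot P′ (root p) (unit l) i)
          (cong (λ x → root p *ᶜ vec l p i +ᶜ (x -ᶜ evM P′ (root p) *ᶜ unit l i)) (annihilates-ℂ P ann (unit l) i))))
        (eq (root p *ᶜ vec l p i) (evM P′ (root p) *ᶜ unit l i))

    Sf : ℚ
    Sf = sumF (λ p → ∣ f p ∣)

    0≤Sf : 0ℚ ≤ Sf
    0≤Sf = 0≤sumF (λ p → 0≤∣p∣ (f p))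

    c-inv : Σ ℚ λ c → 0ℚ < c × (1ℚ + Sf) * c ≡ 1ℚ
    c-inv = inv⁺ (0<+ 0<1 0≤Sf)

    c : ℚ
    c = proj₁ c-inv

    0<c : 0ℚ < c
    0<c = proj₁ (proj₂ c-inv)

    -- If all entries were below c = 1/(1 + Σ|f_p|), the value 1 of f would be at most c Σ|f_p| < 1.
    large-entry : ∀ k → Σ (Fin (n ℕ.* n)) λ p → c ≤ ∣ entries P′ (root k) p ∣
    large-entry k = from (any? (λ p → c ≤? ∣ entries P′ (root k) p ∣))
      where
      from : Dec (Σ (Fin (n ℕ.* n)) λ p → c ≤ ∣ entries P′ (root k) p ∣) → Σ (Fin (n ℕ.* n)) λ p → c ≤ ∣ entries P′ (root k) p ∣
      from (yes p) = p
      from (no none) = ⊥-elim (<-irrefl refl (<-≤-trans Sfc<1 1≤Sfc))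
        where
        1≤Sfc : 1ℚ ≤ Sf * c
        1≤Sfc = ≤-trans (≤-reflexive (cong ∣_∣ (sym (entries-normalised {f = f} norm P′ (root k)))))
          (dot-bound f (entries P′ (root k)) (λ p → <⇒≤ (≰⇒> λ le → none (p , le))))
        Sfc<1 : Sf * c < 1ℚ
        Sfc<1 = subst₂ _<_ (+-identityʳ (Sf * c)) (trans (eq Sf c) (proj₂ (proj₂ c-inv))) (+-monoʳ-< (Sf * c) 0<c)
          where
          eq : ∀ s c → s * c + c ≡ (1ℚ + s) * c
          eq = solve-∀ ℚ-ring

    half-c : Σ ℕ λ m → ℤ.+ 1 / suc m ≤ c * ½
    half-c = archimedean⁻ (0<* 0<c (positive⁻¹ ½))

    m₀ : ℕ
    m₀ = proj₁ half-c

    M₀ : Σ ℕ λ M → C * (ℤ.+ 1 / suc M) ≤ ℤ.+ 1 / suc m₀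
    M₀ = scaled-recip 0≤C m₀

    large : Σ (Fin (n ℕ.* n)) λ p → c ≤ ∣ entries P′ (root (proj₁ M₀)) p ∣
    large = large-entry (proj₁ M₀)

    i₁ l₁ : Fin n
    i₁ = proj₁ (entry (proj₁ large))
    l₁ = proj₂ (entry (proj₁ large))

    -- The large entry could change its place with k. It is picked once, at an index beyond which
    -- entries differ from their value there by at most c/2, and so stays at least c/2.
    apart : Apart0 (λ k → re (vec l₁ k i₁))
    apart = m₀ , proj₁ M₀ , λ k k≥ → ≤-trans (proj₂ half-c) (≤-by (≤⇒0≤ (step k k≥)) (eq c ∣ re (vec l₁ k i₁) ∣))
      where
      eq : ∀ c a → a ≡ c * ½ + (c * ½ + a - c)
      eq = solve-∀ ℚ-ring
      eq′ : ∀ a b → a ≡ (a - b) + b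
      eq′ = solve-∀ ℚ-ring
      step : ∀ k → proj₁ M₀ ℕ.≤ k → c ≤ c * ½ + ∣ re (vec l₁ k i₁) ∣
      step k k≥ = ≤-trans (proj₂ large) (≤-trans (≤-reflexive (cong ∣_∣ (eq′ (re (vec l₁ (proj₁ M₀) i₁)) (re (vec l₁ k i₁)))))
        (≤-trans (∣p+q∣≤∣p∣+∣q∣ (re (vec l₁ (proj₁ M₀) i₁) - re (vec l₁ k i₁)) (re (vec l₁ k i₁))) (+-monoˡ-≤ ∣ re (vec l₁ k i₁) ∣ (≤-trans (≤-reflexive (cong ∣_∣ (sym (re-sub (vec l₁ (proj₁ M₀) i₁) (vec l₁ k i₁)))))
          (≤-trans (≼-re (vec-lipschitz l₁ i₁ (root-cauchy (proj₁ M₀) (proj₁ M₀) k ℕₚ.≤-refl k≥))) (≤-trans (proj₂ M₀) (proj₂ half-c)))))))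

    root-cauchy′ : ∀ m → Σ ℕ λ N → ∀ p q → N ℕ.≤ p → N ℕ.≤ q → root p -ᶜ root q ≼ ℤ.+ 1 / suc m
    root-cauchy′ m = m , root-cauchy m

    hasSmallEigenvalue : HasSmallEigenvalue A
    hasSmallEigenvalue = re-ℝ root root-cauchy′ , im-ℝ root root-cauchy′ ,
      (λ i → re-ℝ (λ k → vec l₁ k i) (vec-cauchy l₁ i)) , (λ i → im-ℝ (λ k → vec l₁ k i) (vec-cauchy l₁ i)) ,
      (λ i m → m , λ p m≤p → subst (λ x → ∣ x ∣ ≤ ℤ.+ 1 / suc m)
        (trans (re-sub (X (vec l₁ p) i) (root p *ᶜ vec l₁ p i)) (cong (λ x → re (X (vec l₁ p) i) - x) (re-* (root p) (vec l₁ p i)))) (≼-re (residual l₁ m p m≤p i))) ,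
      (λ i m → m , λ p m≤p → subst (λ x → ∣ x ∣ ≤ ℤ.+ 1 / suc m)
        (trans (im-sub (X (vec l₁ p) i) (root p *ᶜ vec l₁ p i)) (cong (λ x → im (X (vec l₁ p) i) - x) (trans (im-* (root p) (vec l₁ p i)) (+-comm (re (root p) * im (vec l₁ p i)) (im (root p) * re (vec l₁ p i)))))) (≼-im (residual l₁ m p m≤p i))) ,
      (i₁ , inj₁ apart) ,
      -- (1 - gap)² + r ≤ 1 whenever r ≤ gap ≤ 1.
      (proj₁ gap-recip , 0 , λ k _ → ≤-by (0≤+ (0≤+ (≤⇒0≤ (N≤ (root≼ k))) (≤⇒0≤ (proj₂ gap-recip))) (0≤* (<⇒≤ 0<gap) (≤⇒0≤ gap≤1))) (eq (N (root k)) gap (ℤ.+ 1 / suc (proj₁ gap-recip))))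
      where
      gap-recip : Σ ℕ λ m → ℤ.+ 1 / suc m ≤ gap
      gap-recip = archimedean⁻ 0<gap
      eq : ∀ N g r → 1ℚ ≡ N + r + (((1ℚ - g) * (1ℚ - g) - N) + (g - r) + g * (1ℚ - g))
      eq = solve-∀ ℚ-ring

-- Small eigenvalues obstruct digit systems

common-threshold : ∀ {n} (Q : Fin n → ℕ → Set) → (∀ i → Σ ℕ λ N → ∀ p → N ℕ.≤ p → Q i p) → Σ ℕ λ N → ∀ p → N ℕ.≤ p → ∀ i → Q i p
common-threshold {zero} Q h = 0 , λ _ _ ()
common-threshold {suc n} Q h = from (common-threshold (λ i → Q (suc i)) (λ i → h (suc i)))
  where
  from : (Σ ℕ λ N → ∀ p → N ℕ.≤ p → ∀ i → Q (suc i) p) → Σ ℕ λ N → ∀ p → N ℕ.≤ p → ∀ i → Q i p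
  from (N , g) = proj₁ (h zero) ℕ.⊔ N , λ p le → λ
    { zero → proj₂ (h zero) p (ℕₚ.≤-trans (ℕₚ.m≤m⊔n _ N) le)
    ; (suc i) → g p (ℕₚ.≤-trans (ℕₚ.m≤n⊔m (proj₁ (h zero)) N) le) i }

digit-bound : ∀ {n} (D : List (Vecℚ n)) → Σ ℚ λ Δ → 0ℚ ≤ Δ × (∀ {d} → d ∈ᵥ D → ∀ i → ∣ d i ∣ ≤ Δ)
digit-bound [] = 0ℚ , ≤-refl , λ ()
digit-bound (e ∷ D) = from (digit-bound D)
  where
  Se : ℚ
  Se = sumF (λ i → ∣ e i ∣)
  0≤Se : 0ℚ ≤ Se
  0≤Se = 0≤sumF (λ i → 0≤∣p∣ (e i))
  from : (Σ ℚ λ Δ → 0ℚ ≤ Δ × (∀ {d} → d ∈ᵥ D → ∀ i → ∣ d i ∣ ≤ Δ)) → Σ ℚ λ Δ → 0ℚ ≤ Δ × (∀ {d} → d ∈ᵥ (e ∷ D) → ∀ i → ∣ d i ∣ ≤ Δ)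
  from (Δ , 0≤Δ , b) = Se + Δ , 0≤+ 0≤Se 0≤Δ , λ
    { (here e≈d) i → ≤-trans (≤-reflexive (cong ∣_∣ (sym (e≈d i)))) (≤-trans (term≤sum (λ i → 0≤∣p∣ (e i)) i) (≤-by 0≤Δ refl))
    ; (there d∈) i → ≤-trans (b d∈ i) (≤-by 0≤Se (+-comm Se Δ)) }

module Obstruction {n : ℕ} (A : Mat n) where
  open Powers A
  open Operator A
  open Reduction A
  open Eigen A

  actM-+ : ∀ {d} (p : Vec ℂ d) v w → actM p (λ j → v j +ᶜ w j) ≋ (λ i → actM p v i +ᶜ actM p w i)
  actM-+ [] v w i = refl
  actM-+ (c ∷ cs) v w i = trans (cong (c *ᶜ (v i +ᶜ w i) +ᶜ_) (trans (X-cong (actM-+ cs v w) i) (X-+ (actM cs v) (actM cs w) i)))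
      (eq c (v i) (w i) (X (actM cs v) i) (X (actM cs w) i))
    where
    eq : ∀ c v w a b → c *ᶜ (v +ᶜ w) +ᶜ (a +ᶜ b) ≡ (c *ᶜ v +ᶜ a) +ᶜ (c *ᶜ w +ᶜ b)
    eq = solve-∀ ℂ-ring

  actM-* : ∀ {d} (p : Vec ℂ d) c v → actM p (λ j → c *ᶜ v j) ≋ (λ i → c *ᶜ actM p v i)
  actM-* [] c v i = refl
  actM-* (a ∷ p) c v i = trans (cong (a *ᶜ (c *ᶜ v i) +ᶜ_) (trans (X-cong (actM-* p c v) i) (X-* c (actM p v) i))) (eq a c (v i) (X (actM p v) i))
    where
    eq : ∀ a c v x → a *ᶜ (c *ᶜ v) +ᶜ c *ᶜ x ≡ c *ᶜ (a *ᶜ v +ᶜ x)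
    eq = solve-∀ ℂ-ring

  module _ {d : ℕ} (P : Vec ℚ (suc d)) (ann : Annihilates P) where
    P′ : Vec ℂ (suc d)
    P′ = Vec.map ⟦_⟧ P

    open QuotientBound (quotient-bound P′)

    Q : ℂ → V → V
    Q z = actM (quotM P′ z)

    QX : ∀ z v i → Q z (X v) i ≡ z *ᶜ Q z v i -ᶜ evM P′ z *ᶜ v i
    QX z v i = trans (actM-X (quotM P′ z) v i) (trans (actM-quot P′ z v i)
        (trans (cong (λ x → z *ᶜ Q z v i +ᶜ (x -ᶜ evM P′ z *ᶜ v i)) (annihilates-ℂ P ann v i)) (eq (z *ᶜ Q z v i) (evM P′ z *ᶜ v i))))
      where
      eq : ∀ a b → a +ᶜ (0ᶜ -ᶜ b) ≡ a -ᶜ b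
      eq = solve-∀ ℂ-ring

    -- Q_z(A)(Av - zv) = - P(z)v has entries at most Ce, while |v_i₀| ≥ c; so |P(z)| ≤ Ce/c.
    residual⇒root : ∀ {z v e c i₀} → z ≼ 1ℚ → 0ℚ < c → (∀ i → X v i -ᶜ z *ᶜ v i ≼ e) → c * c ≤ N (v i₀) → ∀ {τ} → 0ℚ ≤ τ → C * e ≤ τ * c → evM P′ z ≼ τ
    residual⇒root {z} {v} {e} {c} {i₀} z≼1 0<c res c≤ {τ} 0≤τ le = mk≼ 0≤τ (*-cancelʳ (c * c) (0<* 0<c 0<c)
        (≤-trans (*-monoˡ (N (evM P′ z)) (0≤N (evM P′ z)) c≤) (≤-trans (≤-reflexive (sym (N-* (evM P′ z) (v i₀)))) (≤-trans (N≤ (≼-mono Pv≼ le)) (≤-reflexive (eq τ c))))))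
      where
      eq : ∀ t c → t * c * (t * c) ≡ t * t * (c * c)
      eq = solve-∀ ℚ-ring
      r : V
      r j = X v j -ᶜ z *ᶜ v j
      Qr : ∀ i → Q z r i ≡ -ᶜ (evM P′ z *ᶜ v i)
      Qr i = trans (actM-+ (quotM P′ z) (X v) (λ j → -ᶜ (z *ᶜ v j)) i)
        (trans (cong₂ _+ᶜ_ (QX z v i) (trans (actM-cong (quotM P′ z) (λ j → eq₁ z (v j)) i) (actM-* (quotM P′ z) (-ᶜ z) v i))) (eq₂ z (Q z v i) (evM P′ z *ᶜ v i)))
        where
        eq₁ : ∀ z v → -ᶜ (z *ᶜ v) ≡ -ᶜ z *ᶜ v
        eq₁ = solve-∀ ℂ-ring
        eq₂ : ∀ z q b → z *ᶜ q -ᶜ b +ᶜ -ᶜ z *ᶜ q ≡ -ᶜ b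
        eq₂ = solve-∀ ℂ-ring
      Pv≼ : evM P′ z *ᶜ v i₀ ≼ C * e
      Pv≼ = subst (_≼ C * e) (trans (cong (λ x → -ᶜ x) (Qr i₀)) (eq₃ (evM P′ z *ᶜ v i₀))) (≼-neg (bound z≼1 res i₀))
        where
        eq₃ : ∀ a → -ᶜ (-ᶜ a) ≡ a
        eq₃ = solve-∀ ℂ-ring

    -- What the obstruction takes from an eigenvalue: |P| becomes arbitrarily small on one fixed
    -- disc of radius less than 1.
    ApproxRoots : Set
    ApproxRoots = Σ ℚ λ s → 0ℚ < s × s ≤ 1ℚ × (∀ τ → 0ℚ < τ → Σ ℂ λ z → z ≼ 1ℚ - s × evM P′ z ≼ τ)

    eigenvalue⇒approxRoots : HasSmallEigenvalue A → ApproxRoots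
    eigenvalue⇒approxRoots (a , b , x , y , eqx , eqy , (i₀ , ap) , (m₁ , N₁ , sm)) =
        s , 0<s , s≤1 , λ τ 0<τ → find τ 0<τ (apart ap)
      where
      s₂ s : ℚ
      s₂ = ℤ.+ 1 / suc m₁
      -- (1 - s₂/2)² ≥ 1 - s₂ converts the bound on the squared modulus into one on the modulus.
      s = s₂ * ½
      0<s : 0ℚ < s
      0<s = 0<* (0<recip m₁) (positive⁻¹ ½)
      s≤1 : s ≤ 1ℚ
      s≤1 = *-mono (<⇒≤ (0<recip m₁)) (recip≤1 m₁) 0≤½ ½≤1
      z : ℕ → ℂ
      z k = seq a k +i seq b k
      v : ℕ → V
      v k j = seq (x j) k +i seq (y j) k
      z≼ : ∀ k → N₁ ℕ.≤ k → z k ≼ 1ℚ - s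
      z≼ k k≥ = mk≼ (≤⇒0≤ s≤1) (≤-by (0≤+ (≤⇒0≤ (sm k k≥)) (0≤sq s)) (eq (N (z k)) s₂))
        where
        eq : ∀ N r → (1ℚ - r * ½) * (1ℚ - r * ½) ≡ N + ((1ℚ - (N + r)) + (r * ½) * (r * ½))
        eq = solve-∀ ℚ-ring
      apart : Apart0 (seq (x i₀)) ⊎ Apart0 (seq (y i₀)) → Σ ℕ λ m → Σ ℕ λ M → ∀ k → M ℕ.≤ k → (ℤ.+ 1 / suc m) * (ℤ.+ 1 / suc m) ≤ N (v k i₀)
      apart (inj₁ (m , M , h)) = m , M , λ k k≥ → ≤-trans (*-mono (<⇒≤ (0<recip m)) (h k k≥) (<⇒≤ (0<recip m)) (h k k≥))
        (≤-trans (≤-reflexive (abs-sq (seq (x i₀) k))) (≤-by (0≤sq (seq (y i₀) k)) refl))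
      apart (inj₂ (m , M , h)) = m , M , λ k k≥ → ≤-trans (*-mono (<⇒≤ (0<recip m)) (h k k≥) (<⇒≤ (0<recip m)) (h k k≥))
        (≤-trans (≤-reflexive (abs-sq (seq (y i₀) k))) (≤-by (0≤sq (seq (x i₀) k)) (+-comm _ (seq (y i₀) k * seq (y i₀) k))))
      res : ∀ {ε} k i → ∣ (A · (λ j → seq (x j) k)) i - (seq a k * seq (x i) k - seq b k * seq (y i) k) ∣ ≤ ε →
        ∣ (A · (λ j → seq (y j) k)) i - (seq b k * seq (x i) k + seq a k * seq (y i) k) ∣ ≤ ε → X (v k) i -ᶜ z k *ᶜ v k i ≼ ε + ε
      res {ε} k i p q = ≼-mono (≼‖‖ _) (+-mono-≤ p (≤-trans (≤-reflexive (cong (λ w → ∣ (A · (λ j → seq (y j) k)) i - w ∣) (+-comm (seq a k * seq (y i) k) (seq b k * seq (x i) k)))) q))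
      find : ∀ τ → 0ℚ < τ → (Σ ℕ λ m → Σ ℕ λ M → ∀ k → M ℕ.≤ k → (ℤ.+ 1 / suc m) * (ℤ.+ 1 / suc m) ≤ N (v k i₀)) → Σ ℂ λ z → z ≼ 1ℚ - s × evM P′ z ≼ τ
      find τ 0<τ (m , M , big) = from (inv⁺ (0<+ 0<1 (0≤+ 0≤C 0≤C)))
        where
        c₀ : ℚ
        c₀ = ℤ.+ 1 / suc m
        from : (Σ ℚ λ g → 0ℚ < g × (1ℚ + (C + C)) * g ≡ 1ℚ) → Σ ℂ λ z → z ≼ 1ℚ - s × evM P′ z ≼ τ
        from (g , 0<g , e) = tolerance (archimedean⁻ (0<* (0<* 0<τ (0<recip m)) 0<g))
          where
          tolerance : (Σ ℕ λ r → ℤ.+ 1 / suc r ≤ τ * c₀ * g) → Σ ℂ λ z → z ≼ 1ℚ - s × evM P′ z ≼ τ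
          tolerance (r , r≤) = at (common-threshold (λ i k → ∣ (A · (λ j → seq (x j) k)) i - (seq a k * seq (x i) k - seq b k * seq (y i) k) ∣ ≤ ε) (λ i → eqx i r))
                                  (common-threshold (λ i k → ∣ (A · (λ j → seq (y j) k)) i - (seq b k * seq (x i) k + seq a k * seq (y i) k) ∣ ≤ ε) (λ i → eqy i r))
            where
            ε : ℚ
            ε = ℤ.+ 1 / suc r
            at : (Σ ℕ λ M → ∀ k → M ℕ.≤ k → ∀ i → ∣ (A · (λ j → seq (x j) k)) i - (seq a k * seq (x i) k - seq b k * seq (y i) k) ∣ ≤ ε) →
                 (Σ ℕ λ M → ∀ k → M ℕ.≤ k → ∀ i → ∣ (A · (λ j → seq (y j) k)) i - (seq b k * seq (x i) k + seq a k * seq (y i) k) ∣ ≤ ε) →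
                 Σ ℂ λ z → z ≼ 1ℚ - s × evM P′ z ≼ τ
            at (M₁ , f₁) (M₂ , f₂) = z k , z≼ k k≥N₁ , residual⇒root {i₀ = i₀} (≼-mono (z≼ k k≥N₁) 1-s≤1) (0<recip m) (λ i → res k i (f₁ k k≥M₁ i) (f₂ k k≥M₂ i)) (big k k≥M) (<⇒≤ 0<τ) small
              where
              k : ℕ
              k = N₁ ℕ.+ (M ℕ.+ (M₁ ℕ.+ M₂))
              k≥N₁ : N₁ ℕ.≤ k
              k≥N₁ = ℕₚ.m≤m+n N₁ _
              k≥M : M ℕ.≤ k
              k≥M = ℕₚ.≤-trans (ℕₚ.m≤m+n M _) (ℕₚ.m≤n+m _ N₁)
              k≥M₁ : M₁ ℕ.≤ k
              k≥M₁ = ℕₚ.≤-trans (ℕₚ.m≤m+n M₁ M₂) (ℕₚ.≤-trans (ℕₚ.m≤n+m _ M) (ℕₚ.m≤n+m _ N₁))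
              k≥M₂ : M₂ ℕ.≤ k
              k≥M₂ = ℕₚ.≤-trans (ℕₚ.m≤n+m M₂ M₁) (ℕₚ.≤-trans (ℕₚ.m≤n+m _ M) (ℕₚ.m≤n+m _ N₁))
              1-s≤1 : 1ℚ - s ≤ 1ℚ
              1-s≤1 = ≤-by (<⇒≤ 0<s) (eq s)
                where
                eq : ∀ s → 1ℚ ≡ 1ℚ - s + s
                eq = solve-∀ ℚ-ring
              small : C * (ε + ε) ≤ τ * c₀
              small = ≤-trans (≤-reflexive (eq₁ C ε)) (≤-trans (*-mono (0≤+ 0≤C 0≤C) (≤-by {C + C} {1ℚ + (C + C)} 0≤1 (+-comm 1ℚ (C + C))) (<⇒≤ (0<recip r)) r≤)
                  (≤-reflexive (trans (eq₂ (1ℚ + (C + C)) (τ * c₀) g) (trans (cong (τ * c₀ *_) e) (*-identityʳ _)))))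
                where
                eq₁ : ∀ c e → c * (e + e) ≡ (c + c) * e
                eq₁ = solve-∀ ℚ-ring
                eq₂ : ∀ a b c → a * (b * c) ≡ b * (a * c)
                eq₂ = solve-∀ ℚ-ring

    real : Vecℚ n → V
    real w j = ⟦ w j ⟧

    mass : Vecℚ n → ℚ
    mass w = sumF (λ j → ∣ w j ∣)

    0≤mass : ∀ w → 0ℚ ≤ mass w
    0≤mass w = 0≤sumF (λ j → 0≤∣p∣ (w j))

    real≼mass : ∀ w j → real w j ≼ mass w
    real≼mass w j = re≼ (term≤sum (λ j → 0≤∣p∣ (w j)) j)

    -- Total size of the proper tails of a digit string: at an approximate root z each tail
    -- contributes an error of P(z) times itself.
    tails : Vecℚ n → List (Vecℚ n) → ℚ
    tails d [] = 0ℚ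
    tails d (e ∷ es) = tails e es + mass (horner A e es)

    0≤tails : ∀ d ds → 0ℚ ≤ tails d ds
    0≤tails d [] = ≤-refl
    0≤tails d (e ∷ es) = 0≤+ (0≤tails e es) (0≤mass (horner A e es))

    -- Q_z(A)(d + Ah) = Q_z(A)d + z Q_z(A)h - P(z)h with |z| ≤ 1 - s. Since sβ + (1 - s)β = β, the
    -- bound β reproduces itself, and the errors collect in `tails`.
    Q-horner : ∀ {z s τ Δ β D} → z ≼ 1ℚ - s → 0ℚ ≤ s → evM P′ z ≼ τ → (∀ {d} → d ∈ᵥ D → ∀ i → ∣ d i ∣ ≤ Δ) → C * Δ ≤ s * β → s ≤ 1ℚ → 0ℚ ≤ β →
      ∀ d ds → d ∈ᵥ D → All (_∈ᵥ D) ds → ∀ i → Q z (real (horner A d ds)) i ≼ β + τ * tails d ds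
    Q-horner {z} {s} {τ} {Δ} {β} {D} z≼ 0≤s Pz D≤ CΔ s≤1 0≤β = go
      where
      z≼1 : z ≼ 1ℚ
      z≼1 = ≼-mono z≼ (≤-by 0≤s (eq s))
        where
        eq : ∀ s → 1ℚ ≡ 1ℚ - s + s
        eq = solve-∀ ℚ-ring
      0≤τ : 0ℚ ≤ τ
      0≤τ = 0≤bound Pz
      Qd : ∀ {d} → d ∈ᵥ D → ∀ i → Q z (real d) i ≼ s * β
      Qd d∈ i = ≼-mono (bound z≼1 (λ j → re≼ (D≤ d∈ j)) i) CΔ
      go : ∀ d ds → d ∈ᵥ D → All (_∈ᵥ D) ds → ∀ i → Q z (real (horner A d ds)) i ≼ β + τ * tails d ds
      go d [] d∈ [] i = ≼-mono (Qd d∈ i) (≤-trans (≤-trans (*-monoʳ β 0≤β s≤1) (≤-reflexive (*-identityˡ β))) (≤-by (0≤* 0≤τ ≤-refl) refl))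
      go d (e ∷ es) d∈ (e∈ ∷ es∈) i = subst (_≼ β + τ * tails d (e ∷ es)) (sym split)
          (≼-mono (≼-+ (Qd d∈ i) (≼-sub (≼-* z≼ (go e es e∈ es∈ i)) (≼-* Pz (real≼mass h i)))) (≤-by (0≤* 0≤s (0≤* 0≤τ (0≤tails e es))) (eq s β τ (tails e es) (mass h))))
        where
        h : Vecℚ n
        h = horner A e es
        eq : ∀ s b t u m → b + t * (u + m) ≡ s * b + ((1ℚ - s) * (b + t * u) + t * m) + s * (t * u)
        eq = solve-∀ ℚ-ring
        X-real : ∀ w j → ⟦ (A · w) j ⟧ ≡ X (real w) j
        X-real w j = cong ((A · w) j +i_) (sym (dot-0 (A j) (λ _ → refl)))
        split : Q z (real (d ⊕ (A · h))) i ≡ Q z (real d) i +ᶜ (z *ᶜ Q z (real h) i -ᶜ evM P′ z *ᶜ real h i)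
        split = trans (actM-cong (quotM P′ z) (λ j → cong (λ w → ⟦ d j ⟧ +ᶜ w) (X-real h j)) i)
          (trans (actM-+ (quotM P′ z) (real d) (X (real h)) i) (cong (Q z (real d) i +ᶜ_) (QX z (real h) i)))

    module _ (f : Vecℚ (n ℕ.* n)) (norm : Normalised d f) (D : List (Vecℚ n)) (fin : ∀ v → InZA A v → InDA A D v) where

      -- The order of choices matters: M from β, then digit strings for the vectors M e_l, then τ
      -- against the tails of these strings, and only then z. As f is 1 on Q_z(A), M = f(M Q_z(A)) ≤
      -- Sf (1 + β) < M.
      no-approxRoots : ApproxRoots → ⊥
      no-approxRoots (s , 0<s , s≤1 , roots) = with-Δ (digit-bound D) (inv⁺ 0<s)
        where
        with-Δ : (Σ ℚ λ Δ → 0ℚ ≤ Δ × (∀ {d} → d ∈ᵥ D → ∀ i → ∣ d i ∣ ≤ Δ)) → (Σ ℚ λ g → 0ℚ < g × s * g ≡ 1ℚ) → ⊥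
        with-Δ (Δ , 0≤Δ , D≤) (g , 0<g , sg) = with-M (archimedean ((1ℚ + Sf) * (1ℚ + β)))
          where
          Sf β : ℚ
          Sf = sumF (λ p → ∣ f p ∣)
          -- CΔ/s, the fixed point of the contraction in `Q-horner`.
          β = C * Δ * g
          0≤β : 0ℚ ≤ β
          0≤β = 0≤* (0≤* 0≤C 0≤Δ) (<⇒≤ 0<g)
          CΔ≤ : C * Δ ≤ s * β
          CΔ≤ = ≤-reflexive (sym (trans (eq s (C * Δ) g) (trans (cong (C * Δ *_) sg) (*-identityʳ _))))
            where
            eq : ∀ a b c → a * (b * c) ≡ b * (a * c)
            eq = solve-∀ ℚ-ring
          with-M : (Σ ℕ λ M → (1ℚ + Sf) * (1ℚ + β) ≤ ι M) → ⊥
          with-M (M , M≥) = with-g (inv⁺ (0<+ 0<1 0≤T))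
            where
            target : Fin n → Vecℚ n
            target l i = ι M * δ l i
            δ-int : ∀ {n} (l i : Fin n) → IsInt (δ l i)
            δ-int zero zero = int-ι 1
            δ-int zero (suc i) = int-ι 0
            δ-int (suc l) zero = int-ι 0
            δ-int (suc l) (suc i) = δ-int l i
            rep : ∀ l → InDA A D (target l)
            rep l = fin (target l) (target l , [] , (λ i → int-mul (int-ι M) (δ-int l i)) , [] , λ i → refl)
            tail : Fin n → ℚ
            tail l = tails (proj₁ (rep l)) (proj₁ (proj₂ (rep l)))
            0≤tail : ∀ l → 0ℚ ≤ tail l
            0≤tail l = 0≤tails (proj₁ (rep l)) (proj₁ (proj₂ (rep l)))
            T : ℚ
            T = sumF tail
            0≤T : 0ℚ ≤ T
            0≤T = 0≤sumF 0≤tail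
            with-g : (Σ ℚ λ τ → 0ℚ < τ × (1ℚ + T) * τ ≡ 1ℚ) → ⊥
            with-g (τ , 0<τ , Tτ) = with-z (roots τ 0<τ)
              where
              with-z : (Σ ℂ λ z → z ≼ 1ℚ - s × evM P′ z ≼ τ) → ⊥
              with-z (z , z≼ , Pz) = <-irrefl refl (<-≤-trans (<-≤-trans strict M≥) M≤)
                where
                τtail≤1 : ∀ l → τ * tail l ≤ 1ℚ
                τtail≤1 l = ≤-trans (*-monoˡ τ (<⇒≤ 0<τ) (≤-trans (term≤sum 0≤tail l) (≤-by {T} {1ℚ + T} 0≤1 (+-comm 1ℚ T)))) (≤-reflexive (trans (*-comm τ (1ℚ + T)) Tτ))
                Q-rep : ∀ l (r : InDA A D (target l)) → τ * tails (proj₁ r) (proj₁ (proj₂ r)) ≤ 1ℚ → ∀ i → ⟦ ι M ⟧ *ᶜ Q z (unit l) i ≼ 1ℚ + β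
                Q-rep l (d , ds , d∈ , ds∈ , e) le i = subst (_≼ 1ℚ + β) scaled (≼-mono (Q-horner z≼ (<⇒≤ 0<s) Pz D≤ CΔ≤ s≤1 0≤β d ds d∈ ds∈ i) (≤-trans (+-monoʳ-≤ β le) (≤-reflexive (+-comm β 1ℚ))))
                  where
                  scaled : Q z (real (horner A d ds)) i ≡ ⟦ ι M ⟧ *ᶜ Q z (unit l) i
                  scaled = trans (actM-cong (quotM P′ z) (λ j → trans (cong ⟦_⟧ (sym (e j))) (⟦⟧-* (ι M) (δ l j))) i) (actM-* (quotM P′ z) ⟦ ι M ⟧ (unit l) i)
                entry≤ : ∀ p → ∣ ι M * entries P′ z p ∣ ≤ 1ℚ + β
                entry≤ p = subst (λ w → ∣ w ∣ ≤ 1ℚ + β) (trans (re-* ⟦ ι M ⟧ q) (eq (ι M) (re q) (im q))) (≼-re (Q-rep l (rep l) (τtail≤1 l) i))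
                  where
                  i l : Fin n
                  i = proj₁ (entry p)
                  l = proj₂ (entry p)
                  q : ℂ
                  q = Q z (unit l) i
                  eq : ∀ m a b → m * a - 0ℚ * b ≡ m * a
                  eq = solve-∀ ℚ-ring
                M≤ : ι M ≤ Sf * (1ℚ + β)
                M≤ = ≤-trans (≤-reflexive (trans (sym (0≤p⇒∣p∣≡p (0≤ι M))) (cong ∣_∣ (sym (trans (dot-* f (ι M) (entries P′ z)) (trans (cong (ι M *_) (entries-normalised {f = f} norm P′ z)) (*-identityʳ (ι M))))))))
                  (dot-bound f (λ p → ι M * entries P′ z p) entry≤)
                strict : Sf * (1ℚ + β) < (1ℚ + Sf) * (1ℚ + β)
                strict = subst₂ _<_ (+-identityʳ (Sf * (1ℚ + β))) (eq Sf (1ℚ + β)) (+-monoʳ-< (Sf * (1ℚ + β)) (0<+ 0<1 0≤β))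
                  where
                  eq : ∀ s b → s * b + b ≡ (1ℚ + s) * b
                  eq = solve-∀ ℚ-ring

theorem1 : (n : ℕ) → 1 ℕ.≤ n → (A : Mat n) →
    (((Σ (List (Vecℚ n)) λ D → DigitSystem A D × Finiteness A D) → ¬ HasSmallEigenvalue A)
    × (¬ HasSmallEigenvalue A → Σ (List (Vecℚ n)) λ D → DigitSystem A D × Finiteness A D))
    × (¬ HasSmallEigenvalue A →
    Σ (List (Vecℚ n)) λ D → All Integral D × DigitSystem A D × Finiteness A D)
theorem1 (suc n) (ℕ.s≤s _) A = from (minimal-polynomial zero)
  where
  open Powers A
  open Reduction A
  open Digits A
  open Obstruction A
  from : MinimalPolynomial →
    (((Σ (List (Vecℚ (suc n))) λ D → DigitSystem A D × Finiteness A D) → ¬ HasSmallEigenvalue A)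
    × (¬ HasSmallEigenvalue A → Σ (List (Vecℚ (suc n))) λ D → DigitSystem A D × Finiteness A D))
    × (¬ HasSmallEigenvalue A → Σ (List (Vecℚ (suc n))) λ D → All Integral D × DigitSystem A D × Finiteness A D)
  from (d , (P , ann) , (f , norm)) = (necessary , λ h → proj₁ (sufficient h) , proj₂ (proj₂ (sufficient h))) , sufficient
    where
    necessary : (Σ (List (Vecℚ (suc n))) λ D → DigitSystem A D × Finiteness A D) → ¬ HasSmallEigenvalue A
    necessary (D , _ , (fin , _)) h = no-approxRoots P ann f norm D fin (eigenvalue⇒approxRoots P ann h)
    sufficient : ¬ HasSmallEigenvalue A → Σ (List (Vecℚ (suc n))) λ D → All Integral D × DigitSystem A D × Finiteness A D
    -- Accuracy ½ is enough to invert A, which fixes the digits; finer ε are requested later,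
    -- according to the vector to be expanded.
    sufficient h = Construct.digitSystem (reduced⇒inverse zero (reduce ½ (positive⁻¹ ½))) reduce
      where
      reduce : ∀ ε → 0ℚ < ε → Reduced ε
      reduce = height-reduction P ann (λ R → h (Eigen.FromRoot.hasSmallEigenvalue A P ann f norm R))
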